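{- Let $n$ be a positive integer and let $S=S_1\cup S_2\subseteq T_{8n}\setminus\{e\}$ be nonempty with $S=S^{ -1}$, where $S_1\subseteq \langle a\rangle\cup\langle a\rangle b^2$ and $S_2\subseteq\langle a\rangle b\cup\langle a\rangle b^3$. Then the Cayley graph $\mathrm{Cay}(T_{8n},S)$ is integral if and only if the following conditions hold for all $j=0,1,\dots,7$ and all $k,h=1,2,\dots,n-1$: (1) $\chi_j(S)$ is an integer; (2) $\varphi_k(S_1)$ and $\varphi_k(S_1^2)+\varphi_k(S_2^2)$ are integers; (3) $\Delta_{\varphi_k}(S)=2\left(\varphi_k(S_1^2)+\varphi_k(S_2^2)\right)-\left(\varphi_k(S_1)\right)^2$ is a perfect square; (4) $\psi_h(S_1)$ and $\psi_h(S_1^2)+\psi_h(S_2^2)$ are integers; (5) $\Delta_{\psi_h}(S)=2\left(\psi_h(S_1^2)+\psi_h(S_2^2)\right)-\left(\psi_h(S_1)\right)^2$ is a perfect square.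
   Context: $T_{8n}=\langle a,b\mid a^{2n}=b^8=e,\ a^n=b^4,\ b^{ -1}ab=a^{ -1}\rangle$ is a group of order $8n$; its elements are $a^r b^s$ with $0\le r\le 2n-1$, $0\le s\le 3$ (each written uniquely in this form). For a finite group $G$ with identity $e$ and a nonempty $S\subseteq G\setminus\{e\}$ with $S=S^{ -1}$, $\mathrm{Cay}(G,S)$ is the graph with vertex set $G$ in which $x,y$ are adjacent iff $xy^{ -1}\in S$. A graph is integral if all eigenvalues of its adjacency matrix are integers. A perfect square means the square of an integer. Let $\omega=\exp(\pi\mathbf i/4)$, $\varepsilon=\exp(2\pi\mathbf i/n)$, $\xi=\exp(\pi\mathbf i/n)$, $\mathbf i^2=-1$. The characters $\chi_j$ ($0\le j\le 7$), $\varphi_k$ ($1\le k\le n-1$), $\psi_h$ ($1\le h\le n-1$) of $T_{8n}$ have the following values ($0\le r\le 2n-1$). If $n$ is odd: $\chi_j(a^rb^s)=(-1)^{rj}\omega^{sj}$ for $s=0,1,2,3$; $\varphi_k(a^r)=\varepsilon^{kr}+\varepsilon^{ -kr}$, $\varphi_k(a^rb^2)=(-1)^k(\varepsilon^{kr}+\varepsilon^{ -kr})$, $\varphi_k(a^rb)=\varphi_k(a^rb^3)=0$; $\psi_h(a^r)=(-1)^{rh+r}(\xi^{hr}+\xi^{ -hr})$, $\psi_h(a^rb^2)=\mathbf i(-1)^{rh+r}(\xi^{hr}+\xi^{ -hr})$, $\psi_h(a^rb)=\psi_h(a^rb^3)=0$. If $n$ is even: $\chi_j(a^rb^s)=\omega^{sj}$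 for $j\in\{0,2,4,6\}$ and $\chi_j(a^rb^s)=(-1)^r\omega^{s(j-1)}$ for $j\in\{1,3,5,7\}$, $s=0,1,2,3$; $\varphi_k(a^r)=\xi^{kr}+\xi^{ -kr}$, $\varphi_k(a^rb^2)=\xi^{kr}+\xi^{ -kr}$ for $k$ even and $\mathbf i(\xi^{kr}+\xi^{ -kr})$ for $k$ odd, $\varphi_k(a^rb)=\varphi_k(a^rb^3)=0$; $\psi_h(a^r)=\xi^{hr}+\xi^{ -hr}$, $\psi_h(a^rb^2)=-(\xi^{hr}+\xi^{ -hr})$ for $h$ even and $-\mathbf i(\xi^{hr}+\xi^{ -hr})$ for $h$ odd, $\psi_h(a^rb)=\psi_h(a^rb^3)=0$. For a character $\chi$ and subsets $A,B$ of the group: $\chi(\emptyset)=0$, $\chi(A)=\sum_{x\in A}\chi(x)$, $\chi(AB)=\sum_{x\in A,\,y\in B}\chi(xy)$ (sum over all pairs, i.e. with multiplicity), and $\chi(A^2)=\chi(AA)$. -}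

module Defs where

open import Level using (Level; _⊔_) renaming (suc to lsuc)
open import Algebra.Apartness.Bundles using (HeytingField)
open import Algebra.Bundles using (CommutativeRing; Group)
open import Algebra.Structures using (IsGroup)
import Algebra.Properties.Group as GroupProperties
import Algebra.Properties.Monoid.Mult as Power
import Algebra.Properties.Semiring.Exp as Exp
import Algebra.Properties.Semiring.Mult as Mult
import Algebra.Properties.Semiring.Sum as Sum
open import Data.Bool.Base using (Bool; if_then_else_; _∧_)
open import Data.Fin.Base using (Fin; toℕ; fromℕ<)
open import Data.Fin.Patterns using (0F; 1F; 2F; 3F)
open import Data.Fin.Properties as Fin using (all?; *↔×; toℕ-injective; toℕ-fromℕ<; toℕ<n)
open import Data.Integer.Base as ℤ using (ℤ; +_; -[1+_]; 0ℤ; 1ℤ; -1ℤ)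
import Data.Integer.DivMod as ℤ
import Data.Integer.Properties as ℤ
open import Data.Integer.Tactic.RingSolver using (solve-∀)
open import Data.Nat.Base as ℕ using (ℕ; zero; suc; NonZero)
import Data.Nat.DivMod as ℕ
import Data.Nat.Properties as ℕ
open import Data.Nat.Divisibility using (_∣?_)
open import Data.Product.Base using (_×_; _,_; ∃; proj₁; proj₂)
open import Data.Vec.Functional using (Vector)
open import Function.Base using (_∘_)
open import Function.Bundles using (_↔_; Inverse; mk↔ₛ′)
open import Function.Construct.Composition using (_↔-∘_)
open import Relation.Binary.Core using (Rel)
open import Relation.Binary.Definitions using (Symmetric; Irreflexive) renaming (Decidable to Decidable₂)
open import Relation.Binary.PropositionalEquality
open import Relation.Nullary.Decidable using (does; toWitness)
open import Relation.Nullary.Negation using (¬_)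
open import Relation.Unary using (Pred; Decidable; _∈_; _∉_; _≐_)

private variable
  c ℓ₁ ℓ₂ p : Level

-- The library has no complex numbers.  The statement needs only that ℂ is
-- an algebraically closed field of characteristic 0.  `_#?_` is excluded
-- middle for equality of scalars, which holds for ℂ classically and for the
-- algebraic numbers constructively.

record AlgClosedField₀ c ℓ₁ ℓ₂ : Set (lsuc (c ⊔ ℓ₁ ⊔ ℓ₂)) where
  field
    heytingField : HeytingField c ℓ₁ ℓ₂

  open HeytingField heytingField public

  commutativeRing : CommutativeRing c ℓ₁
  commutativeRing = record { isCommutativeRing = isCommutativeRing }

  open CommutativeRing commutativeRing public using (semiring)
  open Exp semiring public using (_^_)
  open Mult semiring public using () renaming (_×_ to _·_)
  open Sum semiring public using (sum)

  field
    _#?_      : Decidable₂ _#_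
    char-zero : ∀ m → suc m · 1# # 0#
    root      : ∀ m (q : Vector Carrier (suc m)) →
                ∃ λ x → x ^ suc m + sum (λ i → q i * x ^ toℕ i) ≈ 0#

module Scalars (K : AlgClosedField₀ c ℓ₁ ℓ₂) where
  open AlgClosedField₀ K

  fromℤ : ℤ → Carrier
  fromℤ (+ m)    = m · 1#
  fromℤ -[1+ m ] = - (suc m · 1#)

  IsInteger : Pred Carrier ℓ₁
  IsInteger x = ∃ λ z → x ≈ fromℤ z

  IsPerfectSquare : Pred Carrier ℓ₁
  IsPerfectSquare x = ∃ λ z → x ≈ fromℤ (z ℤ.* z)

  ∑ : ∀ {m} {V : Set} → Fin m ↔ V → (V → Carrier) → Carrier
  ∑ enum f = sum (f ∘ Inverse.to enum)

record PrimitiveRoot (K : AlgClosedField₀ c ℓ₁ ℓ₂) (N : ℕ) : Set (c ⊔ ℓ₁ ⊔ ℓ₂) where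
  open AlgClosedField₀ K
  field
    ζ ζ⁻¹     : Carrier
    inverse   : ζ * ζ⁻¹ ≈ 1#
    ζ^N≈1     : ζ ^ N ≈ 1#
    minimal   : ∀ {m} → 0 ℕ.< m → m ℕ.< N → ζ ^ m # 1#

record SimpleGraph p : Set (lsuc p) where
  field
    order  : ℕ
    Vertex : Set
    enum   : Fin order ↔ Vertex
    _~_    : Rel Vertex p
    _~?_   : Decidable₂ _~_
    symm   : Symmetric _~_
    irrefl : Irreflexive _≡_ _~_

module Spectrum (K : AlgClosedField₀ c ℓ₁ ℓ₂) (Γ : SimpleGraph p) where
  open AlgClosedField₀ K
  open Scalars K
  open SimpleGraph Γ using (Vertex; enum; _~?_)

  adjacency : Vertex → Vertex → Carrier
  adjacency x y = if does (x ~? y) then 1# else 0#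

  IsEigenvalue : Pred Carrier (c ⊔ ℓ₁ ⊔ ℓ₂)
  IsEigenvalue μ = ∃ λ (v : Vertex → Carrier) →
    (∃ λ x → v x # 0#) × (∀ x → ∑ enum (λ y → adjacency x y * v y) ≈ μ * v x)

  Integral : Set (c ⊔ ℓ₁ ⊔ ℓ₂)
  Integral = ∀ μ → IsEigenvalue μ → IsInteger μ

record FiniteGroup : Set₁ where
  infixl 7 _∙_
  infix 8 _⁻¹
  field
    Carrier : Set
    _∙_     : Carrier → Carrier → Carrier
    ε       : Carrier
    _⁻¹     : Carrier → Carrier
    isGroup : IsGroup _≡_ _∙_ ε _⁻¹
    order   : ℕ
    enum    : Fin order ↔ Carrier

  open IsGroup isGroup public using (inverseˡ; inverseʳ; assoc; identityˡ; identityʳ)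

  group : Group _ _
  group = record { isGroup = isGroup }

  _⁻¹ˢ : Pred Carrier p → Pred Carrier p
  (S ⁻¹ˢ) y = ∃ λ x → x ∈ S × y ≡ x ⁻¹

module _ (G : FiniteGroup) {S : Pred (FiniteGroup.Carrier G) p} where
  open FiniteGroup G

  Cay : Decidable S → ε ∉ S → S ≐ S ⁻¹ˢ → SimpleGraph p
  Cay S? ε∉S S≐S⁻¹ = record
    { order  = order
    ; Vertex = Carrier
    ; enum   = enum
    ; _~_    = λ x y → x ∙ y ⁻¹ ∈ S
    ; _~?_   = λ x y → S? (x ∙ y ⁻¹)
    ; symm   = λ {x} {y} xy⁻¹∈S → proj₂ S≐S⁻¹ (x ∙ y ⁻¹ , xy⁻¹∈S , flip x y)
    ; irrefl = λ { {x} refl xx⁻¹∈S → ε∉S (subst S (inverseʳ x) xx⁻¹∈S) }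
    }
    where
    open GroupProperties group
    flip : ∀ x y → y ∙ x ⁻¹ ≡ (x ∙ y ⁻¹) ⁻¹
    flip x y = sym (trans (⁻¹-anti-homo-∙ x (y ⁻¹)) (cong (_∙ x ⁻¹) (⁻¹-involutive y)))

infix 9 a^_b^_
data Normal (n : ℕ) : Set where
  a^_b^_ : Fin (2 ℕ.* n) → Fin 4 → Normal n

module Presentation (n : ℕ) .{{_ : NonZero n}} where

  instance
    2n≢0 : NonZero (2 ℕ.* n)
    2n≢0 = ℕ.m*n≢0 2 n

  infixl 6 _⊕_
  infixl 7 _∙_
  infix 8 _⁻¹

  residue : ℤ → Fin (2 ℕ.* n)
  residue i = fromℕ< (ℤ.n%ℕd<d i (2 ℕ.* n))

  _⊕_ : Fin 4 → Fin 4 → Fin 4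
  s ⊕ u = (toℕ s ℕ.+ toℕ u) ℕ.mod 4

  carry : Fin 4 → Fin 4 → ℤ
  carry s u = + ((toℕ s ℕ.+ toℕ u) ℕ./ 4)

  sign : Fin 4 → ℤ
  sign s = -1ℤ ℤ.^ toℕ s

  -- The relations give bˢ aᵗ = a^((-1)ˢ t) bˢ, and b⁴ = aⁿ absorbs the carry.
  _∙_ : Normal n → Normal n → Normal n
  (a^ r b^ s) ∙ (a^ t b^ u) =
    a^ residue (+ toℕ r ℤ.+ sign s ℤ.* + toℕ t ℤ.+ carry s u ℤ.* + n) b^ (s ⊕ u)

  ε : Normal n
  ε = a^ residue 0ℤ b^ 0F

  _⁻¹ : Normal n → Normal n
  (a^ r b^ 0F) ⁻¹ = a^ residue (ℤ.- + toℕ r) b^ 0F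
  (a^ r b^ 1F) ⁻¹ = a^ residue (+ toℕ r ℤ.- + n) b^ 3F
  (a^ r b^ 2F) ⁻¹ = a^ residue (ℤ.- + toℕ r ℤ.- + n) b^ 2F
  (a^ r b^ 3F) ⁻¹ = a^ residue (+ toℕ r ℤ.- + n) b^ 1F

  quot : ℤ → ℤ
  quot i = i ℤ./ℕ (2 ℕ.* n)

  2n : ℤ
  2n = + 2 ℤ.* + n

  +2n : + (2 ℕ.* n) ≡ 2n
  +2n = ℤ.pos-* 2 n

  divide : ∀ i → i ≡ + toℕ (residue i) ℤ.+ quot i ℤ.* 2n
  divide i = trans (ℤ.a≡a%ℕn+[a/ℕn]*n i (2 ℕ.* n))
    (cong₂ (λ x y → + x ℤ.+ quot i ℤ.* y) (sym (toℕ-fromℕ< (ℤ.n%ℕd<d i (2 ℕ.* n)))) +2n)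

  remainder : ∀ i → + toℕ (residue i) ≡ i ℤ.- quot i ℤ.* 2n
  remainder i = trans (lemma (+ toℕ (residue i)) (quot i ℤ.* 2n)) (cong (ℤ._- (quot i ℤ.* 2n)) (sym (divide i)))
    where
    lemma : ∀ x y → x ≡ (x ℤ.+ y) ℤ.- y
    lemma = solve-∀

  unique-ℕ : ∀ (x y : Fin (2 ℕ.* n)) k → toℕ x ≡ toℕ y ℕ.+ k ℕ.* (2 ℕ.* n) → x ≡ y
  unique-ℕ x y k eq = toℕ-injective (begin
    toℕ x                                       ≡⟨ ℕ.m<n⇒m%n≡m (toℕ<n x) ⟨
    toℕ x ℕ.% (2 ℕ.* n)                         ≡⟨ cong (λ i → i ℕ.% (2 ℕ.* n)) eq ⟩
    (toℕ y ℕ.+ k ℕ.* (2 ℕ.* n)) ℕ.% (2 ℕ.* n)   ≡⟨ ℕ.[m+kn]%n≡m%n (toℕ y) k (2 ℕ.* n) ⟩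
    toℕ y ℕ.% (2 ℕ.* n)                         ≡⟨ ℕ.m<n⇒m%n≡m (toℕ<n y) ⟩
    toℕ y                                       ∎)
    where open ≡-Reasoning

  unique : ∀ (x y : Fin (2 ℕ.* n)) k → + toℕ x ≡ + toℕ y ℤ.+ k ℤ.* 2n → x ≡ y
  unique x y (+ k) eq = unique-ℕ x y k (ℤ.+-injective (trans eq
    (cong (λ i → + toℕ y ℤ.+ i) (sym (trans (ℤ.pos-* k _) (cong (λ i → + k ℤ.* i) +2n))))))
  unique x y -[1+ k ] eq = sym (unique-ℕ y x (suc k) (ℤ.+-injective (trans
    (trans (lemma (+ toℕ y) -[1+ k ] 2n) (cong (ℤ._+ (+ suc k ℤ.* 2n)) (sym eq)))
    (cong (λ i → + toℕ x ℤ.+ i) (sym (trans (ℤ.pos-* (suc k) _) (cong (λ i → + suc k ℤ.* i) +2n)))))))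
    where
    lemma : ∀ y k m → y ≡ (y ℤ.+ k ℤ.* m) ℤ.+ (ℤ.- k) ℤ.* m
    lemma = solve-∀

  residue-cong : ∀ k i j → i ≡ j ℤ.+ k ℤ.* 2n → residue i ≡ residue j
  residue-cong k i j eq = unique (residue i) (residue j) (quot j ℤ.+ k ℤ.- quot i) (begin
    + toℕ (residue i)                                           ≡⟨ remainder i ⟩
    i ℤ.- quot i ℤ.* 2n                                         ≡⟨ cong (ℤ._- (quot i ℤ.* 2n)) eq ⟩
    j ℤ.+ k ℤ.* 2n ℤ.- quot i ℤ.* 2n                            ≡⟨ lemma j k (quot i) (quot j) 2n ⟩
    (j ℤ.- quot j ℤ.* 2n) ℤ.+ (quot j ℤ.+ k ℤ.- quot i) ℤ.* 2n
      ≡⟨ cong (ℤ._+ ((quot j ℤ.+ k ℤ.- quot i) ℤ.* 2n)) (remainder j) ⟨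
    + toℕ (residue j) ℤ.+ (quot j ℤ.+ k ℤ.- quot i) ℤ.* 2n      ∎)
    where
    open ≡-Reasoning
    lemma : ∀ j k p q m → j ℤ.+ k ℤ.* m ℤ.- p ℤ.* m ≡ (j ℤ.- q ℤ.* m) ℤ.+ (q ℤ.+ k ℤ.- p) ℤ.* m
    lemma = solve-∀

  residue-toℕ : ∀ r → residue (+ toℕ r) ≡ r
  residue-toℕ r = unique (residue (+ toℕ r)) r (ℤ.- quot (+ toℕ r))
    (trans (remainder (+ toℕ r)) (lemma (+ toℕ r) (quot (+ toℕ r)) 2n))
    where
    lemma : ∀ r q m → r ℤ.- q ℤ.* m ≡ r ℤ.+ (ℤ.- q) ℤ.* m
    lemma = solve-∀

  half : Fin 4 → ℤ
  half s = + (toℕ s ℕ.% 2)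

  sign≡1-2half : ∀ s → sign s ≡ 1ℤ ℤ.- + 2 ℤ.* half s
  sign≡1-2half = toWitness {a? = all? λ s → sign s ℤ.≟ 1ℤ ℤ.- + 2 ℤ.* half s} _

  sign-⊕ : ∀ s u → sign (s ⊕ u) ≡ sign s ℤ.* sign u
  sign-⊕ = toWitness {a? = all? λ s → all? λ u → sign (s ⊕ u) ℤ.≟ sign s ℤ.* sign u} _

  carry-assoc : ∀ s u w → carry s u ≡ carry u w ℤ.+ carry s (u ⊕ w) ℤ.- carry (s ⊕ u) w
  carry-assoc = toWitness {a? = all? λ s → all? λ u → all? λ w →
    carry s u ℤ.≟ carry u w ℤ.+ carry s (u ⊕ w) ℤ.- carry (s ⊕ u) w} _

  carry-identityˡ : ∀ s → carry 0F s ≡ 0ℤ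
  carry-identityˡ = toWitness {a? = all? λ s → carry 0F s ℤ.≟ 0ℤ} _

  carry-identityʳ : ∀ s → carry s 0F ≡ 0ℤ
  carry-identityʳ = toWitness {a? = all? λ s → carry s 0F ℤ.≟ 0ℤ} _

  ⊕-assoc : ∀ s u w → (s ⊕ u) ⊕ w ≡ s ⊕ (u ⊕ w)
  ⊕-assoc = toWitness {a? = all? λ s → all? λ u → all? λ w →
    (s ⊕ u) ⊕ w Fin.≟ s ⊕ (u ⊕ w)} _

  ⊕-identityˡ : ∀ s → 0F ⊕ s ≡ s
  ⊕-identityˡ = toWitness {a? = all? λ s → 0F ⊕ s Fin.≟ s} _

  ⊕-identityʳ : ∀ s → s ⊕ 0F ≡ s
  ⊕-identityʳ = toWitness {a? = all? λ s → s ⊕ 0F Fin.≟ s} _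

  -- aⁱ bˢ for an arbitrary integer i
  ⟦_,_⟧ : ℤ → Fin 4 → Normal n
  ⟦ i , s ⟧ = a^ residue i b^ s

  ⟦⟧-cong : ∀ k i j s → i ≡ j ℤ.+ k ℤ.* 2n → ⟦ i , s ⟧ ≡ ⟦ j , s ⟧
  ⟦⟧-cong k i j s eq = cong (a^_b^ s) (residue-cong k i j eq)

  ⟦⟧-toℕ : ∀ r s → a^ r b^ s ≡ ⟦ + toℕ r , s ⟧
  ⟦⟧-toℕ r s = cong (a^_b^ s) (sym (residue-toℕ r))

  ∙-⟦⟧ : ∀ i s j u → ⟦ i , s ⟧ ∙ ⟦ j , u ⟧ ≡ ⟦ i ℤ.+ sign s ℤ.* j ℤ.+ carry s u ℤ.* + n , s ⊕ u ⟧
  ∙-⟦⟧ i s j u = ⟦⟧-cong (ℤ.- quot i ℤ.- sign s ℤ.* quot j) _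
    (i ℤ.+ sign s ℤ.* j ℤ.+ carry s u ℤ.* + n) (s ⊕ u)
    (trans (cong₂ (λ x y → x ℤ.+ sign s ℤ.* y ℤ.+ carry s u ℤ.* + n) (remainder i) (remainder j))
           (lemma i (sign s) j (carry s u ℤ.* + n) (quot i) (quot j) 2n))
    where
    lemma : ∀ i σ j c q q′ m →
      (i ℤ.- q ℤ.* m) ℤ.+ σ ℤ.* (j ℤ.- q′ ℤ.* m) ℤ.+ c
      ≡ (i ℤ.+ σ ℤ.* j ℤ.+ c) ℤ.+ (ℤ.- q ℤ.- σ ℤ.* q′) ℤ.* m
    lemma = solve-∀

  ∙-assoc : ∀ x y z → (x ∙ y) ∙ z ≡ x ∙ (y ∙ z)
  ∙-assoc (a^ r b^ s) (a^ t b^ u) (a^ v b^ w) = begin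
    ⟦ X , s ⊕ u ⟧ ∙ (a^ v b^ w)        ≡⟨ cong (⟦ X , s ⊕ u ⟧ ∙_) (⟦⟧-toℕ v w) ⟩
    ⟦ X , s ⊕ u ⟧ ∙ ⟦ + toℕ v , w ⟧    ≡⟨ ∙-⟦⟧ X (s ⊕ u) (+ toℕ v) w ⟩
    ⟦ Z , (s ⊕ u) ⊕ w ⟧                ≡⟨ cong ⟦ Z ,_⟧ (⊕-assoc s u w) ⟩
    ⟦ Z , s ⊕ (u ⊕ w) ⟧                ≡⟨ ⟦⟧-cong (half s ℤ.* carry u w) Z Z′ (s ⊕ (u ⊕ w)) eq ⟩
    ⟦ Z′ , s ⊕ (u ⊕ w) ⟧               ≡⟨ ∙-⟦⟧ (+ toℕ r) s Y (u ⊕ w) ⟨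
    ⟦ + toℕ r , s ⟧ ∙ ⟦ Y , u ⊕ w ⟧    ≡⟨ cong (_∙ ⟦ Y , u ⊕ w ⟧) (⟦⟧-toℕ r s) ⟨
    (a^ r b^ s) ∙ ⟦ Y , u ⊕ w ⟧        ∎
    where
    open ≡-Reasoning
    X Y Z Z′ : ℤ
    X  = + toℕ r ℤ.+ sign s ℤ.* + toℕ t ℤ.+ carry s u ℤ.* + n
    Y  = + toℕ t ℤ.+ sign u ℤ.* + toℕ v ℤ.+ carry u w ℤ.* + n
    Z  = X ℤ.+ sign (s ⊕ u) ℤ.* + toℕ v ℤ.+ carry (s ⊕ u) w ℤ.* + n
    Z′ = + toℕ r ℤ.+ sign s ℤ.* Y ℤ.+ carry s (u ⊕ w) ℤ.* + n
    lemma : ∀ r t v n h σu c₁ c₂ c₃ →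
      (r ℤ.+ (1ℤ ℤ.- + 2 ℤ.* h) ℤ.* t ℤ.+ (c₂ ℤ.+ c₃ ℤ.- c₁) ℤ.* n)
        ℤ.+ ((1ℤ ℤ.- + 2 ℤ.* h) ℤ.* σu) ℤ.* v ℤ.+ c₁ ℤ.* n
      ≡ (r ℤ.+ (1ℤ ℤ.- + 2 ℤ.* h) ℤ.* (t ℤ.+ σu ℤ.* v ℤ.+ c₂ ℤ.* n) ℤ.+ c₃ ℤ.* n)
        ℤ.+ (h ℤ.* c₂) ℤ.* (+ 2 ℤ.* n)
    lemma = solve-∀
    exponents : ∀ r t v n h σu c₁ c₂ c₃ {σs σsu c₀} →
      σs ≡ 1ℤ ℤ.- + 2 ℤ.* h → σsu ≡ σs ℤ.* σu → c₀ ≡ c₂ ℤ.+ c₃ ℤ.- c₁ →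
      (r ℤ.+ σs ℤ.* t ℤ.+ c₀ ℤ.* n) ℤ.+ σsu ℤ.* v ℤ.+ c₁ ℤ.* n
      ≡ (r ℤ.+ σs ℤ.* (t ℤ.+ σu ℤ.* v ℤ.+ c₂ ℤ.* n) ℤ.+ c₃ ℤ.* n) ℤ.+ (h ℤ.* c₂) ℤ.* (+ 2 ℤ.* n)
    exponents r t v n h σu c₁ c₂ c₃ refl refl refl = lemma r t v n h σu c₁ c₂ c₃
    eq : Z ≡ Z′ ℤ.+ (half s ℤ.* carry u w) ℤ.* 2n
    eq = exponents (+ toℕ r) (+ toℕ t) (+ toℕ v) (+ n) (half s) (sign u)
      (carry (s ⊕ u) w) (carry u w) (carry s (u ⊕ w))
      (sign≡1-2half s) (sign-⊕ s u) (carry-assoc s u w)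

  ∙-identityˡ : ∀ x → ε ∙ x ≡ x
  ∙-identityˡ (a^ r b^ s) = begin
    ε ∙ (a^ r b^ s)                                            ≡⟨ cong (ε ∙_) (⟦⟧-toℕ r s) ⟩
    ⟦ 0ℤ , 0F ⟧ ∙ ⟦ + toℕ r , s ⟧                              ≡⟨ ∙-⟦⟧ 0ℤ 0F (+ toℕ r) s ⟩
    ⟦ 0ℤ ℤ.+ 1ℤ ℤ.* + toℕ r ℤ.+ carry 0F s ℤ.* + n , 0F ⊕ s ⟧
      ≡⟨ cong₂ (λ c → ⟦ 0ℤ ℤ.+ 1ℤ ℤ.* + toℕ r ℤ.+ c ℤ.* + n ,_⟧) (carry-identityˡ s) (⊕-identityˡ s) ⟩
    ⟦ 0ℤ ℤ.+ 1ℤ ℤ.* + toℕ r ℤ.+ 0ℤ ℤ.* + n , s ⟧               ≡⟨ cong ⟦_, s ⟧ (lemma (+ toℕ r) (+ n)) ⟩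
    ⟦ + toℕ r , s ⟧                                            ≡⟨ ⟦⟧-toℕ r s ⟨
    a^ r b^ s                                                  ∎
    where
    open ≡-Reasoning
    lemma : ∀ r n → 0ℤ ℤ.+ 1ℤ ℤ.* r ℤ.+ 0ℤ ℤ.* n ≡ r
    lemma = solve-∀

  ∙-identityʳ : ∀ x → x ∙ ε ≡ x
  ∙-identityʳ (a^ r b^ s) = begin
    (a^ r b^ s) ∙ ε                                            ≡⟨ cong (_∙ ε) (⟦⟧-toℕ r s) ⟩
    ⟦ + toℕ r , s ⟧ ∙ ⟦ 0ℤ , 0F ⟧                              ≡⟨ ∙-⟦⟧ (+ toℕ r) s 0ℤ 0F ⟩
    ⟦ + toℕ r ℤ.+ sign s ℤ.* 0ℤ ℤ.+ carry s 0F ℤ.* + n , s ⊕ 0F ⟧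
      ≡⟨ cong₂ (λ c → ⟦ + toℕ r ℤ.+ sign s ℤ.* 0ℤ ℤ.+ c ℤ.* + n ,_⟧) (carry-identityʳ s) (⊕-identityʳ s) ⟩
    ⟦ + toℕ r ℤ.+ sign s ℤ.* 0ℤ ℤ.+ 0ℤ ℤ.* + n , s ⟧           ≡⟨ cong ⟦_, s ⟧ (lemma (+ toℕ r) (sign s) (+ n)) ⟩
    ⟦ + toℕ r , s ⟧                                            ≡⟨ ⟦⟧-toℕ r s ⟨
    a^ r b^ s                                                  ∎
    where
    open ≡-Reasoning
    lemma : ∀ r σ n → r ℤ.+ σ ℤ.* 0ℤ ℤ.+ 0ℤ ℤ.* n ≡ r
    lemma = solve-∀

  ∙-⟦⟧≡ε : ∀ k i s j u → s ⊕ u ≡ 0F →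
    i ℤ.+ sign s ℤ.* j ℤ.+ carry s u ℤ.* + n ≡ 0ℤ ℤ.+ k ℤ.* 2n → ⟦ i , s ⟧ ∙ ⟦ j , u ⟧ ≡ ε
  ∙-⟦⟧≡ε k i s j u s⊕u≡0 eq = trans (∙-⟦⟧ i s j u)
    (trans (⟦⟧-cong k _ 0ℤ (s ⊕ u) eq) (cong ⟦ 0ℤ ,_⟧ s⊕u≡0))

  ⁻¹-inverseˡ : ∀ x → x ⁻¹ ∙ x ≡ ε
  ⁻¹-inverseˡ (a^ r b^ s) = trans (cong ((a^ r b^ s) ⁻¹ ∙_) (⟦⟧-toℕ r s)) (go s)
    where
    lemma₀ : ∀ r n → ℤ.- r ℤ.+ 1ℤ ℤ.* r ℤ.+ 0ℤ ℤ.* n ≡ 0ℤ ℤ.+ 0ℤ ℤ.* (+ 2 ℤ.* n)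
    lemma₀ = solve-∀
    lemma₁ : ∀ r n → (r ℤ.- n) ℤ.+ -1ℤ ℤ.* r ℤ.+ 1ℤ ℤ.* n ≡ 0ℤ ℤ.+ 0ℤ ℤ.* (+ 2 ℤ.* n)
    lemma₁ = solve-∀
    lemma₂ : ∀ r n → (ℤ.- r ℤ.- n) ℤ.+ 1ℤ ℤ.* r ℤ.+ 1ℤ ℤ.* n ≡ 0ℤ ℤ.+ 0ℤ ℤ.* (+ 2 ℤ.* n)
    lemma₂ = solve-∀
    go : ∀ s → (a^ r b^ s) ⁻¹ ∙ ⟦ + toℕ r , s ⟧ ≡ ε
    go 0F = ∙-⟦⟧≡ε 0ℤ (ℤ.- + toℕ r) 0F (+ toℕ r) 0F refl (lemma₀ (+ toℕ r) (+ n))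
    go 1F = ∙-⟦⟧≡ε 0ℤ (+ toℕ r ℤ.- + n) 3F (+ toℕ r) 1F refl (lemma₁ (+ toℕ r) (+ n))
    go 2F = ∙-⟦⟧≡ε 0ℤ (ℤ.- + toℕ r ℤ.- + n) 2F (+ toℕ r) 2F refl (lemma₂ (+ toℕ r) (+ n))
    go 3F = ∙-⟦⟧≡ε 0ℤ (+ toℕ r ℤ.- + n) 1F (+ toℕ r) 3F refl (lemma₁ (+ toℕ r) (+ n))

  ⁻¹-inverseʳ : ∀ x → x ∙ x ⁻¹ ≡ ε
  ⁻¹-inverseʳ (a^ r b^ s) = trans (cong (_∙ (a^ r b^ s) ⁻¹) (⟦⟧-toℕ r s)) (go s)
    where
    lemma₀ : ∀ r n → r ℤ.+ 1ℤ ℤ.* (ℤ.- r) ℤ.+ 0ℤ ℤ.* n ≡ 0ℤ ℤ.+ 0ℤ ℤ.* (+ 2 ℤ.* n)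
    lemma₀ = solve-∀
    lemma₁ : ∀ r n → r ℤ.+ -1ℤ ℤ.* (r ℤ.- n) ℤ.+ 1ℤ ℤ.* n ≡ 0ℤ ℤ.+ 1ℤ ℤ.* (+ 2 ℤ.* n)
    lemma₁ = solve-∀
    lemma₂ : ∀ r n → r ℤ.+ 1ℤ ℤ.* (ℤ.- r ℤ.- n) ℤ.+ 1ℤ ℤ.* n ≡ 0ℤ ℤ.+ 0ℤ ℤ.* (+ 2 ℤ.* n)
    lemma₂ = solve-∀
    go : ∀ s → ⟦ + toℕ r , s ⟧ ∙ (a^ r b^ s) ⁻¹ ≡ ε
    go 0F = ∙-⟦⟧≡ε 0ℤ (+ toℕ r) 0F (ℤ.- + toℕ r) 0F refl (lemma₀ (+ toℕ r) (+ n))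
    go 1F = ∙-⟦⟧≡ε 1ℤ (+ toℕ r) 1F (+ toℕ r ℤ.- + n) 3F refl (lemma₁ (+ toℕ r) (+ n))
    go 2F = ∙-⟦⟧≡ε 0ℤ (+ toℕ r) 2F (ℤ.- + toℕ r ℤ.- + n) 2F refl (lemma₂ (+ toℕ r) (+ n))
    go 3F = ∙-⟦⟧≡ε 1ℤ (+ toℕ r) 3F (+ toℕ r ℤ.- + n) 1F refl (lemma₁ (+ toℕ r) (+ n))

  exponents : (Fin (2 ℕ.* n) × Fin 4) ↔ Normal n
  exponents = mk↔ₛ′ to from to∘from (λ _ → refl)
    where
    to : Fin (2 ℕ.* n) × Fin 4 → Normal n
    to (r , s) = a^ r b^ s
    from : Normal n → Fin (2 ℕ.* n) × Fin 4
    from (a^ r b^ s) = r , s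
    to∘from : ∀ x → to (from x) ≡ x
    to∘from (a^ r b^ s) = refl

  T : FiniteGroup
  T = record
    { Carrier = Normal n
    ; _∙_     = _∙_
    ; ε       = ε
    ; _⁻¹     = _⁻¹
    ; isGroup = record
      { isMonoid = record
        { isSemigroup = record
          { isMagma = record { isEquivalence = isEquivalence ; ∙-cong = cong₂ _∙_ }
          ; assoc   = ∙-assoc
          }
        ; identity = ∙-identityˡ , ∙-identityʳ
        }
      ; inverse = ⁻¹-inverseˡ , ⁻¹-inverseʳ
      ; ⁻¹-cong = cong _⁻¹
      }
    ; order   = 2 ℕ.* n ℕ.* 4
    ; enum    = exponents ↔-∘ *↔×
    }

  -- T satisfies the defining relations and is generated by a and b.  The
  -- presented group has at most 8n elements, so T realises it.

  open Power (Group.monoid (FiniteGroup.group T)) using (×-homo-+)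
    renaming (_×_ to power)
  open GroupProperties (FiniteGroup.group T) using (\\-leftDividesʳ)

  a b : Normal n
  a = ⟦ 1ℤ , 0F ⟧
  b = ⟦ 0ℤ , 1F ⟧

  a-power : ∀ m → power m a ≡ ⟦ + m , 0F ⟧
  a-power zero    = refl
  a-power (suc m) = trans (cong (a ∙_) (a-power m)) (trans (∙-⟦⟧ 1ℤ 0F (+ m) 0F)
    (cong ⟦_, 0F ⟧ (lemma (+ m) (+ n))))
    where
    lemma : ∀ m n → 1ℤ ℤ.+ 1ℤ ℤ.* m ℤ.+ 0ℤ ℤ.* n ≡ 1ℤ ℤ.+ m
    lemma = solve-∀

  b-power : ∀ s → power (toℕ s) b ≡ ⟦ 0ℤ , s ⟧
  b-power s = go s
    where
    lemma : ∀ n → 0ℤ ℤ.+ -1ℤ ℤ.* 0ℤ ℤ.+ 0ℤ ℤ.* n ≡ 0ℤ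
    lemma = solve-∀
    step : ∀ {x} s → x ≡ ⟦ 0ℤ , s ⟧ → carry 1F s ≡ 0ℤ → b ∙ x ≡ ⟦ 0ℤ , 1F ⊕ s ⟧
    step s refl c≡0 = trans (∙-⟦⟧ 0ℤ 1F 0ℤ s) (cong ⟦_, 1F ⊕ s ⟧
      (trans (cong (λ c → 0ℤ ℤ.+ -1ℤ ℤ.* 0ℤ ℤ.+ c ℤ.* + n) c≡0) (lemma (+ n))))
    b¹ : power 1 b ≡ ⟦ 0ℤ , 1F ⟧
    b¹ = step 0F refl refl
    b² : power 2 b ≡ ⟦ 0ℤ , 2F ⟧
    b² = step 1F b¹ refl
    go : ∀ s → power (toℕ s) b ≡ ⟦ 0ℤ , s ⟧
    go 0F = refl
    go 1F = b¹
    go 2F = b²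
    go 3F = step 2F b² refl

  a²ⁿ≡ε : power (2 ℕ.* n) a ≡ ε
  a²ⁿ≡ε = trans (a-power (2 ℕ.* n)) (⟦⟧-cong 1ℤ _ 0ℤ 0F (trans +2n (lemma (+ n))))
    where
    lemma : ∀ n → + 2 ℤ.* n ≡ 0ℤ ℤ.+ 1ℤ ℤ.* (+ 2 ℤ.* n)
    lemma = solve-∀

  aⁿ≡b⁴ : power n a ≡ power 4 b
  aⁿ≡b⁴ = trans (a-power n) (sym (trans (cong (b ∙_) (b-power 3F)) (trans (∙-⟦⟧ 0ℤ 1F 0ℤ 3F)
    (cong ⟦_, 0F ⟧ (lemma (+ n))))))
    where
    lemma : ∀ n → 0ℤ ℤ.+ -1ℤ ℤ.* 0ℤ ℤ.+ 1ℤ ℤ.* n ≡ n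
    lemma = solve-∀

  b⁸≡ε : power 8 b ≡ ε
  b⁸≡ε = begin
    power 8 b                ≡⟨ ×-homo-+ b 4 4 ⟩
    power 4 b ∙ power 4 b    ≡⟨ cong₂ _∙_ aⁿ≡b⁴ aⁿ≡b⁴ ⟨
    power n a ∙ power n a    ≡⟨ ×-homo-+ a n n ⟨
    power (n ℕ.+ n) a        ≡⟨ cong (λ m → power (n ℕ.+ m) a) (ℕ.+-identityʳ n) ⟨
    power (2 ℕ.* n) a        ≡⟨ a²ⁿ≡ε ⟩
    ε                        ∎
    where open ≡-Reasoning

  b⁻¹ab≡a⁻¹ : b ⁻¹ ∙ (a ∙ b) ≡ a ⁻¹
  b⁻¹ab≡a⁻¹ = trans (cong (b ⁻¹ ∙_) ab≡ba⁻¹) (\\-leftDividesʳ b (a ⁻¹))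
    where
    lemma₁ : ∀ q m → ℤ.- (1ℤ ℤ.- q ℤ.* m) ≡ -1ℤ ℤ.+ q ℤ.* m
    lemma₁ = solve-∀
    a⁻¹≡ : a ⁻¹ ≡ ⟦ -1ℤ , 0F ⟧
    a⁻¹≡ = ⟦⟧-cong (quot 1ℤ) _ -1ℤ 0F
      (trans (cong ℤ.-_ (remainder 1ℤ)) (lemma₁ (quot 1ℤ) 2n))
    lemma₂ : ∀ n → 1ℤ ℤ.+ 1ℤ ℤ.* 0ℤ ℤ.+ 0ℤ ℤ.* n ≡ 0ℤ ℤ.+ -1ℤ ℤ.* -1ℤ ℤ.+ 0ℤ ℤ.* n
    lemma₂ = solve-∀
    ab≡ba⁻¹ : a ∙ b ≡ b ∙ a ⁻¹
    ab≡ba⁻¹ = begin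
      a ∙ b                        ≡⟨ ∙-⟦⟧ 1ℤ 0F 0ℤ 1F ⟩
      ⟦ 1ℤ ℤ.+ 1ℤ ℤ.* 0ℤ ℤ.+ 0ℤ ℤ.* + n , 1F ⟧      ≡⟨ cong ⟦_, 1F ⟧ (lemma₂ (+ n)) ⟩
      ⟦ 0ℤ ℤ.+ -1ℤ ℤ.* -1ℤ ℤ.+ 0ℤ ℤ.* + n , 1F ⟧    ≡⟨ ∙-⟦⟧ 0ℤ 1F -1ℤ 0F ⟨
      b ∙ ⟦ -1ℤ , 0F ⟧             ≡⟨ cong (b ∙_) a⁻¹≡ ⟨
      b ∙ a ⁻¹                     ∎
      where open ≡-Reasoning

  normal-form : ∀ r s → a^ r b^ s ≡ power (toℕ r) a ∙ power (toℕ s) b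
  normal-form r s = sym (begin
    power (toℕ r) a ∙ power (toℕ s) b    ≡⟨ cong₂ _∙_ (a-power (toℕ r)) (b-power s) ⟩
    ⟦ + toℕ r , 0F ⟧ ∙ ⟦ 0ℤ , s ⟧        ≡⟨ ∙-⟦⟧ (+ toℕ r) 0F 0ℤ s ⟩
    ⟦ + toℕ r ℤ.+ 1ℤ ℤ.* 0ℤ ℤ.+ carry 0F s ℤ.* + n , 0F ⊕ s ⟧
      ≡⟨ cong₂ (λ c → ⟦ + toℕ r ℤ.+ 1ℤ ℤ.* 0ℤ ℤ.+ c ℤ.* + n ,_⟧) (carry-identityˡ s) (⊕-identityˡ s) ⟩
    ⟦ + toℕ r ℤ.+ 1ℤ ℤ.* 0ℤ ℤ.+ 0ℤ ℤ.* + n , s ⟧    ≡⟨ cong ⟦_, s ⟧ (lemma (+ toℕ r) (+ n)) ⟩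
    ⟦ + toℕ r , s ⟧                      ≡⟨ ⟦⟧-toℕ r s ⟨
    a^ r b^ s                            ∎)
    where
    open ≡-Reasoning
    lemma : ∀ r n → r ℤ.+ 1ℤ ℤ.* 0ℤ ℤ.+ 0ℤ ℤ.* n ≡ r
    lemma = solve-∀

T : (n : ℕ) .{{_ : NonZero n}} → FiniteGroup
T n = Presentation.T n

⟨a⟩b^ : ∀ {n} → Fin 4 → Pred (Normal n) _
⟨a⟩b^ s x = ∃ λ r → x ≡ a^ r b^ s

module CharacterSums (K : AlgClosedField₀ c ℓ₁ ℓ₂) (G : FiniteGroup) where
  open AlgClosedField₀ K using (0#) renaming (Carrier to Scalar)
  open Scalars K
  open FiniteGroup G

  infix 10 _⟪_⟫ _⟪_·_⟫ _⟪_²⟫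

  _⟪_⟫ : (Carrier → Scalar) → {A : Pred Carrier p} → Decidable A → Scalar
  χ ⟪ A? ⟫ = ∑ enum λ x → if does (A? x) then χ x else 0#

  _⟪_·_⟫ : (Carrier → Scalar) → {A B : Pred Carrier p} → Decidable A → Decidable B → Scalar
  χ ⟪ A? · B? ⟫ = ∑ enum λ x → ∑ enum λ y →
    if does (A? x) ∧ does (B? y) then χ (x ∙ y) else 0#

  _⟪_²⟫ : (Carrier → Scalar) → {A : Pred Carrier p} → Decidable A → Scalar
  χ ⟪ A? ²⟫ = χ ⟪ A? · A? ⟫

isEven : ℕ → Bool
isEven m = does (2 ∣? m)

-- With ζ = exp(2πi/8n) in ℂ, the roots of unity below are the usual
-- ω = exp(πi/4), ξ = exp(πi/n), ε = exp(2πi/n) and i.  They are taken as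
-- powers of one ζ so that they are compatible as in ℂ, e.g. ω = ξ for n = 4.

module Characters (K : AlgClosedField₀ c ℓ₁ ℓ₂) (n : ℕ) (prim : PrimitiveRoot K (8 ℕ.* n)) where
  open AlgClosedField₀ K
  open PrimitiveRoot prim

  ω i ξ ξ⁻¹ ε ε⁻¹ : Carrier
  ω   = ζ ^ n
  i   = ω ^ 2
  ξ   = ζ ^ 4
  ξ⁻¹ = ζ⁻¹ ^ 4
  ε   = ζ ^ 8
  ε⁻¹ = ζ⁻¹ ^ 8

  [-1]^ : ℕ → Carrier
  [-1]^ m = (- 1#) ^ m

  ξ± ε± : ℕ → Carrier
  ξ± m = ξ ^ m + ξ⁻¹ ^ m
  ε± m = ε ^ m + ε⁻¹ ^ m

  module Odd where
    χ : Fin 8 → Normal n → Carrier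
    χ j (a^ r b^ s) = [-1]^ (toℕ r ℕ.* toℕ j) * ω ^ (toℕ s ℕ.* toℕ j)

    φ : ℕ → Normal n → Carrier
    φ k (a^ r b^ 0F) = ε± (k ℕ.* toℕ r)
    φ k (a^ r b^ 1F) = 0#
    φ k (a^ r b^ 2F) = [-1]^ k * ε± (k ℕ.* toℕ r)
    φ k (a^ r b^ 3F) = 0#

    ψ : ℕ → Normal n → Carrier
    ψ h (a^ r b^ 0F) = [-1]^ (toℕ r ℕ.* h ℕ.+ toℕ r) * ξ± (h ℕ.* toℕ r)
    ψ h (a^ r b^ 1F) = 0#
    ψ h (a^ r b^ 2F) = i * [-1]^ (toℕ r ℕ.* h ℕ.+ toℕ r) * ξ± (h ℕ.* toℕ r)
    ψ h (a^ r b^ 3F) = 0#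

  module Even where
    χ : Fin 8 → Normal n → Carrier
    χ j (a^ r b^ s) = if isEven (toℕ j)
      then ω ^ (toℕ s ℕ.* toℕ j)
      else [-1]^ (toℕ r) * ω ^ (toℕ s ℕ.* (toℕ j ℕ.∸ 1))

    φ : ℕ → Normal n → Carrier
    φ k (a^ r b^ 0F) = ξ± (k ℕ.* toℕ r)
    φ k (a^ r b^ 1F) = 0#
    φ k (a^ r b^ 2F) = if isEven k then ξ± (k ℕ.* toℕ r) else i * ξ± (k ℕ.* toℕ r)
    φ k (a^ r b^ 3F) = 0#

    ψ : ℕ → Normal n → Carrier
    ψ h (a^ r b^ 0F) = ξ± (h ℕ.* toℕ r)
    ψ h (a^ r b^ 1F) = 0#
    ψ h (a^ r b^ 2F) = if isEven h then - ξ± (h ℕ.* toℕ r) else - (i * ξ± (h ℕ.* toℕ r))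
    ψ h (a^ r b^ 3F) = 0#

  χ : Fin 8 → Normal n → Carrier
  χ = if isEven n then Even.χ else Odd.χ

  -- φ and ψ are characters for 1 ≤ k , h < n.
  φ ψ : ℕ → Normal n → Carrier
  φ = if isEven n then Even.φ else Odd.φ
  ψ = if isEven n then Even.ψ else Odd.ψ

module Discriminant (K : AlgClosedField₀ c ℓ₁ ℓ₂) (G : FiniteGroup) where
  open AlgClosedField₀ K using (_+_; _-_; _^_; _·_) renaming (Carrier to Scalar)
  open FiniteGroup G using (Carrier)
  open CharacterSums K G

  module _ {A B : Pred Carrier p} (A? : Decidable A) (B? : Decidable B) where
    squares : (Carrier → Scalar) → Scalar
    squares χ = χ ⟪ A? ²⟫ + χ ⟪ B? ²⟫

    Δ : (Carrier → Scalar) → Scalar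
    Δ χ = 2 · squares χ - χ ⟪ A? ⟫ ^ 2

{-# OPTIONS --safe #-}

-- The adjacency operator of Cay(G, S) is v ↦ (x ↦ Σ_{z ∈ S} v(zx)), so for a representation ρ of G every
-- row vector w with w ρ(S) = μ w yields the eigenfunctions x ↦ (w ρ(x))ⱼ.  The irreducible representations of
-- T₈ₙ have degree at most two: the linear ones give the eigenvalues χ(S), and in degree two
-- ρ(a) = diag(α, α⁻¹), ρ(b) = (0 c; 1 0), so that ρ(S₁) is diagonal and ρ(S₂) anti-diagonal.  The two
-- eigenvalues μ, ν of ρ(S) therefore satisfy μ + ν = tr ρ(S₁), μ² + ν² = tr ρ(S₁)² + tr ρ(S₂)² and
-- (μ - ν)² = Δ, and they are integers precisely if tr ρ(S₁) and μ² + ν² are integers and Δ is a square.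
-- Conversely an eigenvector v may be translated so that v(e) ≠ 0; by Fourier inversion at e some matrix
-- coefficient of Σₓ v(x⁻¹) ρ(x) at a pair (α, c) = (ξᵏ, ± iᵏ) is nonzero, which makes the eigenvalue of v
-- a root of the characteristic polynomial of ρ(S).
module Submission where

open import Defs
open import Level using (_⊔_)
open import Algebra.Bundles using (CommutativeRing; Monoid)
import Algebra.Apartness.Properties.HeytingCommutativeRing as HCR
import Algebra.Properties.AbelianGroup as AbelianGroupProperties
import Algebra.Properties.CommutativeMonoid.Sum as SumProperties
import Algebra.Properties.CommutativeSemiring.Exp as ExpProperties
import Algebra.Properties.Group as GroupProperties
import Algebra.Properties.Monoid.Mult as Power
import Algebra.Properties.Ring as RingProperties
import Algebra.Properties.Semiring.Exp as SemiringExp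
import Algebra.Properties.Semiring.Mult as MultProperties
import Algebra.Properties.Semiring.Sum as SemiringSumProperties
import Algebra.Solver.Ring as RingSolver
open import Algebra.Solver.Ring.AlmostCommutativeRing using (fromCommutativeRing; _-Raw-AlmostCommutative⟶_)
open import Data.Bool.Base using (Bool; true; false; if_then_else_; _∧_)
open import Data.Bool.Properties using (∧-comm)
open import Data.Fin.Base using (Fin; zero; suc; toℕ)
open import Data.Fin.Patterns using (0F; 1F; 2F; 3F; 4F; 5F; 6F; 7F)
open import Data.Fin.Properties using (punchInᵢ≢i; toℕ-fromℕ<; toℕ<n)
open import Data.Integer.Base as ℤ using (ℤ; +_; -[1+_]; _⊖_; 0ℤ; 1ℤ; -1ℤ)
import Data.Integer.DivMod as ℤ
import Data.Integer.Divisibility.Signed as ℤ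
import Data.Integer.Properties as ℤ
open import Data.Integer.Tactic.RingSolver using (solve-∀)
open import Data.Maybe.Base as Maybe using (Maybe)
open import Data.Nat.Base as ℕ using (ℕ; zero; suc; NonZero)
import Data.Nat.DivMod as ℕ
open import Data.Nat.Divisibility as ℕ using (_∣?_; divides; m%n≡0⇒n∣m)
open import Data.Nat.Primality using (euclidsLemma; prime[2])
import Data.Nat.Properties as ℕ
open import Data.Nat.Tactic.RingSolver using () renaming (solve-∀ to ℕ-solve-∀)
open import Data.Product.Base using (_×_; _,_; ∃; ∃₂; proj₁; proj₂)
open import Data.Sum.Base using (_⊎_; inj₁; inj₂)
open import Data.Vec.Functional using ([]; _∷_)
open import Function.Base using (_∘_)
open import Function.Bundles using (_↔_; _⇔_; Inverse; mk↔ₛ′; mk⇔)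
open import Function.Construct.Composition using (_↔-∘_)
open import Function.Construct.Identity using (↔-id)
open import Function.Construct.Symmetry using (↔-sym)
import Relation.Binary.Reasoning.Setoid as SetoidReasoning
open import Relation.Binary.Definitions using (Tri; tri<; tri≈; tri>)
open import Relation.Binary.PropositionalEquality as ≡ using (_≡_; _≢_)
open import Relation.Nullary.Decidable using (Dec; yes; no; does; does-⇔; dec⇒maybe)
open import Relation.Nullary.Negation using (¬_; contradiction)
open import Relation.Unary using (Pred; Decidable; Satisfiable; _∈_; _∉_; _≐_; _∪_; _⊆_)
open import Relation.Unary.Properties using (_∪?_)

-- Completeness of the list of representations enters as one explicit identity: over all 0 ≤ k < 2n
-- and both square roots c of (-1)ᵏ, the upper left entries of the representations (ξᵏ, c) add up to
-- 4n times the point mass at e. This family is larger than the list of characters, and matching the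
-- two shapes the proof. The indices k and 2n - k give the same trace; for k = 0 and k = n the
-- representation splits into linear characters; and for odd n the repetition among the ψ leaves
-- some characters present only through their duals, which S = S⁻¹ makes equivalent. Each eigenvalue
-- μ is treated on its own: every (k, c) either annihilates its eigenvector or proves μ integral,
-- and not all of them can annihilate it. Integrality of μ is in the end a question of parity. From
-- m² = Δ one gets 2μ = t ± m, and t² + m² = 2q with q integral forces t and m to have the same
-- parity.

2∣x²⇒2∣x : ∀ x → + 2 ℤ.∣ x ℤ.* x → + 2 ℤ.∣ x
2∣x²⇒2∣x x 2∣x² with euclidsLemma ℤ.∣ x ∣ ℤ.∣ x ∣ prime[2] (≡.subst (2 ℕ.∣_) (ℤ.abs-* x x) (ℤ.∣⇒∣ᵤ 2∣x²))
... | inj₁ 2∣x = ℤ.∣ᵤ⇒∣ 2∣x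
... | inj₂ 2∣x = ℤ.∣ᵤ⇒∣ 2∣x

-- The square of x + y is 2 (z + x y), hence even. This halves t ± √Δ inside ℤ.
x²+y²≡2z⇒2∣x+y : ∀ x y z → x ℤ.* x ℤ.+ y ℤ.* y ≡ z ℤ.+ z → + 2 ℤ.∣ x ℤ.+ y
x²+y²≡2z⇒2∣x+y x y z eq = 2∣x²⇒2∣x (x ℤ.+ y) (ℤ.divides (z ℤ.+ x ℤ.* y)
  (≡.trans (square x y) (≡.trans (≡.cong (ℤ._+ (+ 2 ℤ.* (x ℤ.* y))) eq) (double z (x ℤ.* y)))))
  where
  square : ∀ x y → (x ℤ.+ y) ℤ.* (x ℤ.+ y) ≡ x ℤ.* x ℤ.+ y ℤ.* y ℤ.+ + 2 ℤ.* (x ℤ.* y)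
  square = solve-∀
  double : ∀ z w → z ℤ.+ z ℤ.+ + 2 ℤ.* w ≡ (z ℤ.+ w) ℤ.* + 2
  double = solve-∀

-- Integers in a field of characteristic 0, and integral roots of quadratics.

module FieldProperties {c ℓ₁ ℓ₂} (K : AlgClosedField₀ c ℓ₁ ℓ₂) where
  open AlgClosedField₀ K
  open Scalars K
  open CommutativeRing commutativeRing using (ring; +-abelianGroup)
  open RingProperties ring using (-0#≈0#; -‿distribˡ-*; -‿distribʳ-*; -‿involutive)
  open AbelianGroupProperties +-abelianGroup using (⁻¹-∙-comm)
  open MultProperties semiring using (×-homo-+; ×1-homo-*)
  open HCR heytingCommutativeRing
    public using (x-0≈x; x#0y#0→xy#0; #-congʳ; 1#0)
  open SetoidReasoning setoid

  fromℤ-⊖ : ∀ m n → fromℤ (m ⊖ n) ≈ m · 1# - n · 1#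
  fromℤ-⊖ m       zero    = sym (x-0≈x (m · 1#))
  fromℤ-⊖ zero    (suc n) = sym (+-identityˡ _)
  fromℤ-⊖ (suc m) (suc n) = begin
    fromℤ (suc m ⊖ suc n)              ≡⟨ ≡.cong fromℤ (ℤ.[1+m]⊖[1+n]≡m⊖n m n) ⟩
    fromℤ (m ⊖ n)                      ≈⟨ fromℤ-⊖ m n ⟩
    m · 1# - n · 1#                    ≈⟨ +-congʳ (x≈y+x-y _ 1#) ⟩
    1# + m · 1# - 1# - n · 1#          ≈⟨ +-assoc _ _ _ ⟩
    1# + m · 1# + (- 1# - n · 1#)      ≈⟨ +-congˡ (⁻¹-∙-comm 1# (n · 1#)) ⟩
    1# + m · 1# - (1# + n · 1#)        ∎
    where
    x≈y+x-y : ∀ x y → x ≈ y + x - y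
    x≈y+x-y x y = sym (AbelianGroupProperties.xyx⁻¹≈y +-abelianGroup y x)

  fromℤ-neg : ∀ i → fromℤ (ℤ.- i) ≈ - fromℤ i
  fromℤ-neg (+ zero)  = sym -0#≈0#
  fromℤ-neg (+ suc m) = refl
  fromℤ-neg -[1+ m ]  = sym (-‿involutive _)

  fromℤ-+ : ∀ i j → fromℤ (i ℤ.+ j) ≈ fromℤ i + fromℤ j
  fromℤ-+ (+ m)    (+ n)    = ×-homo-+ 1# m n
  fromℤ-+ (+ m)    -[1+ n ] = fromℤ-⊖ m (suc n)
  fromℤ-+ -[1+ m ] (+ n)    = trans (fromℤ-⊖ n (suc m)) (+-comm _ _)
  fromℤ-+ -[1+ m ] -[1+ n ] = begin
    - (suc (suc (m ℕ.+ n)) · 1#)      ≡⟨ ≡.cong (λ k → - (suc k · 1#)) (ℕ.+-suc m n) ⟨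
    - ((suc m ℕ.+ suc n) · 1#)        ≈⟨ -‿cong (×-homo-+ 1# (suc m) (suc n)) ⟩
    - (suc m · 1# + suc n · 1#)       ≈⟨ ⁻¹-∙-comm _ _ ⟨
    - (suc m · 1#) - suc n · 1#       ∎

  fromℤ-* : ∀ i j → fromℤ (i ℤ.* j) ≈ fromℤ i * fromℤ j
  fromℤ-* (+ m) j = go m j
    where
    go : ∀ m j → fromℤ (+ m ℤ.* j) ≈ m · 1# * fromℤ j
    go m (+ n)    = trans (reflexive (≡.cong fromℤ (≡.sym (ℤ.pos-* m n)))) (×1-homo-* m n)
    go m -[1+ n ] = begin
      fromℤ (+ m ℤ.* -[1+ n ])       ≡⟨ ≡.cong fromℤ (ℤ.neg-distribʳ-* (+ m) (+ suc n)) ⟨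
      fromℤ (ℤ.- (+ m ℤ.* + suc n))  ≈⟨ fromℤ-neg (+ m ℤ.* + suc n) ⟩
      - fromℤ (+ m ℤ.* + suc n)      ≈⟨ -‿cong (go m (+ suc n)) ⟩
      - (m · 1# * suc n · 1#)        ≈⟨ -‿distribʳ-* _ _ ⟩
      m · 1# * - (suc n · 1#)        ∎
  fromℤ-* -[1+ m ] j = begin
    fromℤ (-[1+ m ] ℤ.* j)        ≡⟨ ≡.cong fromℤ (ℤ.neg-distribˡ-* (+ suc m) j) ⟨
    fromℤ (ℤ.- (+ suc m ℤ.* j))   ≈⟨ fromℤ-neg (+ suc m ℤ.* j) ⟩
    - fromℤ (+ suc m ℤ.* j)       ≈⟨ -‿cong (fromℤ-* (+ suc m) j) ⟩
    - (suc m · 1# * fromℤ j)      ≈⟨ -‿distribˡ-* _ _ ⟩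
    - (suc m · 1#) * fromℤ j      ∎

  module Solver where
    -- Unlike fromℤ, it sends 1 to 1# definitionally.
    coefficient : ℤ → Carrier
    coefficient (+ 1) = 1#
    coefficient i     = fromℤ i

    coefficient≈ : ∀ i → coefficient i ≈ fromℤ i
    coefficient≈ (+ 0)           = refl
    coefficient≈ (+ 1)           = sym (+-identityʳ 1#)
    coefficient≈ (+ suc (suc _)) = refl
    coefficient≈ -[1+ _ ]        = refl

    morphism : ℤ.+-*-rawRing -Raw-AlmostCommutative⟶ fromCommutativeRing commutativeRing
    morphism = record
      { ⟦_⟧    = coefficient
      ; +-homo = λ i j → trans (coefficient≈ (i ℤ.+ j))
          (trans (fromℤ-+ i j) (sym (+-cong (coefficient≈ i) (coefficient≈ j))))
      ; *-homo = λ i j → trans (coefficient≈ (i ℤ.* j))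
          (trans (fromℤ-* i j) (sym (*-cong (coefficient≈ i) (coefficient≈ j))))
      ; -‿homo = λ i → trans (coefficient≈ (ℤ.- i))
          (trans (fromℤ-neg i) (sym (-‿cong (coefficient≈ i))))
      ; 0-homo = refl
      ; 1-homo = refl
      }

    coefficient≟ : ∀ i j → Maybe (coefficient i ≈ coefficient j)
    coefficient≟ i j = Maybe.map (λ { ≡.refl → refl }) (dec⇒maybe (i ℤ.≟ j))

    open RingSolver ℤ.+-*-rawRing (fromCommutativeRing commutativeRing) morphism coefficient≟
      public using (solve; _:=_; _:+_; _:*_; _:-_; :-_; con)

  #⇒≉ : ∀ {x y} → x # y → ¬ x ≈ y
  #⇒≉ x#y x≈y = proj₂ (tight _ _) x≈y x#y

  -- The single entry point of `_#?_`: every later case distinction on a vanishing entry,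
  -- coefficient or factor goes through it.
  ≈0⊎#0 : ∀ x → x ≈ 0# ⊎ x # 0#
  ≈0⊎#0 x with x #? 0#
  ... | yes x#0 = inj₂ x#0
  ... | no ¬x#0 = inj₁ (proj₁ (tight _ _) ¬x#0)

  #0-cancelˡ : ∀ {x y} → x # 0# → x * y ≈ 0# → y ≈ 0#
  #0-cancelˡ {x} {y} x#0 xy≈0 with ≈0⊎#0 y
  ... | inj₁ y≈0 = y≈0
  ... | inj₂ y#0 = contradiction xy≈0 (#⇒≉ (x#0y#0→xy#0 x#0 y#0))

  xy≈0⇒x≈0⊎y≈0 : ∀ {x y} → x * y ≈ 0# → x ≈ 0# ⊎ y ≈ 0#
  xy≈0⇒x≈0⊎y≈0 {x} xy≈0 with ≈0⊎#0 x
  ... | inj₁ x≈0 = inj₁ x≈0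
  ... | inj₂ x#0 = inj₂ (#0-cancelˡ x#0 xy≈0)

  x-y≈0⇒x≈y : ∀ {x y} → x - y ≈ 0# → x ≈ y
  x-y≈0⇒x≈y {x} {y} eq = begin
    x          ≈⟨ solve 2 (λ x y → x := x :- y :+ y) refl x y ⟩
    x - y + y  ≈⟨ +-congʳ eq ⟩
    0# + y     ≈⟨ +-identityˡ y ⟩
    y          ∎
    where open Solver

  x≈y⇒x-y≈0 : ∀ {x y} → x ≈ y → x - y ≈ 0#
  x≈y⇒x-y≈0 {y = y} eq = trans (+-congʳ eq) (-‿inverseʳ y)

  x²≈y²⇒x≈±y : ∀ {x y} → x * x ≈ y * y → x ≈ y ⊎ x ≈ - y
  x²≈y²⇒x≈±y {x} {y} eq with xy≈0⇒x≈0⊎y≈0 {x - y} {x - - y} (begin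
    (x - y) * (x - - y)  ≈⟨ solve 2 (λ x y → (x :- y) :* (x :- (:- y)) := x :* x :- y :* y) refl x y ⟩
    x * x - y * y        ≈⟨ x≈y⇒x-y≈0 eq ⟩
    0#                   ∎)
    where open Solver
  ... | inj₁ x-y≈0 = inj₁ (x-y≈0⇒x≈y x-y≈0)
  ... | inj₂ x+y≈0 = inj₂ (x-y≈0⇒x≈y x+y≈0)

  2#0 : 1# + 1# # 0#
  2#0 = #-congʳ (+-congˡ (+-identityʳ 1#)) (char-zero 1)

  x+x≈0⇒x≈0 : ∀ {x} → x + x ≈ 0# → x ≈ 0#
  x+x≈0⇒x≈0 {x} eq = #0-cancelˡ 2#0
    (trans (solve 1 (λ x → (con (+ 1) :+ con (+ 1)) :* x := x :+ x) refl x) eq)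
    where open Solver

  fromℤ≈0⇒≡0 : ∀ i → fromℤ i ≈ 0# → i ≡ + 0
  fromℤ≈0⇒≡0 (+ zero)  _  = ≡.refl
  fromℤ≈0⇒≡0 (+ suc m) eq = contradiction eq (#⇒≉ (char-zero m))
  fromℤ≈0⇒≡0 -[1+ m ]  eq = contradiction (begin
    suc m · 1#          ≈⟨ -‿involutive _ ⟨
    - - (suc m · 1#)    ≈⟨ -‿cong eq ⟩
    - 0#                ≈⟨ -0#≈0# ⟩
    0#                  ∎) (#⇒≉ (char-zero m))

  -- Characteristic 0 lets an identity between scalars be read in ℤ, where parity makes sense.
  fromℤ-injective : ∀ {i j} → fromℤ i ≈ fromℤ j → i ≡ j
  fromℤ-injective {i} {j} eq = ℤ.i-j≡0⇒i≡j i j (fromℤ≈0⇒≡0 (i ℤ.- j) (begin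
    fromℤ (i ℤ.- j)               ≈⟨ fromℤ-+ i (ℤ.- j) ⟩
    fromℤ i + fromℤ (ℤ.- j)       ≈⟨ +-congˡ (fromℤ-neg j) ⟩
    fromℤ i - fromℤ j             ≈⟨ x≈y⇒x-y≈0 eq ⟩
    0#                            ∎))

  -- Algebraic closure is used in this form only: for the eigenvalues of a 2×2 matrix with trace t
  -- and determinant d, and for a square root of c as the case t = 0, d = -c.
  quadratic-root : ∀ t d → ∃ λ x → x * x - t * x + d ≈ 0#
  quadratic-root t d with root 1 (d ∷ - t ∷ [])
  ... | x , eq = x , trans (solve 3 (λ x t d →
      x :* x :- t :* x :+ d
      := x :* (x :* con (+ 1)) :+ (d :* con (+ 1) :+ ((:- t) :* (x :* con (+ 1)) :+ con (+ 0))))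
      refl x t d) eq
    where open Solver

  IsInteger-cong : ∀ {x y} → x ≈ y → IsInteger x → IsInteger y
  IsInteger-cong x≈y (z , eq) = z , trans (sym x≈y) eq

  IsPerfectSquare-cong : ∀ {x y} → x ≈ y → IsPerfectSquare x → IsPerfectSquare y
  IsPerfectSquare-cong x≈y (z , eq) = z , trans (sym x≈y) eq

  -- With t = μ + ν and q = μ² + ν², the right-hand side of the last hypothesis is (μ - ν)².
  IsInteger-quadratic : ∀ {μ t q} → IsInteger t → IsInteger q → IsPerfectSquare (2 · q - t ^ 2) →
    (μ + μ - t) * (μ + μ - t) ≈ 2 · q - t ^ 2 → IsInteger μ
  IsInteger-quadratic {μ} {t} {q} (T , t≈T) (Q , q≈Q) (m , Δ≈m²) eq =
    conclude (x²≈y²⇒x≈±y {y = fromℤ m} (trans (trans eq Δ≈m²) (fromℤ-* m m)))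
    where
    open Solver
    -- The definition Δ = 2q - t², rewritten in ℤ; it makes T and m congruent modulo 2.
    T²+m²≡2Q : T ℤ.* T ℤ.+ m ℤ.* m ≡ Q ℤ.+ Q
    T²+m²≡2Q = fromℤ-injective (begin
      fromℤ (T ℤ.* T ℤ.+ m ℤ.* m)          ≈⟨ fromℤ-+ (T ℤ.* T) (m ℤ.* m) ⟩
      fromℤ (T ℤ.* T) + fromℤ (m ℤ.* m)    ≈⟨ +-cong (fromℤ-* T T) (sym Δ≈m²) ⟩
      fromℤ T * fromℤ T + (2 · q - t ^ 2)  ≈⟨ +-congʳ (*-cong t≈T t≈T) ⟨
      t * t + (2 · q - t ^ 2)
        ≈⟨ solve 2 (λ t q → t :* t :+ (q :+ (q :+ con (+ 0)) :- t :* (t :* con (+ 1))) := q :+ q) refl t q ⟩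
      q + q                                ≈⟨ +-cong q≈Q q≈Q ⟩
      fromℤ Q + fromℤ Q                    ≈⟨ fromℤ-+ Q Q ⟨
      fromℤ (Q ℤ.+ Q)                      ∎)
    halve : ∀ m → T ℤ.* T ℤ.+ m ℤ.* m ≡ Q ℤ.+ Q → μ + μ - t ≈ fromℤ m → IsInteger μ
    halve m eq 2μ-t≈m with x²+y²≡2z⇒2∣x+y T m Q eq
    ... | ℤ.divides w T+m≡2w = w , x-y≈0⇒x≈y (x+x≈0⇒x≈0 (begin
      (μ - fromℤ w) + (μ - fromℤ w)
        ≈⟨ solve 3 (λ μ w t → (μ :- w) :+ (μ :- w) := t :+ (μ :+ μ :- t) :- w :* con (+ 2)) refl μ (fromℤ w) t ⟩
      t + (μ + μ - t) - fromℤ w * fromℤ (+ 2)     ≈⟨ +-cong (+-cong t≈T 2μ-t≈m) (-‿cong (sym (fromℤ-* w (+ 2)))) ⟩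
      fromℤ T + fromℤ m - fromℤ (w ℤ.* + 2)       ≡⟨ ≡.cong (λ z → fromℤ T + fromℤ m - fromℤ z) T+m≡2w ⟨
      fromℤ T + fromℤ m - fromℤ (T ℤ.+ m)         ≈⟨ x≈y⇒x-y≈0 (sym (fromℤ-+ T m)) ⟩
      0#                                          ∎))
    -- Only m² is known, so 2μ - t is m or -m. The relation of T, m and Q is invariant under m ↦ -m,
    -- so both signs are halved alike.
    conclude : μ + μ - t ≈ fromℤ m ⊎ μ + μ - t ≈ - fromℤ m → IsInteger μ
    conclude (inj₁ +m) = halve m T²+m²≡2Q +m
    conclude (inj₂ -m) = halve (ℤ.- m) (≡.trans (neg-square T m) T²+m²≡2Q) (trans -m (sym (fromℤ-neg m)))
      where
      neg-square : ∀ x y → x ℤ.* x ℤ.+ (ℤ.- y) ℤ.* (ℤ.- y) ≡ x ℤ.* x ℤ.+ y ℤ.* y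
      neg-square = solve-∀

  IsInteger-+ : ∀ {x y} → IsInteger x → IsInteger y → IsInteger (x + y)
  IsInteger-+ (m , x≈m) (k , y≈k) = m ℤ.+ k , trans (+-cong x≈m y≈k) (sym (fromℤ-+ m k))

  IsInteger-* : ∀ {x y} → IsInteger x → IsInteger y → IsInteger (x * y)
  IsInteger-* (m , x≈m) (k , y≈k) = m ℤ.* k , trans (*-cong x≈m y≈k) (sym (fromℤ-* m k))

  IsPerfectSquare-difference : ∀ {x y} → IsInteger x → IsInteger y → IsPerfectSquare ((x - y) * (x - y))
  IsPerfectSquare-difference {x} {y} (m , x≈m) (k , y≈k) =
    m ℤ.- k , trans (*-cong x-y≈m-k x-y≈m-k) (sym (fromℤ-* (m ℤ.- k) (m ℤ.- k)))
    where
    x-y≈m-k : x - y ≈ fromℤ (m ℤ.- k)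
    x-y≈m-k = trans (+-cong x≈m (trans (-‿cong y≈k) (sym (fromℤ-neg k)))) (sym (fromℤ-+ m (ℤ.- k)))

-- Finite sums over enumerated types.

module FiniteSums {c ℓ₁ ℓ₂} (K : AlgClosedField₀ c ℓ₁ ℓ₂) where
  open AlgClosedField₀ K
  open Scalars K
  open CommutativeRing commutativeRing using (+-commutativeMonoid)
  module Σₚ = SumProperties +-commutativeMonoid
  module Σₛ = SemiringSumProperties semiring
  open SetoidReasoning setoid

  module _ {m} {V : Set} (enum : Fin m ↔ V) where
    ∑-cong : ∀ {f g : V → Carrier} → (∀ x → f x ≈ g x) → ∑ enum f ≈ ∑ enum g
    ∑-cong eq = Σₚ.sum-cong-≋ {m} (eq ∘ Inverse.to enum)

    ∑-+ : ∀ f g → ∑ enum (λ x → f x + g x) ≈ ∑ enum f + ∑ enum g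
    ∑-+ f g = Σₚ.∑-distrib-+ (f ∘ Inverse.to enum) (g ∘ Inverse.to enum)

    *-∑ : ∀ a f → a * ∑ enum f ≈ ∑ enum (λ x → a * f x)
    *-∑ a f = Σₛ.*-distribˡ-sum a (f ∘ Inverse.to enum)

    ∑-* : ∀ a f → ∑ enum f * a ≈ ∑ enum (λ x → f x * a)
    ∑-* a f = Σₛ.*-distribʳ-sum a (f ∘ Inverse.to enum)

    ∑-0 : ∀ {f : V → Carrier} → (∀ x → f x ≈ 0#) → ∑ enum f ≈ 0#
    ∑-0 eq = trans (∑-cong eq) (Σₚ.sum-replicate-zero m)

    ∑-reindex : ∀ (π : V ↔ V) f → ∑ enum (f ∘ Inverse.to π) ≈ ∑ enum f
    ∑-reindex π f = sym (trans (Σₚ.sum-permute (f ∘ Inverse.to enum) (↔-sym enum ↔-∘ (π ↔-∘ enum)))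
      (Σₚ.sum-cong-≋ {m} λ j → reflexive (≡.cong f (Inverse.strictlyInverseˡ enum (Inverse.to π (Inverse.to enum j))))))

  ∑-comm : ∀ {m k} {V W : Set} (enumV : Fin m ↔ V) (enumW : Fin k ↔ W) (f : V → W → Carrier) →
    ∑ enumV (λ x → ∑ enumW (λ y → f x y)) ≈ ∑ enumW (λ y → ∑ enumV (λ x → f x y))
  ∑-comm {m} {k} enumV enumW f = Σₚ.∑-comm {m} {k} λ i j → f (Inverse.to enumV i) (Inverse.to enumW j)

  sum-single : ∀ {m} (f : Fin m → Carrier) i → (∀ j → j ≢ i → f j ≈ 0#) → sum f ≈ f i
  sum-single {suc m} f i f≈0 = begin
    sum f    ≈⟨ Σₚ.sum-remove {i = i} f ⟩
    f i + _  ≈⟨ +-congˡ (trans (Σₚ.sum-cong-≋ λ j → f≈0 _ (punchInᵢ≢i i j)) (Σₚ.sum-replicate-zero m)) ⟩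
    f i + 0# ≈⟨ +-identityʳ (f i) ⟩
    f i      ∎

  ∑-single : ∀ {m} {V : Set} (enum : Fin m ↔ V) f x → (∀ y → y ≢ x → f y ≈ 0#) → ∑ enum f ≈ f x
  ∑-single enum f x f≈0 = trans
    (sum-single (f ∘ Inverse.to enum) (Inverse.from enum x) λ j j≢ → f≈0 _ λ eq →
      j≢ (≡.trans (≡.sym (Inverse.strictlyInverseʳ enum j)) (≡.cong (Inverse.from enum) eq)))
    (reflexive (≡.cong f (Inverse.strictlyInverseˡ enum x)))

  indicator : Bool → Carrier
  indicator b = if b then 1# else 0#

  -- Turns the guard of a character sum into a factor, so that distributivity applies to it.
  if≈indicator* : ∀ b x → (if b then x else 0#) ≈ indicator b * x
  if≈indicator* true  x = sym (*-identityˡ x)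
  if≈indicator* false x = sym (zeroˡ x)

  indicator-∧ : ∀ a b → indicator (a ∧ b) ≈ indicator a * indicator b
  indicator-∧ true  b = sym (*-identityˡ _)
  indicator-∧ false b = sym (zeroˡ _)

module GroupSums {c ℓ₁ ℓ₂} (K : AlgClosedField₀ c ℓ₁ ℓ₂) (G : FiniteGroup) where
  open AlgClosedField₀ K renaming (Carrier to Scalar)
  open Scalars K
  open FiniteSums K
  open FiniteGroup G
  open GroupProperties group using (⁻¹-involutive)

  inversion : Carrier ↔ Carrier
  inversion = mk↔ₛ′ _⁻¹ _⁻¹ ⁻¹-involutive ⁻¹-involutive

  translationʳ : Carrier → Carrier ↔ Carrier
  translationʳ z = mk↔ₛ′ (_∙ z) (_∙ z ⁻¹)
    (λ x → ≡.trans (assoc x (z ⁻¹) z) (≡.trans (≡.cong (x ∙_) (inverseˡ z)) (identityʳ x)))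
    (λ x → ≡.trans (assoc x z (z ⁻¹)) (≡.trans (≡.cong (x ∙_) (inverseʳ z)) (identityʳ x)))

  ∑-⁻¹ : ∀ f → ∑ enum (λ x → f (x ⁻¹)) ≈ ∑ enum f
  ∑-⁻¹ = ∑-reindex enum inversion

  ∑-∙ʳ : ∀ z f → ∑ enum (λ x → f (x ∙ z)) ≈ ∑ enum f
  ∑-∙ʳ z = ∑-reindex enum (translationʳ z)

-- Homomorphisms from the group to a monoid, built from the defining relations.

module Representation {c ℓ} (M : Monoid c ℓ) (n : ℕ) .{{_ : NonZero n}} where
  open Monoid M renaming (_∙_ to _⊗_; ε to 1M; ∙-cong to ⊗-cong; ∙-congˡ to ⊗-congˡ; ∙-congʳ to ⊗-congʳ)
  open Power M using (×-homo-+; ×-assocˡ; ×-congʳ; ×-homo-1) renaming (_×_ to power)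
  open Presentation n
  open SetoidReasoning setoid

  -- A monoid has no inverses, so the inverse of A is part of the data. The conjugation relation
  -- b⁻¹ab = a⁻¹ is stated as BA = A⁻¹B, the form that moves B to the right of A.
  record Relations (A A⁻¹ B : Carrier) : Set ℓ where
    field
      inverseʳ : A ⊗ A⁻¹ ≈ 1M
      inverseˡ : A⁻¹ ⊗ A ≈ 1M
      A²ⁿ≈1    : power (2 ℕ.* n) A ≈ 1M
      Aⁿ≈B⁴    : power n A ≈ power 4 B
      BA≈A⁻¹B  : B ⊗ A ≈ A⁻¹ ⊗ B

  image : Carrier → Carrier → Normal n → Carrier
  image A B (a^ r b^ s) = power (toℕ r) A ⊗ power (toℕ s) B

  power-1M : ∀ m → power m 1M ≈ 1M
  power-1M zero    = refl
  power-1M (suc m) = trans (identityˡ _) (power-1M m)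

  module _ {A A⁻¹ B} (rel : Relations A A⁻¹ B) where
    open Relations rel

    -- Aⁱ for an integer i. The exponent is reduced by the same `residue` as in the group law, so
    -- that the image of a product is by definition a `zpower` times a power of B.
    zpower : ℤ → Carrier
    zpower i = power (toℕ (residue i)) A

    zpower-+ℕ : ∀ m → zpower (+ m) ≈ power m A
    zpower-+ℕ m = begin
      zpower (+ m)                                          ≡⟨ ≡.cong (λ k → power k A) (toℕ-fromℕ< (ℤ.n%ℕd<d (+ m) (2 ℕ.* n))) ⟩
      power (m ℕ.% (2 ℕ.* n)) A                             ≈⟨ identityʳ _ ⟨
      power (m ℕ.% (2 ℕ.* n)) A ⊗ 1M                        ≈⟨ ⊗-congˡ (power-1M q) ⟨
      power (m ℕ.% (2 ℕ.* n)) A ⊗ power q 1M                ≈⟨ ⊗-congˡ (×-congʳ q A²ⁿ≈1) ⟨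
      power (m ℕ.% (2 ℕ.* n)) A ⊗ power q (power (2 ℕ.* n) A) ≈⟨ ⊗-congˡ (×-assocˡ A q (2 ℕ.* n)) ⟩
      power (m ℕ.% (2 ℕ.* n)) A ⊗ power (q ℕ.* (2 ℕ.* n)) A ≈⟨ ×-homo-+ A (m ℕ.% (2 ℕ.* n)) _ ⟨
      power (m ℕ.% (2 ℕ.* n) ℕ.+ q ℕ.* (2 ℕ.* n)) A         ≡⟨ ≡.cong (λ k → power k A) (ℕ.m≡m%n+[m/n]*n m (2 ℕ.* n)) ⟨
      power m A                                             ∎
      where
      q : ℕ
      q = m ℕ./ (2 ℕ.* n)

    zpower-+ : ∀ i j → zpower (i ℤ.+ j) ≈ zpower i ⊗ zpower j
    zpower-+ i j = begin
      zpower (i ℤ.+ j)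
        ≡⟨ ≡.cong (λ r → power (toℕ r) A) (residue-cong (quot i ℤ.+ quot j) (i ℤ.+ j)
             (+ toℕ (residue i) ℤ.+ + toℕ (residue j))
             (≡.trans (≡.cong₂ ℤ._+_ (divide i) (divide j))
               (regroup (+ toℕ (residue i)) (+ toℕ (residue j)) (quot i) (quot j) 2n))) ⟩
      zpower (+ (toℕ (residue i) ℕ.+ toℕ (residue j)))  ≈⟨ zpower-+ℕ (toℕ (residue i) ℕ.+ toℕ (residue j)) ⟩
      power (toℕ (residue i) ℕ.+ toℕ (residue j)) A     ≈⟨ ×-homo-+ A (toℕ (residue i)) _ ⟩
      zpower i ⊗ zpower j                               ∎
      where
      regroup : ∀ r s p q m → (r ℤ.+ p ℤ.* m) ℤ.+ (s ℤ.+ q ℤ.* m) ≡ (r ℤ.+ s) ℤ.+ (p ℤ.+ q) ℤ.* m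
      regroup = solve-∀

    power-inverse : ∀ m → power m A⁻¹ ⊗ power m A ≈ 1M
    power-inverse zero    = identityˡ 1M
    power-inverse (suc m) = begin
      power (suc m) A⁻¹ ⊗ power (suc m) A               ≡⟨ ≡.cong (λ k → power k A⁻¹ ⊗ power (suc m) A) (ℕ.+-comm 1 m) ⟩
      power (m ℕ.+ 1) A⁻¹ ⊗ (A ⊗ power m A)             ≈⟨ ⊗-congʳ (trans (×-homo-+ A⁻¹ m 1) (⊗-congˡ (×-homo-1 A⁻¹))) ⟩
      power m A⁻¹ ⊗ A⁻¹ ⊗ (A ⊗ power m A)               ≈⟨ assoc _ _ _ ⟩
      power m A⁻¹ ⊗ (A⁻¹ ⊗ (A ⊗ power m A))             ≈⟨ ⊗-congˡ (assoc _ _ _) ⟨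
      power m A⁻¹ ⊗ (A⁻¹ ⊗ A ⊗ power m A)               ≈⟨ ⊗-congˡ (trans (⊗-congʳ inverseˡ) (identityˡ _)) ⟩
      power m A⁻¹ ⊗ power m A                           ≈⟨ power-inverse m ⟩
      1M                                                ∎

    zpower-neg : ∀ i → zpower (ℤ.- i) ≈ power (toℕ (residue i)) A⁻¹
    zpower-neg i = begin
      zpower (ℤ.- i)                                    ≈⟨ identityˡ _ ⟨
      1M ⊗ zpower (ℤ.- i)                               ≈⟨ ⊗-congʳ (power-inverse m) ⟨
      power m A⁻¹ ⊗ zpower i ⊗ zpower (ℤ.- i)           ≈⟨ assoc _ _ _ ⟩
      power m A⁻¹ ⊗ (zpower i ⊗ zpower (ℤ.- i))         ≈⟨ ⊗-congˡ (zpower-+ i (ℤ.- i)) ⟨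
      power m A⁻¹ ⊗ zpower (i ℤ.- i)                    ≡⟨ ≡.cong (λ k → power m A⁻¹ ⊗ zpower k) (ℤ.+-inverseʳ i) ⟩
      power m A⁻¹ ⊗ zpower 0ℤ                           ≈⟨ ⊗-congˡ (zpower-+ℕ 0) ⟩
      power m A⁻¹ ⊗ 1M                                  ≈⟨ identityʳ _ ⟩
      power m A⁻¹                                       ∎
      where
      m : ℕ
      m = toℕ (residue i)

    B-power : ∀ m → B ⊗ power m A ≈ power m A⁻¹ ⊗ B
    B-power zero    = trans (identityʳ B) (sym (identityˡ B))
    B-power (suc m) = begin
      B ⊗ (A ⊗ power m A)          ≈⟨ assoc _ _ _ ⟨
      B ⊗ A ⊗ power m A            ≈⟨ ⊗-congʳ BA≈A⁻¹B ⟩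
      A⁻¹ ⊗ B ⊗ power m A          ≈⟨ assoc _ _ _ ⟩
      A⁻¹ ⊗ (B ⊗ power m A)        ≈⟨ ⊗-congˡ (B-power m) ⟩
      A⁻¹ ⊗ (power m A⁻¹ ⊗ B)      ≈⟨ assoc _ _ _ ⟨
      A⁻¹ ⊗ power m A⁻¹ ⊗ B        ∎

    -- Each B inverts the power of A that it passes; s of them produce the `sign` of the group law.
    Bˢ-zpower : ∀ s i → power s B ⊗ zpower i ≈ zpower (-1ℤ ℤ.^ s ℤ.* i) ⊗ power s B
    Bˢ-zpower zero    i = begin
      1M ⊗ zpower i                ≈⟨ identityˡ _ ⟩
      zpower i                     ≈⟨ identityʳ _ ⟨
      zpower i ⊗ 1M                ≡⟨ ≡.cong (λ j → zpower j ⊗ 1M) (ℤ.*-identityˡ i) ⟨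
      zpower (1ℤ ℤ.* i) ⊗ 1M       ∎
    Bˢ-zpower (suc s) i = begin
      B ⊗ power s B ⊗ zpower i                           ≈⟨ assoc _ _ _ ⟩
      B ⊗ (power s B ⊗ zpower i)                         ≈⟨ ⊗-congˡ (Bˢ-zpower s i) ⟩
      B ⊗ (zpower j ⊗ power s B)                         ≈⟨ assoc _ _ _ ⟨
      B ⊗ zpower j ⊗ power s B                           ≈⟨ ⊗-congʳ (B-power (toℕ (residue j))) ⟩
      power (toℕ (residue j)) A⁻¹ ⊗ B ⊗ power s B        ≈⟨ ⊗-congʳ (⊗-congʳ (zpower-neg j)) ⟨
      zpower (ℤ.- j) ⊗ B ⊗ power s B                     ≈⟨ assoc _ _ _ ⟩
      zpower (ℤ.- j) ⊗ power (suc s) B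
        ≡⟨ ≡.cong (λ k → zpower k ⊗ power (suc s) B) (negate (-1ℤ ℤ.^ s) i) ⟩
      zpower (-1ℤ ℤ.^ suc s ℤ.* i) ⊗ power (suc s) B     ∎
      where
      j : ℤ
      j = -1ℤ ℤ.^ s ℤ.* i
      negate : ∀ σ i → ℤ.- (σ ℤ.* i) ≡ (-1ℤ ℤ.* σ) ℤ.* i
      negate = solve-∀

    -- Dividing the exponent s + u by 4 splits off powers of B⁴ = Aⁿ; their number is the `carry` of
    -- the group law.
    B-carry : ∀ s u → power (toℕ s) B ⊗ power (toℕ u) B ≈ zpower (carry s u ℤ.* + n) ⊗ power (toℕ (s ⊕ u)) B
    B-carry s u = begin
      power (toℕ s) B ⊗ power (toℕ u) B                  ≈⟨ ×-homo-+ B (toℕ s) (toℕ u) ⟨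
      power m B                                          ≡⟨ ≡.cong (λ k → power k B)
                                                              (≡.trans (ℕ.m≡m%n+[m/n]*n m 4) (ℕ.+-comm (m ℕ.% 4) _)) ⟩
      power (q ℕ.* 4 ℕ.+ m ℕ.% 4) B                      ≈⟨ ×-homo-+ B (q ℕ.* 4) (m ℕ.% 4) ⟩
      power (q ℕ.* 4) B ⊗ power (m ℕ.% 4) B              ≈⟨ ⊗-cong B⁴ᵠ≈ (reflexive (≡.cong (λ k → power k B)
                                                              (≡.sym (toℕ-fromℕ< (ℕ.m%n<n m 4))))) ⟩
      zpower (carry s u ℤ.* + n) ⊗ power (toℕ (s ⊕ u)) B ∎
      where
      m q : ℕ
      m = toℕ s ℕ.+ toℕ u
      q = m ℕ./ 4
      B⁴ᵠ≈ : power (q ℕ.* 4) B ≈ zpower (+ q ℤ.* + n)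
      B⁴ᵠ≈ = begin
        power (q ℕ.* 4) B        ≈⟨ ×-assocˡ B q 4 ⟨
        power q (power 4 B)      ≈⟨ ×-congʳ q Aⁿ≈B⁴ ⟨
        power q (power n A)      ≈⟨ ×-assocˡ A q n ⟩
        power (q ℕ.* n) A        ≈⟨ zpower-+ℕ (q ℕ.* n) ⟨
        zpower (+ (q ℕ.* n))     ≡⟨ ≡.cong zpower (ℤ.pos-* q n) ⟩
        zpower (+ q ℤ.* + n)     ∎

    -- Read from the bottom up, this brings Aʳ Bˢ Aᵗ Bᵘ to normal form: Aᵗ moves left past Bˢ, then
    -- the overflow of the exponent of B becomes a power of A.
    image-∙ : ∀ x y → image A B (x ∙ y) ≈ image A B x ⊗ image A B y
    image-∙ (a^ r b^ s) (a^ t b^ u) = begin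
      zpower (+ toℕ r ℤ.+ σt ℤ.+ cn) ⊗ Bᵛ          ≈⟨ ⊗-congʳ (trans (zpower-+ (+ toℕ r ℤ.+ σt) cn) (⊗-congʳ (zpower-+ (+ toℕ r) σt))) ⟩
      zpower (+ toℕ r) ⊗ zpower σt ⊗ zpower cn ⊗ Bᵛ ≈⟨ assoc _ _ _ ⟩
      zpower (+ toℕ r) ⊗ zpower σt ⊗ (zpower cn ⊗ Bᵛ) ≈⟨ ⊗-cong (⊗-congʳ (zpower-+ℕ (toℕ r))) (sym (B-carry s u)) ⟩
      Aʳ ⊗ zpower σt ⊗ (Bˢ ⊗ Bᵘ)                   ≈⟨ assoc _ _ _ ⟨
      Aʳ ⊗ zpower σt ⊗ Bˢ ⊗ Bᵘ                     ≈⟨ ⊗-congʳ (assoc _ _ _) ⟩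
      Aʳ ⊗ (zpower σt ⊗ Bˢ) ⊗ Bᵘ                   ≈⟨ ⊗-congʳ (⊗-congˡ (Bˢ-zpower (toℕ s) (+ toℕ t))) ⟨
      Aʳ ⊗ (Bˢ ⊗ zpower (+ toℕ t)) ⊗ Bᵘ            ≈⟨ ⊗-congʳ (⊗-congˡ (⊗-congˡ (zpower-+ℕ (toℕ t)))) ⟩
      Aʳ ⊗ (Bˢ ⊗ Aᵗ) ⊗ Bᵘ                          ≈⟨ ⊗-congʳ (assoc _ _ _) ⟨
      Aʳ ⊗ Bˢ ⊗ Aᵗ ⊗ Bᵘ                            ≈⟨ assoc _ _ _ ⟩
      Aʳ ⊗ Bˢ ⊗ (Aᵗ ⊗ Bᵘ)                          ∎
      where
      σt cn : ℤ
      σt = sign s ℤ.* + toℕ t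
      cn = carry s u ℤ.* + n
      Aʳ Aᵗ Bˢ Bᵘ Bᵛ : Carrier
      Aʳ = power (toℕ r) A
      Aᵗ = power (toℕ t) A
      Bˢ = power (toℕ s) B
      Bᵘ = power (toℕ u) B
      Bᵛ = power (toℕ (s ⊕ u)) B

    image-ε : image A B ε ≈ 1M
    image-ε = trans (identityʳ _) (zpower-+ℕ 0)

-- Representations of degree one and two.

module MatrixRepresentations {c ℓ₁ ℓ₂} (K : AlgClosedField₀ c ℓ₁ ℓ₂) (n : ℕ) .{{_ : NonZero n}} where
  open AlgClosedField₀ K
  open CommutativeRing commutativeRing using (*-monoid; commutativeSemiring)
  open FieldProperties K using (module Solver)
  open SemiringExp semiring using (^-congˡ; ^-homo-*; ^-assocʳ)
  open ExpProperties commutativeSemiring using (^-distrib-*)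
  open Presentation n using (_∙_; ε)
  open SetoidReasoning setoid
  open Solver

  infixl 7 _⊗_
  infix 4 _≋_

  Matrix : Set c
  Matrix = Fin 2 → Fin 2 → Carrier

  _≋_ : Matrix → Matrix → Set ℓ₁
  X ≋ Y = ∀ i j → X i j ≈ Y i j

  _⊗_ : Matrix → Matrix → Matrix
  (X ⊗ Y) i j = X i 0F * Y 0F j + X i 1F * Y 1F j

  matrix : (p q r s : Carrier) → Matrix
  matrix p q r s 0F 0F = p
  matrix p q r s 0F 1F = q
  matrix p q r s 1F 0F = r
  matrix p q r s 1F 1F = s

  diagonal : Carrier → Carrier → Matrix
  diagonal p q = matrix p 0# 0# q

  entrywise : ∀ {X Y : Matrix} → X 0F 0F ≈ Y 0F 0F → X 0F 1F ≈ Y 0F 1F →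
    X 1F 0F ≈ Y 1F 0F → X 1F 1F ≈ Y 1F 1F → X ≋ Y
  entrywise p q r s 0F 0F = p
  entrywise p q r s 0F 1F = q
  entrywise p q r s 1F 0F = r
  entrywise p q r s 1F 1F = s

  matrixMonoid : Monoid c ℓ₁
  matrixMonoid = record
    { Carrier  = Matrix
    ; _≈_      = _≋_
    ; _∙_      = _⊗_
    ; ε        = diagonal 1# 1#
    ; isMonoid = record
      { isSemigroup = record
        { isMagma = record
          { isEquivalence = record
            { refl  = λ i j → refl
            ; sym   = λ X≋Y i j → sym (X≋Y i j)
            ; trans = λ X≋Y Y≋Z i j → trans (X≋Y i j) (Y≋Z i j)
            }
          ; ∙-cong = λ X≋X′ Y≋Y′ i j →
              +-cong (*-cong (X≋X′ i 0F) (Y≋Y′ 0F j)) (*-cong (X≋X′ i 1F) (Y≋Y′ 1F j))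
          }
        ; assoc = λ X Y Z i j → solve 8 (λ x₀ x₁ y₀₀ y₀₁ y₁₀ y₁₁ z₀ z₁ →
            (x₀ :* y₀₀ :+ x₁ :* y₁₀) :* z₀ :+ (x₀ :* y₀₁ :+ x₁ :* y₁₁) :* z₁
            := x₀ :* (y₀₀ :* z₀ :+ y₀₁ :* z₁) :+ x₁ :* (y₁₀ :* z₀ :+ y₁₁ :* z₁))
            refl (X i 0F) (X i 1F) (Y 0F 0F) (Y 0F 1F) (Y 1F 0F) (Y 1F 1F) (Z 0F j) (Z 1F j)
        }
      ; identity =
          (λ X → entrywise (1x+0y (X 0F 0F) (X 1F 0F)) (1x+0y (X 0F 1F) (X 1F 1F))
                             (0x+1y (X 0F 0F) (X 1F 0F)) (0x+1y (X 0F 1F) (X 1F 1F)))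
        , (λ X → entrywise (x1+y0 (X 0F 0F) (X 0F 1F)) (x0+y1 (X 0F 0F) (X 0F 1F))
                             (x1+y0 (X 1F 0F) (X 1F 1F)) (x0+y1 (X 1F 0F) (X 1F 1F)))
      }
    }
    where
    1x+0y : ∀ x y → 1# * x + 0# * y ≈ x
    1x+0y = solve 2 (λ x y → con (+ 1) :* x :+ con (+ 0) :* y := x) refl
    0x+1y : ∀ x y → 0# * x + 1# * y ≈ y
    0x+1y = solve 2 (λ x y → con (+ 0) :* x :+ con (+ 1) :* y := y) refl
    x1+y0 : ∀ x y → x * 1# + y * 0# ≈ x
    x1+y0 = solve 2 (λ x y → x :* con (+ 1) :+ y :* con (+ 0) := x) refl
    x0+y1 : ∀ x y → x * 0# + y * 1# ≈ y
    x0+y1 = solve 2 (λ x y → x :* con (+ 0) :+ y :* con (+ 1) := y) refl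

  module Linear    = Representation *-monoid n
  module Quadratic = Representation matrixMonoid n
  open Power matrixMonoid using () renaming (_×_ to power)
  open Monoid matrixMonoid using () renaming (trans to ≋-trans; ∙-cong to ⊗-cong)

  -- Here β and d are the images of a and b. In a commutative monoid the conjugation relation says β
  -- = β⁻¹, and what remains of the presentation is d⁴ = βⁿ.
  record LinearParameters (β d : Carrier) : Set ℓ₁ where
    field
      β²≈1  : β * β ≈ 1#
      d⁴≈βⁿ : d ^ 4 ≈ β ^ n

  character : Carrier → Carrier → Normal n → Carrier
  character = Linear.image

  linearRelations : ∀ {β d} → LinearParameters β d → Linear.Relations β β d
  linearRelations {β} {d} params = record
    { inverseʳ = β²≈1
    ; inverseˡ = β²≈1
    ; A²ⁿ≈1    = begin
        β ^ (2 ℕ.* n)    ≈⟨ ^-assocʳ β 2 n ⟨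
        (β ^ 2) ^ n      ≈⟨ ^-congˡ n (trans (*-congˡ (*-identityʳ β)) β²≈1) ⟩
        1# ^ n           ≈⟨ Linear.power-1M n ⟩
        1#               ∎
    ; Aⁿ≈B⁴    = sym d⁴≈βⁿ
    ; BA≈A⁻¹B  = *-comm d β
    }
    where open LinearParameters params

  character-∙ : ∀ {β d} → LinearParameters β d → ∀ x y → character β d (x ∙ y) ≈ character β d x * character β d y
  character-∙ params = Linear.image-∙ (linearRelations params)

  character-ε : ∀ {β d} → LinearParameters β d → character β d ε ≈ 1#
  character-ε params = Linear.image-ε (linearRelations params)

  -- The matrix of b squares to the scalar c, so aⁿ = b⁴ asks for c² = αⁿ in one diagonal entry and
  -- c² = α⁻ⁿ in the other; α²ⁿ = 1 makes the two agree.
  record QuadraticParameters (α α⁻¹ c : Carrier) : Set ℓ₁ where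
    field
      αα⁻¹≈1 : α * α⁻¹ ≈ 1#
      α²ⁿ≈1  : α ^ (2 ℕ.* n) ≈ 1#
      c²≈αⁿ  : c * c ≈ α ^ n

    αᵐα⁻¹ᵐ≈1 : ∀ m → α ^ m * α⁻¹ ^ m ≈ 1#
    αᵐα⁻¹ᵐ≈1 m = begin
      α ^ m * α⁻¹ ^ m    ≈⟨ ^-distrib-* α α⁻¹ m ⟨
      (α * α⁻¹) ^ m      ≈⟨ ^-congˡ m αα⁻¹≈1 ⟩
      1# ^ m             ≈⟨ Linear.power-1M m ⟩
      1#                 ∎

    α⁻¹²ⁿ≈1 : α⁻¹ ^ (2 ℕ.* n) ≈ 1#
    α⁻¹²ⁿ≈1 = begin
      α⁻¹ ^ (2 ℕ.* n)                       ≈⟨ *-identityˡ _ ⟨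
      1# * α⁻¹ ^ (2 ℕ.* n)                  ≈⟨ *-congʳ α²ⁿ≈1 ⟨
      α ^ (2 ℕ.* n) * α⁻¹ ^ (2 ℕ.* n)       ≈⟨ αᵐα⁻¹ᵐ≈1 (2 ℕ.* n) ⟩
      1#                                    ∎

    c²≈α⁻¹ⁿ : c * c ≈ α⁻¹ ^ n
    c²≈α⁻¹ⁿ = begin
      c * c                                 ≈⟨ c²≈αⁿ ⟩
      α ^ n                                 ≈⟨ *-identityʳ _ ⟨
      α ^ n * 1#                            ≈⟨ *-congˡ α⁻¹²ⁿ≈1 ⟨
      α ^ n * α⁻¹ ^ (2 ℕ.* n)               ≡⟨ ≡.cong (λ m → α ^ n * α⁻¹ ^ (n ℕ.+ m)) (ℕ.+-identityʳ n) ⟩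
      α ^ n * α⁻¹ ^ (n ℕ.+ n)               ≈⟨ *-congˡ (^-homo-* α⁻¹ n n) ⟩
      α ^ n * (α⁻¹ ^ n * α⁻¹ ^ n)           ≈⟨ *-assoc _ _ _ ⟨
      α ^ n * α⁻¹ ^ n * α⁻¹ ^ n             ≈⟨ *-congʳ (αᵐα⁻¹ᵐ≈1 n) ⟩
      1# * α⁻¹ ^ n                          ≈⟨ *-identityˡ _ ⟩
      α⁻¹ ^ n                               ∎

  diagonal-power : ∀ p q m → power m (diagonal p q) ≋ diagonal (p ^ m) (q ^ m)
  diagonal-power p q zero    = λ i j → refl
  diagonal-power p q (suc m) = ≋-trans {j = diagonal p q ⊗ diagonal (p ^ m) (q ^ m)} {k = diagonal (p ^ suc m) (q ^ suc m)}
    (⊗-cong {x = diagonal p q} {u = power m (diagonal p q)} (λ i j → refl) (diagonal-power p q m))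
    (entrywise (x+00 p (p ^ m)) (x0+0y p (q ^ m)) (0x+y0 (p ^ m) q) (00+x q (q ^ m)))
    where
    x+00 : ∀ x y → x * y + 0# * 0# ≈ x * y
    x+00 = solve 2 (λ x y → x :* y :+ con (+ 0) :* con (+ 0) := x :* y) refl
    00+x : ∀ x y → 0# * 0# + x * y ≈ x * y
    00+x = solve 2 (λ x y → con (+ 0) :* con (+ 0) :+ x :* y := x :* y) refl
    x0+0y : ∀ x y → x * 0# + 0# * y ≈ 0#
    x0+0y = solve 2 (λ x y → x :* con (+ 0) :+ con (+ 0) :* y := con (+ 0)) refl
    0x+y0 : ∀ x y → 0# * x + y * 0# ≈ 0#
    0x+y0 = solve 2 (λ x y → con (+ 0) :* x :+ y :* con (+ 0) := con (+ 0)) refl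

  ρ : Carrier → Carrier → Carrier → Normal n → Matrix
  ρ α α⁻¹ c = Quadratic.image (diagonal α α⁻¹) (matrix 0# c 1# 0#)

  module _ (α α⁻¹ c : Carrier) where
    -- `ρ` multiplied out for each power of b. With literal zeros the diagonal or anti-diagonal
    -- shape, and with it the vanishing of traces, can be read off by computation.
    entry : Normal n → Matrix
    entry (a^ r b^ 0F) = diagonal (α ^ toℕ r) (α⁻¹ ^ toℕ r)
    entry (a^ r b^ 1F) = matrix 0# (α ^ toℕ r * c) (α⁻¹ ^ toℕ r) 0#
    entry (a^ r b^ 2F) = diagonal (α ^ toℕ r * c) (α⁻¹ ^ toℕ r * c)
    entry (a^ r b^ 3F) = matrix 0# (α ^ toℕ r * (c * c)) (α⁻¹ ^ toℕ r * c) 0#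

    private
      B : Matrix
      B = matrix 0# c 1# 0#

      xp+0r : ∀ x p r → x * p + 0# * r ≈ x * p
      xp+0r = solve 3 (λ x p r → x :* p :+ con (+ 0) :* r := x :* p) refl

      0p+yr : ∀ y p r → 0# * p + y * r ≈ y * r
      0p+yr = solve 3 (λ y p r → con (+ 0) :* p :+ y :* r := y :* r) refl

      diagonal-⊗ : ∀ x y p q r s → diagonal x y ⊗ matrix p q r s ≋ matrix (x * p) (x * q) (y * r) (y * s)
      diagonal-⊗ x y p q r s = entrywise (xp+0r x p r) (xp+0r x q s) (0p+yr y p r) (0p+yr y q s)

      B-⊗ : ∀ p q r s → B ⊗ matrix p q r s ≋ matrix (c * r) (c * s) p q
      B-⊗ p q r s = entrywise (0p+yr c p r) (0p+yr c q s)
        (trans (xp+0r 1# p r) (*-identityˡ p)) (trans (xp+0r 1# q s) (*-identityˡ q))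

      Bᵖ : Fin 4 → Matrix
      Bᵖ 0F = diagonal 1# 1#
      Bᵖ 1F = B
      Bᵖ 2F = diagonal c c
      Bᵖ 3F = matrix 0# (c * c) c 0#

      step : ∀ m {X} {p q r s} → power m B ≋ matrix p q r s → matrix (c * r) (c * s) p q ≋ X → power (suc m) B ≋ X
      step m {X} {p} {q} {r} {s} eq eq′ = ≋-trans {i = power (suc m) B} {k = X}
        (⊗-cong {x = B} {u = power m B} (λ i j → refl) eq) (≋-trans {k = X} (B-⊗ p q r s) eq′)

      B¹ : power 1 B ≋ B
      B¹ = step 0 {B} (λ i j → refl) (entrywise (zeroʳ c) (*-identityʳ c) refl refl)

      B² : power 2 B ≋ Bᵖ 2F
      B² = step 1 {Bᵖ 2F} B¹ (entrywise (*-identityʳ c) (zeroʳ c) refl refl)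

    B-power : ∀ s → power (toℕ s) B ≋ Bᵖ s
    B-power 0F = λ i j → refl
    B-power 1F = B¹
    B-power 2F = B²
    B-power 3F = step 2 {Bᵖ 3F} B² (entrywise (zeroʳ c) refl refl refl)

    ρ≋entry : ∀ x → ρ α α⁻¹ c x ≋ entry x
    ρ≋entry (a^ r b^ s) = ≋-trans {j = diagonal x y ⊗ Bᵖ s} {k = entry (a^ r b^ s)}
      (⊗-cong {x = power (toℕ r) (diagonal α α⁻¹)} {u = power (toℕ s) B} (diagonal-power α α⁻¹ (toℕ r)) (B-power s))
      (go s)
      where
      x y : Carrier
      x = α ^ toℕ r
      y = α⁻¹ ^ toℕ r
      go : ∀ s → (diagonal x y ⊗ Bᵖ s) ≋ entry (a^ r b^ s)
      go 0F = ≋-trans {k = entry (a^ r b^ 0F)} (diagonal-⊗ x y 1# 0# 0# 1#)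
        (entrywise (*-identityʳ x) (zeroʳ x) (zeroʳ y) (*-identityʳ y))
      go 1F = ≋-trans {k = entry (a^ r b^ 1F)} (diagonal-⊗ x y 0# c 1# 0#)
        (entrywise (zeroʳ x) refl (*-identityʳ y) (zeroʳ y))
      go 2F = ≋-trans {k = entry (a^ r b^ 2F)} (diagonal-⊗ x y c 0# 0# c)
        (entrywise refl (zeroʳ x) (zeroʳ y) refl)
      go 3F = ≋-trans {k = entry (a^ r b^ 3F)} (diagonal-⊗ x y 0# (c * c) c 0#)
        (entrywise (zeroʳ x) refl refl (zeroʳ y))

    relations : QuadraticParameters α α⁻¹ c → Quadratic.Relations (diagonal α α⁻¹) (diagonal α⁻¹ α) B
    relations params = record
      { inverseʳ = ≋-trans {k = diagonal 1# 1#} (diagonal-⊗ α α⁻¹ α⁻¹ 0# 0# α)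
          (entrywise αα⁻¹≈1 (zeroʳ α) (zeroʳ α⁻¹) (trans (*-comm α⁻¹ α) αα⁻¹≈1))
      ; inverseˡ = ≋-trans {k = diagonal 1# 1#} (diagonal-⊗ α⁻¹ α α 0# 0# α⁻¹)
          (entrywise (trans (*-comm α⁻¹ α) αα⁻¹≈1) (zeroʳ α⁻¹) (zeroʳ α) αα⁻¹≈1)
      ; A²ⁿ≈1    = ≋-trans {k = diagonal 1# 1#} (diagonal-power α α⁻¹ (2 ℕ.* n))
          (entrywise α²ⁿ≈1 refl refl α⁻¹²ⁿ≈1)
      ; Aⁿ≈B⁴    = ≋-trans {k = power 4 B} (diagonal-power α α⁻¹ n)
          (λ i j → sym (step 3 {diagonal (α ^ n) (α⁻¹ ^ n)} (B-power 3F)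
            (entrywise c²≈αⁿ (zeroʳ c) refl c²≈α⁻¹ⁿ) i j))
      ; BA≈A⁻¹B  = ≋-trans {k = diagonal α⁻¹ α ⊗ B} (B-⊗ α 0# 0# α⁻¹)
          (λ i j → sym (≋-trans {k = matrix (c * 0#) (c * α⁻¹) α 0#} (diagonal-⊗ α⁻¹ α 0# c 1# 0#)
            (entrywise (trans (zeroʳ α⁻¹) (sym (zeroʳ c))) (*-comm α⁻¹ c) (*-identityʳ α) (zeroʳ α)) i j))
      }
      where open QuadraticParameters params

    ρ-∙ : QuadraticParameters α α⁻¹ c → ∀ x y → ρ α α⁻¹ c (x ∙ y) ≋ ρ α α⁻¹ c x ⊗ ρ α α⁻¹ c y
    ρ-∙ params = Quadratic.image-∙ (relations params)

    ρ-ε : QuadraticParameters α α⁻¹ c → ρ α α⁻¹ c ε ≋ diagonal 1# 1#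
    ρ-ε params = Quadratic.image-ε (relations params)

-- Eigenvalues of the Cayley graph of an arbitrary finite group.

module CayleySpectrum {c ℓ₁ ℓ₂ p} (K : AlgClosedField₀ c ℓ₁ ℓ₂) (G : FiniteGroup)
  {S : Pred (FiniteGroup.Carrier G) p} (S? : Decidable S)
  (ε∉S : FiniteGroup.ε G ∉ S) (S≐S⁻¹ : S ≐ FiniteGroup._⁻¹ˢ G S) where
  open AlgClosedField₀ K renaming (Carrier to Scalar)
  open Scalars K
  open FiniteSums K
  open GroupSums K G
  open FiniteGroup G
  open GroupProperties group using (⁻¹-involutive; ⁻¹-anti-homo-∙; ε⁻¹≈ε)
  open Spectrum K (Cay G S? ε∉S S≐S⁻¹)
  open SetoidReasoning setoid

  ⁻¹-closed : ∀ {x} → x ∈ S → x ⁻¹ ∈ S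
  ⁻¹-closed {x} x∈S = proj₂ S≐S⁻¹ (x , x∈S , ≡.refl)

  does-⁻¹ : ∀ x → does (S? (x ⁻¹)) ≡ does (S? x)
  does-⁻¹ x = does-⇔ (mk⇔ (≡.subst S (⁻¹-involutive x) ∘ ⁻¹-closed) ⁻¹-closed) (S? (x ⁻¹)) (S? x)

  s : Carrier → Scalar
  s x = indicator (does (S? x))

  -- The substitution y = z x turns x y⁻¹ into z⁻¹, and membership in S is invariant under
  -- inversion.
  adjacency-translation : ∀ (v : Carrier → Scalar) x → ∑ enum (λ y → adjacency x y * v y) ≈ ∑ enum (λ z → s z * v (z ∙ x))
  adjacency-translation v x = begin
    ∑ enum (λ y → s (x ∙ y ⁻¹) * v y)                      ≈⟨ ∑-∙ʳ x (λ y → s (x ∙ y ⁻¹) * v y) ⟨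
    ∑ enum (λ z → s (x ∙ (z ∙ x) ⁻¹) * v (z ∙ x))
      ≈⟨ ∑-cong enum (λ z → *-congʳ {v (z ∙ x)} (reflexive (≡.cong indicator
           (≡.trans (≡.cong (does ∘ S?) (simplify z)) (does-⁻¹ z))))) ⟩
    ∑ enum (λ z → s z * v (z ∙ x))                         ∎
    where
    simplify : ∀ z → x ∙ (z ∙ x) ⁻¹ ≡ z ⁻¹
    simplify z = ≡.trans (≡.cong (x ∙_) (⁻¹-anti-homo-∙ z x))
      (≡.trans (≡.sym (assoc x (x ⁻¹) (z ⁻¹))) (≡.trans (≡.cong (_∙ z ⁻¹) (inverseʳ x)) (identityˡ (z ⁻¹))))

  eigenfunction : ∀ {μ} (f : Carrier → Scalar) {x} → f x # 0# → (∀ x → ∑ enum (λ z → s z * f (z ∙ x)) ≈ μ * f x) → IsEigenvalue μ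
  eigenfunction f fx#0 eq = f , (_ , fx#0) , λ x → trans (adjacency-translation f x) (eq x)

  -- Up to a translation and an inversion, w is the eigenvector: μ ⟨w , f⟩ = ⟨w , fS⟩ with (fS)(y) = Σ_{z ∈ S} f(yz).
  eigenvalue-pairing : ∀ {μ} → IsEigenvalue μ → ∃ λ (w : Carrier → Scalar) → w ε # 0# ×
    (∀ (f : Carrier → Scalar) → μ * ∑ enum (λ x → w x * f x) ≈ ∑ enum (λ y → w y * ∑ enum (λ z → s z * f (y ∙ z))))
  eigenvalue-pairing {μ} (v , (x₀ , vx₀#0) , eigen) =
    w , ≡.subst (λ x → v x # 0#) (≡.sym (≡.trans (≡.cong (_∙ x₀) ε⁻¹≈ε) (identityˡ x₀))) vx₀#0 , pairing
    where
    -- Translation by x₀ moves the nonzero value of v to ε. The inversion turns the left factor z ∈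
    -- S into a right factor z⁻¹, which a substitution can shift onto f.
    w : Carrier → Scalar
    w x = v (x ⁻¹ ∙ x₀)
    w-eigen : ∀ x → μ * w x ≈ ∑ enum (λ z → s z * w (x ∙ z ⁻¹))
    w-eigen x = trans (sym (eigen (x ⁻¹ ∙ x₀))) (trans (adjacency-translation v (x ⁻¹ ∙ x₀))
      (∑-cong enum λ z → *-congˡ {s z} (reflexive (≡.cong v (≡.trans (≡.sym (assoc z (x ⁻¹) x₀))
        (≡.cong (_∙ x₀) (≡.sym (≡.trans (⁻¹-anti-homo-∙ x (z ⁻¹)) (≡.cong (_∙ x ⁻¹) (⁻¹-involutive z)))))))))) 
    cancel : ∀ x z → (x ∙ z) ∙ z ⁻¹ ≡ x
    cancel x z = ≡.trans (assoc x z (z ⁻¹)) (≡.trans (≡.cong (x ∙_) (inverseʳ z)) (identityʳ x))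
    pairing : ∀ (f : Carrier → Scalar) → μ * ∑ enum (λ x → w x * f x) ≈ ∑ enum (λ y → w y * ∑ enum (λ z → s z * f (y ∙ z)))
    pairing f = begin
      μ * ∑ enum (λ x → w x * f x)
        ≈⟨ *-∑ enum μ (λ x → w x * f x) ⟩
      ∑ enum (λ x → μ * (w x * f x))
        ≈⟨ ∑-cong enum (λ x → trans (sym (*-assoc _ _ _)) (trans (*-congʳ (w-eigen x))
             (∑-* enum (f x) (λ z → s z * w (x ∙ z ⁻¹))))) ⟩
      ∑ enum (λ x → ∑ enum (λ z → s z * w (x ∙ z ⁻¹) * f x))
        ≈⟨ ∑-comm enum enum (λ x z → s z * w (x ∙ z ⁻¹) * f x) ⟩
      ∑ enum (λ z → ∑ enum (λ x → s z * w (x ∙ z ⁻¹) * f x))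
        -- Substituting x = y z transfers the action of S from w to f.
        ≈⟨ ∑-cong enum (λ z → ∑-∙ʳ z (λ x → s z * w (x ∙ z ⁻¹) * f x)) ⟨
      ∑ enum (λ z → ∑ enum (λ y → s z * w ((y ∙ z) ∙ z ⁻¹) * f (y ∙ z)))
        ≈⟨ ∑-cong enum (λ z → ∑-cong enum λ y → trans
             (*-congʳ {f (y ∙ z)} (trans (*-congˡ {s z} (reflexive (≡.cong w (cancel y z)))) (*-comm _ _))) (*-assoc _ _ _)) ⟩
      ∑ enum (λ z → ∑ enum (λ y → w y * (s z * f (y ∙ z))))
        ≈⟨ ∑-comm enum enum (λ z y → w y * (s z * f (y ∙ z))) ⟩
      ∑ enum (λ y → ∑ enum (λ z → w y * (s z * f (y ∙ z))))
        ≈⟨ ∑-cong enum (λ y → *-∑ enum (w y) (λ z → s z * f (y ∙ z))) ⟨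
      ∑ enum (λ y → w y * ∑ enum (λ z → s z * f (y ∙ z)))  ∎

  module LinearCharacter {χ : Carrier → Scalar} (χ-∙ : ∀ x y → χ (x ∙ y) ≈ χ x * χ y) where
    open CharacterSums K G using (_⟪_⟫)
    open FieldProperties K

    χ⟪S⟫ : Scalar
    χ⟪S⟫ = ∑ enum (λ z → s z * χ z)

    χ⟪S⟫≈ : χ ⟪ S? ⟫ ≈ χ⟪S⟫
    χ⟪S⟫≈ = ∑-cong enum λ z → if≈indicator* (does (S? z)) (χ z)

    isEigenvalue : χ ε # 0# → IsEigenvalue (χ ⟪ S? ⟫)
    isEigenvalue χε#0 = eigenfunction χ χε#0 λ x → begin
      ∑ enum (λ z → s z * χ (z ∙ x))     ≈⟨ ∑-cong enum (λ z → trans (*-congˡ {s z} (χ-∙ z x)) (sym (*-assoc _ _ _))) ⟩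
      ∑ enum (λ z → s z * χ z * χ x)     ≈⟨ ∑-* enum (χ x) (λ z → s z * χ z) ⟨
      χ⟪S⟫ * χ x                         ≈⟨ *-congʳ χ⟪S⟫≈ ⟨
      χ ⟪ S? ⟫ * χ x                     ∎

    -- With f = χ the right side of the pairing factors, giving μ V = V χ(S) for V = ⟨w , χ⟩; a
    -- nonzero V cancels.
    ⟨w,χ⟩≈0⊎μ≈χ⟪S⟫ : ∀ {μ} {w : Carrier → Scalar} →
      (∀ (f : Carrier → Scalar) → μ * ∑ enum (λ x → w x * f x) ≈ ∑ enum (λ y → w y * ∑ enum (λ z → s z * f (y ∙ z)))) →
      ∑ enum (λ x → w x * χ x) ≈ 0# ⊎ μ ≈ χ ⟪ S? ⟫
    ⟨w,χ⟩≈0⊎μ≈χ⟪S⟫ {μ} {w} pairing = conclude (≈0⊎#0 V)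
      where
      open Solver
      V : Scalar
      V = ∑ enum (λ x → w x * χ x)
      μV≈Vχ⟪S⟫ : μ * V ≈ V * χ⟪S⟫
      μV≈Vχ⟪S⟫ = begin
        μ * V                                                  ≈⟨ pairing χ ⟩
        ∑ enum (λ y → w y * ∑ enum (λ z → s z * χ (y ∙ z)))
          ≈⟨ ∑-cong enum (λ y → *-congˡ {w y} (∑-cong enum λ z → trans (*-congˡ {s z} (χ-∙ y z))
               (solve 3 (λ s x y → s :* (x :* y) := x :* (s :* y)) refl (s z) (χ y) (χ z)))) ⟩
        ∑ enum (λ y → w y * ∑ enum (λ z → χ y * (s z * χ z)))
          ≈⟨ ∑-cong enum (λ y → trans (*-congˡ {w y} (sym (*-∑ enum (χ y) (λ z → s z * χ z)))) (sym (*-assoc _ _ _))) ⟩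
        ∑ enum (λ y → w y * χ y * χ⟪S⟫)                        ≈⟨ ∑-* enum χ⟪S⟫ (λ y → w y * χ y) ⟨
        V * χ⟪S⟫                                               ∎
      conclude : V ≈ 0# ⊎ V # 0# → V ≈ 0# ⊎ μ ≈ χ ⟪ S? ⟫
      conclude (inj₁ V≈0) = inj₁ V≈0
      conclude (inj₂ V#0) = inj₂ (trans (x-y≈0⇒x≈y (#0-cancelˡ V#0 (begin
        V * (μ - χ⟪S⟫)        ≈⟨ solve 3 (λ v μ x → v :* (μ :- x) := μ :* v :- v :* x) refl V μ χ⟪S⟫ ⟩
        μ * V - V * χ⟪S⟫      ≈⟨ x≈y⇒x-y≈0 μV≈Vχ⟪S⟫ ⟩
        0#                    ∎))) (sym χ⟪S⟫≈))

-- Traces of degree-two representations and their sums over subsets.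

module QuadraticCharacters {c ℓ₁ ℓ₂} (K : AlgClosedField₀ c ℓ₁ ℓ₂) (n : ℕ) .{{_ : NonZero n}} where
  open AlgClosedField₀ K renaming (Carrier to Scalar)
  open Scalars K
  open FiniteSums K
  open FieldProperties K
  open MatrixRepresentations K n
  open FiniteGroup (T n) using (enum; _∙_)
  open CharacterSums K (T n)
  open SetoidReasoning setoid
  open Solver

  sumOver : ∀ {p} {A : Pred (Normal n) p} → Decidable A → (Normal n → Scalar) → Scalar
  sumOver A? f = ∑ enum λ x → indicator (does (A? x)) * f x

  ⟪⟫≈sumOver : ∀ {p} {A : Pred (Normal n) p} (A? : Decidable A) f → f ⟪ A? ⟫ ≈ sumOver A? f
  ⟪⟫≈sumOver A? f = ∑-cong enum λ x → if≈indicator* (does (A? x)) (f x)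

  module _ {p} {A : Pred (Normal n) p} (A? : Decidable A) where
    private
      a : Normal n → Scalar
      a x = indicator (does (A? x))

    sumOver-≈0 : ∀ f → (∀ x → x ∈ A → f x ≈ 0#) → sumOver A? f ≈ 0#
    sumOver-≈0 f f≈0 = ∑-0 enum go
      where
      go : ∀ x → a x * f x ≈ 0#
      go x with A? x
      ... | yes x∈A = trans (*-congˡ (f≈0 x x∈A)) (zeroʳ _)
      ... | no _    = zeroˡ _

    sumOver-+ : ∀ f g → sumOver A? (λ x → f x + g x) ≈ sumOver A? f + sumOver A? g
    sumOver-+ f g = trans (∑-cong enum λ x → distribˡ (a x) (f x) (g x)) (∑-+ enum (λ x → a x * f x) (λ x → a x * g x))

    private
      product : ∀ f g → ∑ enum (λ x → ∑ enum (λ y → (a x * f x) * (a y * g y))) ≈ sumOver A? f * sumOver A? g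
      product f g = trans (∑-cong enum λ x → sym (*-∑ enum (a x * f x) (λ y → a y * g y)))
        (sym (∑-* enum (sumOver A? g) (λ x → a x * f x)))

      ∑∑-+ : ∀ (f g : Normal n → Normal n → Scalar) →
        ∑ enum (λ x → ∑ enum (λ y → f x y + g x y))
        ≈ ∑ enum (λ x → ∑ enum (λ y → f x y)) + ∑ enum (λ x → ∑ enum (λ y → g x y))
      ∑∑-+ f g = trans (∑-cong enum λ x → ∑-+ enum (f x) (g x))
        (∑-+ enum (λ x → ∑ enum (f x)) (λ x → ∑ enum (g x)))

    -- The right side is the trace of `M ⊗ M` for M = e(A): as e is multiplicative, the sum of tr
    -- e(xy) over pairs is a sum of products of entries of M.
    ⟪²⟫-trace : ∀ (e : Normal n → Matrix) → (∀ x y → e (x ∙ y) ≋ (e x ⊗ e y)) →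
      let M : Matrix
          M i j = sumOver A? λ x → e x i j
      in (λ x → e x 0F 0F + e x 1F 1F) ⟪ A? ²⟫
         ≈ (M 0F 0F * M 0F 0F + M 0F 1F * M 1F 0F) + (M 1F 0F * M 0F 1F + M 1F 1F * M 1F 1F)
    ⟪²⟫-trace e e-∙ = begin
      (λ x → e x 0F 0F + e x 1F 1F) ⟪ A? ²⟫
        ≈⟨ ∑-cong enum (λ x → ∑-cong enum λ y → pointwise x y) ⟩
      ∑ enum (λ x → ∑ enum (λ y → (t 0F 0F x y + t 0F 1F x y) + (t 1F 0F x y + t 1F 1F x y)))
        ≈⟨ ∑∑-+ (λ x y → t 0F 0F x y + t 0F 1F x y) (λ x y → t 1F 0F x y + t 1F 1F x y) ⟩
      _ ≈⟨ +-cong (∑∑-+ (t 0F 0F) (t 0F 1F)) (∑∑-+ (t 1F 0F) (t 1F 1F)) ⟩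
      _ ≈⟨ +-cong (+-cong (entries 0F 0F) (entries 0F 1F)) (+-cong (entries 1F 0F) (entries 1F 1F)) ⟩
      _ ∎
      where
      t : Fin 2 → Fin 2 → Normal n → Normal n → Scalar
      t i j x y = (a x * e x i j) * (a y * e y j i)
      entries : ∀ i j → ∑ enum (λ x → ∑ enum (λ y → t i j x y))
        ≈ sumOver A? (λ x → e x i j) * sumOver A? (λ x → e x j i)
      entries i j = product (λ x → e x i j) (λ x → e x j i)
      pointwise : ∀ x y → (if does (A? x) ∧ does (A? y) then e (x ∙ y) 0F 0F + e (x ∙ y) 1F 1F else 0#)
        ≈ (t 0F 0F x y + t 0F 1F x y) + (t 1F 0F x y + t 1F 1F x y)
      pointwise x y = begin
        (if does (A? x) ∧ does (A? y) then e (x ∙ y) 0F 0F + e (x ∙ y) 1F 1F else 0#)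
          ≈⟨ if≈indicator* (does (A? x) ∧ does (A? y)) _ ⟩
        indicator (does (A? x) ∧ does (A? y)) * (e (x ∙ y) 0F 0F + e (x ∙ y) 1F 1F)
          ≈⟨ *-cong (indicator-∧ (does (A? x)) (does (A? y))) (+-cong (e-∙ x y 0F 0F) (e-∙ x y 1F 1F)) ⟩
        (a x * a y) * ((e x ⊗ e y) 0F 0F + (e x ⊗ e y) 1F 1F)
          ≈⟨ solve 10 (λ a b x₀₀ x₀₁ x₁₀ x₁₁ y₀₀ y₀₁ y₁₀ y₁₁ →
               (a :* b) :* ((x₀₀ :* y₀₀ :+ x₀₁ :* y₁₀) :+ (x₁₀ :* y₀₁ :+ x₁₁ :* y₁₁))
               := ((a :* x₀₀) :* (b :* y₀₀) :+ (a :* x₀₁) :* (b :* y₁₀))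
                  :+ ((a :* x₁₀) :* (b :* y₀₁) :+ (a :* x₁₁) :* (b :* y₁₁)))
               refl (a x) (a y) (e x 0F 0F) (e x 0F 1F) (e x 1F 0F) (e x 1F 1F)
               (e y 0F 0F) (e y 0F 1F) (e y 1F 0F) (e y 1F 1F) ⟩
        (t 0F 0F x y + t 0F 1F x y) + (t 1F 0F x y + t 1F 1F x y) ∎

  trace : Scalar → Scalar → Scalar → Normal n → Scalar
  trace α α⁻¹ c x = entry α α⁻¹ c x 0F 0F + entry α α⁻¹ c x 1F 1F

  entry-∙ : ∀ {α α⁻¹ c} → QuadraticParameters α α⁻¹ c → ∀ x y → entry α α⁻¹ c (x ∙ y) ≋ (entry α α⁻¹ c x ⊗ entry α α⁻¹ c y)
  entry-∙ {α} {α⁻¹} {c} params x y i j = begin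
    entry α α⁻¹ c (x ∙ y) i j                 ≈⟨ ρ≋entry α α⁻¹ c (x ∙ y) i j ⟨
    ρ α α⁻¹ c (x ∙ y) i j                     ≈⟨ ρ-∙ α α⁻¹ c params x y i j ⟩
    (ρ α α⁻¹ c x ⊗ ρ α α⁻¹ c y) i j
      ≈⟨ +-cong (*-cong (ρ≋entry α α⁻¹ c x i 0F) (ρ≋entry α α⁻¹ c y 0F j))
                (*-cong (ρ≋entry α α⁻¹ c x i 1F) (ρ≋entry α α⁻¹ c y 1F j)) ⟩
    (entry α α⁻¹ c x ⊗ entry α α⁻¹ c y) i j   ∎

-- Degree-two representations when S splits by the parity of the exponent of b.

module SplitConnectionSet {c ℓ₁ ℓ₂ p} (K : AlgClosedField₀ c ℓ₁ ℓ₂) (n : ℕ) .{{_ : NonZero n}}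
  {S₁ S₂ : Pred (Normal n) p} (S₁? : Decidable S₁) (S₂? : Decidable S₂)
  (S₁⊆ : S₁ ⊆ ⟨a⟩b^ 0F ∪ ⟨a⟩b^ 2F) (S₂⊆ : S₂ ⊆ ⟨a⟩b^ 1F ∪ ⟨a⟩b^ 3F)
  (ε∉S : FiniteGroup.ε (T n) ∉ S₁ ∪ S₂) (S≐S⁻¹ : (S₁ ∪ S₂) ≐ FiniteGroup._⁻¹ˢ (T n) (S₁ ∪ S₂)) where
  open AlgClosedField₀ K renaming (Carrier to Scalar)
  open Scalars K
  open FiniteSums K
  open GroupSums K (T n)
  open FieldProperties K
  open MatrixRepresentations K n
  open QuadraticCharacters K n
  open FiniteGroup (T n) using (enum; _∙_; ε; _⁻¹; group)
  open GroupProperties group using (⁻¹-involutive; ⁻¹-anti-homo-∙)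
  open CharacterSums K (T n)
  open Discriminant K (T n)
  open CayleySpectrum K (T n) (S₁? ∪? S₂?) ε∉S S≐S⁻¹
  open Spectrum K (Cay (T n) (S₁? ∪? S₂?) ε∉S S≐S⁻¹)
  open SetoidReasoning setoid
  open Solver

  even∉odd : ∀ {x} → x ∈ ⟨a⟩b^ {n} 0F ∪ ⟨a⟩b^ 2F → x ∉ ⟨a⟩b^ 1F ∪ ⟨a⟩b^ 3F
  even∉odd (inj₁ (_ , ≡.refl)) (inj₁ (_ , ()))
  even∉odd (inj₁ (_ , ≡.refl)) (inj₂ (_ , ()))
  even∉odd (inj₂ (_ , ≡.refl)) (inj₁ (_ , ()))
  even∉odd (inj₂ (_ , ≡.refl)) (inj₂ (_ , ()))

  S₁∩S₂≡∅ : ∀ {x} → x ∈ S₁ → x ∉ S₂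
  S₁∩S₂≡∅ x∈S₁ x∈S₂ = even∉odd (S₁⊆ x∈S₁) (S₂⊆ x∈S₂)

  s≈s₁+s₂ : ∀ x → s x ≈ indicator (does (S₁? x)) + indicator (does (S₂? x))
  s≈s₁+s₂ x with S₁? x | S₂? x
  ... | yes x∈S₁ | yes x∈S₂ = contradiction x∈S₂ (S₁∩S₂≡∅ x∈S₁)
  ... | yes _    | no _     = sym (+-identityʳ 1#)
  ... | no _     | yes _    = sym (+-identityˡ 1#)
  ... | no _     | no _     = sym (+-identityˡ 0#)

  sumOver-∪ : ∀ f → ∑ enum (λ x → s x * f x) ≈ sumOver S₁? f + sumOver S₂? f
  sumOver-∪ f = trans (∑-cong enum λ x → trans (*-congʳ (s≈s₁+s₂ x)) (distribʳ (f x) _ _))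
    (∑-+ enum (λ x → indicator (does (S₁? x)) * f x) (λ x → indicator (does (S₂? x)) * f x))

  IntegralSquares : (Normal n → Scalar) → Set ℓ₁
  IntegralSquares f =
    (IsInteger (f ⟪ S₁? ⟫) × IsInteger (squares S₁? S₂? f)) × IsPerfectSquare (Δ S₁? S₂? f)

  if-cong : ∀ b {y z} → y ≈ z → (if b then y else 0#) ≈ (if b then z else 0#)
  if-cong true  y≈z = y≈z
  if-cong false _   = refl

  module _ {f g : Normal n → Scalar} (f≈g : ∀ x → f x ≈ g x) where
    ⟪⟫-cong : ∀ {A : Pred (Normal n) p} (A? : Decidable A) → f ⟪ A? ⟫ ≈ g ⟪ A? ⟫
    ⟪⟫-cong A? = ∑-cong enum λ x → if-cong (does (A? x)) (f≈g x)

    ⟪²⟫-cong : ∀ {A : Pred (Normal n) p} (A? : Decidable A) → f ⟪ A? ²⟫ ≈ g ⟪ A? ²⟫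
    ⟪²⟫-cong A? = ∑-cong enum λ x → ∑-cong enum λ y → if-cong (does (A? x) ∧ does (A? y)) (f≈g (x ∙ y))

  -- The conditions see f only through these three sums. This covers pointwise equal functions, and
  -- also a character and its dual, which may differ pointwise.
  IntegralSquares-resp : ∀ {f g} → f ⟪ S₁? ⟫ ≈ g ⟪ S₁? ⟫ → f ⟪ S₁? ²⟫ ≈ g ⟪ S₁? ²⟫ → f ⟪ S₂? ²⟫ ≈ g ⟪ S₂? ²⟫ →
    IntegralSquares f → IntegralSquares g
  IntegralSquares-resp {f} {g} linear square₁ square₂ ((t , q) , Δ-square) =
      (IsInteger-cong linear t , IsInteger-cong squares≈ q)
    , IsPerfectSquare-cong
        (+-cong (+-cong squares≈ (+-congʳ squares≈)) (-‿cong (*-cong linear (*-congʳ linear)))) Δ-square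
    where
    squares≈ : squares S₁? S₂? f ≈ squares S₁? S₂? g
    squares≈ = +-cong square₁ square₂

  IntegralSquares-cong : ∀ {f g} → (∀ x → f x ≈ g x) → IntegralSquares f → IntegralSquares g
  IntegralSquares-cong {f} {g} f≈g = IntegralSquares-resp {f} {g} (⟪⟫-cong f≈g S₁?) (⟪²⟫-cong f≈g S₁?) (⟪²⟫-cong f≈g S₂?)

  even-⁻¹ : ∀ x → x ∈ ⟨a⟩b^ 0F ∪ ⟨a⟩b^ 2F → x ⁻¹ ∈ ⟨a⟩b^ {n} 0F ∪ ⟨a⟩b^ 2F
  even-⁻¹ _ (inj₁ (r , ≡.refl)) = inj₁ (_ , ≡.refl)
  even-⁻¹ _ (inj₂ (r , ≡.refl)) = inj₂ (_ , ≡.refl)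

  odd-⁻¹ : ∀ x → x ∈ ⟨a⟩b^ 1F ∪ ⟨a⟩b^ 3F → x ⁻¹ ∈ ⟨a⟩b^ {n} 1F ∪ ⟨a⟩b^ 3F
  odd-⁻¹ _ (inj₁ (r , ≡.refl)) = inj₂ (_ , ≡.refl)
  odd-⁻¹ _ (inj₂ (r , ≡.refl)) = inj₁ (_ , ≡.refl)

  -- Inversion preserves the parity of the exponent of b, and this parity separates S₁ from S₂; so
  -- the symmetry of S passes to each part.
  S₁-⁻¹ : ∀ {x} → x ∈ S₁ → x ⁻¹ ∈ S₁
  S₁-⁻¹ {x} x∈S₁ with ⁻¹-closed (inj₁ x∈S₁)
  ... | inj₁ x⁻¹∈S₁ = x⁻¹∈S₁
  ... | inj₂ x⁻¹∈S₂ = contradiction (S₂⊆ x⁻¹∈S₂) (even∉odd (even-⁻¹ x (S₁⊆ x∈S₁)))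

  S₂-⁻¹ : ∀ {x} → x ∈ S₂ → x ⁻¹ ∈ S₂
  S₂-⁻¹ {x} x∈S₂ with ⁻¹-closed (inj₂ x∈S₂)
  ... | inj₁ x⁻¹∈S₁ = contradiction (odd-⁻¹ x (S₂⊆ x∈S₂)) (even∉odd (S₁⊆ x⁻¹∈S₁))
  ... | inj₂ x⁻¹∈S₂ = x⁻¹∈S₂

  module _ {A : Pred (Normal n) p} (A? : Decidable A) (A-⁻¹ : ∀ {x} → x ∈ A → x ⁻¹ ∈ A) (f : Normal n → Scalar) where
    private
      A?-⁻¹ : ∀ x → does (A? (x ⁻¹)) ≡ does (A? x)
      A?-⁻¹ x = does-⇔ (mk⇔ (≡.subst A (⁻¹-involutive x) ∘ A-⁻¹) A-⁻¹) (A? (x ⁻¹)) (A? x)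

    ⟪⟫-dual : (f ∘ _⁻¹) ⟪ A? ⟫ ≈ f ⟪ A? ⟫
    ⟪⟫-dual = trans
      (∑-cong enum λ x → reflexive (≡.cong (λ b → if b then f (x ⁻¹) else 0#) (≡.sym (A?-⁻¹ x))))
      (∑-⁻¹ (λ x → if does (A? x) then f x else 0#))

    -- Since (xy)⁻¹ = y⁻¹x⁻¹, reindexing both variables by inversion reverses the order of the
    -- factors, and exchanging the sums restores it.
    ⟪²⟫-dual : (f ∘ _⁻¹) ⟪ A? ²⟫ ≈ f ⟪ A? ²⟫
    ⟪²⟫-dual = begin
      ∑ enum (λ x → ∑ enum (λ y → if does (A? x) ∧ does (A? y) then f ((x ∙ y) ⁻¹) else 0#))
        ≈⟨ ∑-cong enum (λ x → ∑-cong enum λ y → reflexive (≡.trans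
             (≡.cong₂ (λ b z → if b then f z else 0#)
               (≡.sym (≡.cong₂ _∧_ (A?-⁻¹ x) (A?-⁻¹ y))) (⁻¹-anti-homo-∙ x y))
             (≡.cong (λ b → if b then f (y ⁻¹ ∙ x ⁻¹) else 0#)
               (∧-comm (does (A? (x ⁻¹))) (does (A? (y ⁻¹))))))) ⟩
      ∑ enum (λ x → ∑ enum (λ y → F (y ⁻¹) (x ⁻¹)))    ≈⟨ ∑-cong enum (λ x → ∑-⁻¹ (λ y → F y (x ⁻¹))) ⟩
      ∑ enum (λ x → ∑ enum (λ y → F y (x ⁻¹)))         ≈⟨ ∑-⁻¹ (λ x → ∑ enum (λ y → F y x)) ⟩
      ∑ enum (λ x → ∑ enum (λ y → F y x))              ≈⟨ ∑-comm enum enum (λ x y → F y x) ⟩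
      ∑ enum (λ y → ∑ enum (λ x → F y x))              ∎
      where
      F : Normal n → Normal n → Scalar
      F y x = if does (A? y) ∧ does (A? x) then f (y ∙ x) else 0#

  -- Transfers the conditions to characters that appear in the list only through their duals.
  IntegralSquares-dual : ∀ f → IntegralSquares f → IntegralSquares (f ∘ _⁻¹)
  IntegralSquares-dual f = IntegralSquares-resp {f} {f ∘ _⁻¹} (sym (⟪⟫-dual S₁? S₁-⁻¹ f))
    (sym (⟪²⟫-dual S₁? S₁-⁻¹ f)) (sym (⟪²⟫-dual S₂? S₂-⁻¹ f))

  module _ {α α⁻¹ c} (params : QuadraticParameters α α⁻¹ c) where
    private
      e : Normal n → Matrix
      e = entry α α⁻¹ c
      M : Matrix
      M i j = ∑ enum λ z → s z * e z i j
      P Q X Y t q : Scalar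
      P = sumOver S₁? λ z → e z 0F 0F
      Q = sumOver S₁? λ z → e z 1F 1F
      X = sumOver S₂? λ z → e z 0F 1F
      Y = sumOver S₂? λ z → e z 1F 0F
      t = trace α α⁻¹ c ⟪ S₁? ⟫
      q = squares S₁? S₂? (trace α α⁻¹ c)

      off-diagonal : ∀ i j → i ≢ j → ∀ x → x ∈ S₁ → e x i j ≈ 0#
      off-diagonal i j i≢j x x∈S₁ with S₁⊆ x∈S₁
      off-diagonal 0F 0F i≢j x x∈S₁ | _ = contradiction ≡.refl i≢j
      off-diagonal 1F 1F i≢j x x∈S₁ | _ = contradiction ≡.refl i≢j
      off-diagonal 0F 1F _ x _ | inj₁ (_ , ≡.refl) = refl
      off-diagonal 0F 1F _ x _ | inj₂ (_ , ≡.refl) = refl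
      off-diagonal 1F 0F _ x _ | inj₁ (_ , ≡.refl) = refl
      off-diagonal 1F 0F _ x _ | inj₂ (_ , ≡.refl) = refl

      on-diagonal : ∀ i x → x ∈ S₂ → e x i i ≈ 0#
      on-diagonal i x x∈S₂ with S₂⊆ x∈S₂
      on-diagonal 0F x _ | inj₁ (_ , ≡.refl) = refl
      on-diagonal 0F x _ | inj₂ (_ , ≡.refl) = refl
      on-diagonal 1F x _ | inj₁ (_ , ≡.refl) = refl
      on-diagonal 1F x _ | inj₂ (_ , ≡.refl) = refl

      S₁-off : ∀ i j → i ≢ j → sumOver S₁? (λ z → e z i j) ≈ 0#
      S₁-off i j i≢j = sumOver-≈0 S₁? (λ z → e z i j) (off-diagonal i j i≢j)

      S₂-on : ∀ i → sumOver S₂? (λ z → e z i i) ≈ 0#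
      S₂-on i = sumOver-≈0 S₂? (λ z → e z i i) (on-diagonal i)

      M-diagonal : ∀ i → M i i ≈ sumOver S₁? (λ z → e z i i)
      M-diagonal i = trans (sumOver-∪ (λ z → e z i i)) (trans (+-congˡ (S₂-on i)) (+-identityʳ _))

      M-off-diagonal : ∀ i j → i ≢ j → M i j ≈ sumOver S₂? (λ z → e z i j)
      M-off-diagonal i j i≢j = trans (sumOver-∪ (λ z → e z i j)) (trans (+-congʳ (S₁-off i j i≢j)) (+-identityˡ _))

      M≋ : M ≋ matrix P X Y Q
      M≋ = entrywise (M-diagonal 0F) (M-off-diagonal 0F 1F λ ()) (M-off-diagonal 1F 0F λ ()) (M-diagonal 1F)

      t≈ : t ≈ P + Q
      t≈ = trans (⟪⟫≈sumOver S₁? (trace α α⁻¹ c)) (sumOver-+ S₁? (λ z → e z 0F 0F) (λ z → e z 1F 1F))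

      -- The right side is the trace of the square of `matrix P X Y Q`. The mixed products of the S₁
      -- and S₂ parts are anti-diagonal, so only S₁² and S₂² contribute to it.
      q≈ : q ≈ (P * P + Q * Q) + (X * Y + Y * X)
      q≈ = begin
        q ≈⟨ +-cong (⟪²⟫-trace S₁? e (entry-∙ params)) (⟪²⟫-trace S₂? e (entry-∙ params)) ⟩
        _ ≈⟨ +-cong (+-cong (+-congˡ (*-cong (S₁-off 0F 1F λ ()) (S₁-off 1F 0F λ ())))
                            (+-congʳ (*-cong (S₁-off 1F 0F λ ()) (S₁-off 0F 1F λ ()))))
                    (+-cong (+-congʳ (*-cong (S₂-on 0F) (S₂-on 0F))) (+-congˡ (*-cong (S₂-on 1F) (S₂-on 1F)))) ⟩
        ((P * P + 0# * 0#) + (0# * 0# + Q * Q)) + ((0# * 0# + X * Y) + (Y * X + 0# * 0#))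
          ≈⟨ solve 4 (λ p q x y → ((p :* p :+ con (+ 0) :* con (+ 0)) :+ (con (+ 0) :* con (+ 0) :+ q :* q))
                              :+ ((con (+ 0) :* con (+ 0) :+ x :* y) :+ (y :* x :+ con (+ 0) :* con (+ 0)))
                              := (p :* p :+ q :* q) :+ (x :* y :+ y :* x)) refl P Q X Y ⟩
        (P * P + Q * Q) + (X * Y + Y * X) ∎

      CharacteristicRoot : Scalar → Set ℓ₁
      CharacteristicRoot μ = (μ - P) * (μ - Q) - X * Y ≈ 0#

      row-eigenvalue : ∀ {μ} w₀ w₁ → w₀ * P + w₁ * Y ≈ μ * w₀ → w₀ * X + w₁ * Q ≈ μ * w₁ →
        w₀ # 0# ⊎ w₁ # 0# → IsEigenvalue μ
      row-eigenvalue {μ} w₀ w₁ eq₀ eq₁ = conclude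
        where
        f : Fin 2 → Normal n → Scalar
        f j x = w₀ * e x 0F j + w₁ * e x 1F j
        wM : ∀ j → ∑ enum (λ z → s z * f j z) ≈ w₀ * M 0F j + w₁ * M 1F j
        wM j = trans (∑-cong enum λ z → solve 5 (λ s w₀ w₁ a b →
                 s :* (w₀ :* a :+ w₁ :* b) := w₀ :* (s :* a) :+ w₁ :* (s :* b)) refl (s z) w₀ w₁ (e z 0F j) (e z 1F j))
          (trans (∑-+ enum (λ z → w₀ * (s z * e z 0F j)) (λ z → w₁ * (s z * e z 1F j)))
            (sym (+-cong (*-∑ enum w₀ (λ z → s z * e z 0F j)) (*-∑ enum w₁ (λ z → s z * e z 1F j)))))
        wM₀ : ∑ enum (λ z → s z * f 0F z) ≈ μ * w₀
        wM₀ = trans (wM 0F) (trans (+-cong (*-congˡ (M≋ 0F 0F)) (*-congˡ (M≋ 1F 0F))) eq₀)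
        wM₁ : ∑ enum (λ z → s z * f 1F z) ≈ μ * w₁
        wM₁ = trans (wM 1F) (trans (+-cong (*-congˡ (M≋ 0F 1F)) (*-congˡ (M≋ 1F 1F))) eq₁)
        f-eigen : ∀ j x → ∑ enum (λ z → s z * f j (z ∙ x)) ≈ μ * f j x
        f-eigen j x = begin
          ∑ enum (λ z → s z * f j (z ∙ x))
            ≈⟨ ∑-cong enum (λ z → trans
                 (*-congˡ {s z} (+-cong (*-congˡ (entry-∙ params z x 0F j)) (*-congˡ (entry-∙ params z x 1F j))))
                 (solve 9 (λ s w₀ w₁ z₀₀ z₀₁ z₁₀ z₁₁ x₀ x₁ →
                   s :* (w₀ :* (z₀₀ :* x₀ :+ z₀₁ :* x₁) :+ w₁ :* (z₁₀ :* x₀ :+ z₁₁ :* x₁))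
                   := (s :* (w₀ :* z₀₀ :+ w₁ :* z₁₀)) :* x₀ :+ (s :* (w₀ :* z₀₁ :+ w₁ :* z₁₁)) :* x₁)
                   refl (s z) w₀ w₁ (e z 0F 0F) (e z 0F 1F) (e z 1F 0F) (e z 1F 1F) (e x 0F j) (e x 1F j))) ⟩
          ∑ enum (λ z → (s z * f 0F z) * e x 0F j + (s z * f 1F z) * e x 1F j)
            ≈⟨ ∑-+ enum (λ z → (s z * f 0F z) * e x 0F j) (λ z → (s z * f 1F z) * e x 1F j) ⟩
          ∑ enum (λ z → (s z * f 0F z) * e x 0F j) + ∑ enum (λ z → (s z * f 1F z) * e x 1F j)
            ≈⟨ +-cong (∑-* enum (e x 0F j) (λ z → s z * f 0F z)) (∑-* enum (e x 1F j) (λ z → s z * f 1F z)) ⟨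
          ∑ enum (λ z → s z * f 0F z) * e x 0F j + ∑ enum (λ z → s z * f 1F z) * e x 1F j
            ≈⟨ +-cong (*-congʳ wM₀) (*-congʳ wM₁) ⟩
          μ * w₀ * e x 0F j + μ * w₁ * e x 1F j
            ≈⟨ solve 5 (λ μ w₀ w₁ x₀ x₁ → μ :* w₀ :* x₀ :+ μ :* w₁ :* x₁ := μ :* (w₀ :* x₀ :+ w₁ :* x₁))
                 refl μ w₀ w₁ (e x 0F j) (e x 1F j) ⟩
          μ * f j x ∎
        e-ε : e ε ≋ diagonal 1# 1#
        e-ε i j = trans (sym (ρ≋entry α α⁻¹ c ε i j)) (ρ-ε α α⁻¹ c params i j)
        f₀ε : f 0F ε ≈ w₀
        f₀ε = trans (+-cong (*-congˡ {w₀} (e-ε 0F 0F)) (*-congˡ {w₁} (e-ε 1F 0F)))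
          (solve 2 (λ x y → x :* con (+ 1) :+ y :* con (+ 0) := x) refl w₀ w₁)
        f₁ε : f 1F ε ≈ w₁
        f₁ε = trans (+-cong (*-congˡ {w₀} (e-ε 0F 1F)) (*-congˡ {w₁} (e-ε 1F 1F)))
          (solve 2 (λ x y → x :* con (+ 0) :+ y :* con (+ 1) := y) refl w₀ w₁)
        -- The representation is the identity at ε, so f j takes the value wⱼ there; a nonzero
        -- coordinate of w selects a nonzero eigenfunction.
        conclude : w₀ # 0# ⊎ w₁ # 0# → IsEigenvalue μ
        conclude (inj₁ w₀#0) = eigenfunction (f 0F) {ε} (#-congʳ (sym f₀ε) w₀#0) (f-eigen 0F)
        conclude (inj₂ w₁#0) = eigenfunction (f 1F) {ε} (#-congʳ (sym f₁ε) w₁#0) (f-eigen 1F)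

      -- The vectors (μ - Q, X) and (Y, μ - P) are the rows of the adjugate of μ - M, hence left
      -- null vectors of μ - M when its determinant vanishes. If both are zero then M is the scalar
      -- μ and (1, 0) serves.
      characteristicRoot⇒eigenvalue : ∀ μ → CharacteristicRoot μ → IsEigenvalue μ
      characteristicRoot⇒eigenvalue μ root = go (≈0⊎#0 Y) (≈0⊎#0 (μ - P)) (≈0⊎#0 (μ - Q)) (≈0⊎#0 X)
        where
        Y,μ-P : Y # 0# ⊎ (μ - P) # 0# → IsEigenvalue μ
        Y,μ-P = row-eigenvalue Y (μ - P)
          (solve 3 (λ y p μ → y :* p :+ (μ :- p) :* y := μ :* y) refl Y P μ)
          (x-y≈0⇒x≈y (begin
            Y * X + (μ - P) * Q - μ * (μ - P)
              ≈⟨ solve 5 (λ p q x y μ → y :* x :+ (μ :- p) :* q :- μ :* (μ :- p)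
                   := :- ((μ :- p) :* (μ :- q) :- x :* y)) refl P Q X Y μ ⟩
            - ((μ - P) * (μ - Q) - X * Y)  ≈⟨ -‿cong root ⟩
            - 0#                           ≈⟨ solve 0 (:- con (+ 0) := con (+ 0)) refl ⟩
            0#                             ∎))
        μ-Q,X : (μ - Q) # 0# ⊎ X # 0# → IsEigenvalue μ
        μ-Q,X = row-eigenvalue (μ - Q) X
          (x-y≈0⇒x≈y (begin
            (μ - Q) * P + X * Y - μ * (μ - Q)
              ≈⟨ solve 5 (λ p q x y μ → (μ :- q) :* p :+ x :* y :- μ :* (μ :- q)
                   := :- ((μ :- p) :* (μ :- q) :- x :* y)) refl P Q X Y μ ⟩
            - ((μ - P) * (μ - Q) - X * Y)  ≈⟨ -‿cong root ⟩
            - 0#                           ≈⟨ solve 0 (:- con (+ 0) := con (+ 0)) refl ⟩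
            0#                             ∎))
          (solve 3 (λ x q μ → (μ :- q) :* x :+ x :* q := μ :* x) refl X Q μ)
        go : Y ≈ 0# ⊎ Y # 0# → μ - P ≈ 0# ⊎ (μ - P) # 0# → μ - Q ≈ 0# ⊎ (μ - Q) # 0# → X ≈ 0# ⊎ X # 0# → IsEigenvalue μ
        go (inj₂ Y#0) _            _            _          = Y,μ-P (inj₁ Y#0)
        go (inj₁ _)   (inj₂ μ-P#0) _            _          = Y,μ-P (inj₂ μ-P#0)
        go (inj₁ _)   (inj₁ _)     (inj₂ μ-Q#0) _          = μ-Q,X (inj₁ μ-Q#0)
        go (inj₁ _)   (inj₁ _)     (inj₁ _)     (inj₂ X#0) = μ-Q,X (inj₂ X#0)
        go (inj₁ Y≈0) (inj₁ μ-P≈0) (inj₁ μ-Q≈0) (inj₁ X≈0) = row-eigenvalue 1# 0#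
          (trans (+-cong (trans (*-identityˡ P) (sym (x-y≈0⇒x≈y μ-P≈0))) (zeroˡ Y))
            (solve 1 (λ μ → μ :+ con (+ 0) := μ :* con (+ 1)) refl μ))
          (trans (+-cong (trans (*-identityˡ X) X≈0) (zeroˡ Q)) (solve 1 (λ μ → con (+ 0) :+ con (+ 0) := μ :* con (+ 0)) refl μ))
          (inj₁ 1#0)

    integral⇒IntegralSquares : Integral → IntegralSquares (trace α α⁻¹ c)
    integral⇒IntegralSquares integral = (t-integer , q-integer) , Δ-square
      where
      μ : Scalar
      μ = proj₁ (quadratic-root (P + Q) (P * Q - X * Y))
      μ-root : μ * μ - (P + Q) * μ + (P * Q - X * Y) ≈ 0#
      μ-root = proj₂ (quadratic-root (P + Q) (P * Q - X * Y))
      -- The other root, by Vieta; its characteristic equation expands to that of μ.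
      ν : Scalar
      ν = P + Q - μ
      μ-char : CharacteristicRoot μ
      μ-char = trans (solve 5 (λ p q x y μ → (μ :- p) :* (μ :- q) :- x :* y
        := μ :* μ :- (p :+ q) :* μ :+ (p :* q :- x :* y)) refl P Q X Y μ) μ-root
      ν-char : CharacteristicRoot ν
      ν-char = trans (solve 5 (λ p q x y μ → (p :+ q :- μ :- p) :* (p :+ q :- μ :- q) :- x :* y
        := μ :* μ :- (p :+ q) :* μ :+ (p :* q :- x :* y)) refl P Q X Y μ) μ-root
      μ-integer : IsInteger μ
      μ-integer = integral μ (characteristicRoot⇒eigenvalue μ μ-char)
      ν-integer : IsInteger ν
      ν-integer = integral ν (characteristicRoot⇒eigenvalue ν ν-char)
      t≈μ+ν : t ≈ μ + ν
      t≈μ+ν = trans t≈ (solve 3 (λ p q μ → p :+ q := μ :+ (p :+ q :- μ)) refl P Q μ)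
      q≈μ²+ν² : q ≈ μ * μ + ν * ν
      q≈μ²+ν² = trans q≈ (x-y≈0⇒x≈y (begin
        (P * P + Q * Q) + (X * Y + Y * X) - (μ * μ + ν * ν)
          ≈⟨ solve 5 (λ p q x y μ → let r = μ :* μ :- (p :+ q) :* μ :+ (p :* q :- x :* y) in
               (p :* p :+ q :* q) :+ (x :* y :+ y :* x) :- (μ :* μ :+ (p :+ q :- μ) :* (p :+ q :- μ))
               := :- (r :+ r)) refl P Q X Y μ ⟩
        - ((μ * μ - (P + Q) * μ + (P * Q - X * Y)) + (μ * μ - (P + Q) * μ + (P * Q - X * Y)))
          ≈⟨ -‿cong (+-cong μ-root μ-root) ⟩
        - (0# + 0#) ≈⟨ solve 0 (:- (con (+ 0) :+ con (+ 0)) := con (+ 0)) refl ⟩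
        0#    ∎))
      t-integer : IsInteger t
      t-integer = IsInteger-cong (sym t≈μ+ν) (IsInteger-+ μ-integer ν-integer)
      q-integer : IsInteger q
      q-integer = IsInteger-cong (sym q≈μ²+ν²)
        (IsInteger-+ (IsInteger-* μ-integer μ-integer) (IsInteger-* ν-integer ν-integer))
      Δ-square : IsPerfectSquare (Δ S₁? S₂? (trace α α⁻¹ c))
      Δ-square = IsPerfectSquare-cong (sym (begin
        2 · q - t ^ 2
          ≈⟨ +-cong (+-cong q≈μ²+ν² (+-congʳ q≈μ²+ν²)) (-‿cong (*-cong t≈μ+ν (*-congʳ t≈μ+ν))) ⟩
        2 · (μ * μ + ν * ν) - (μ + ν) ^ 2
          ≈⟨ solve 2 (λ μ ν → ((μ :* μ :+ ν :* ν) :+ ((μ :* μ :+ ν :* ν) :+ con (+ 0)))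
                 :- ((μ :+ ν) :* ((μ :+ ν) :* con (+ 1))) := (μ :- ν) :* (μ :- ν)) refl μ ν ⟩
        (μ - ν) * (μ - ν) ∎)) (IsPerfectSquare-difference μ-integer ν-integer)

    -- Pairing w with the first row of the representation gives a row vector V with μ V = V M. If V₀
    -- is nonzero, eliminating V₁ makes μ a root of the characteristic polynomial, and then (2μ -
    -- t)² = Δ.
    IntegralSquares⇒≈0⊎integer : IntegralSquares (trace α α⁻¹ c) → ∀ {μ} {w : Normal n → Scalar} →
      (∀ (f : Normal n → Scalar) → μ * ∑ enum (λ x → w x * f x) ≈ ∑ enum (λ y → w y * ∑ enum (λ z → s z * f (y ∙ z)))) →
      ∑ enum (λ x → w x * e x 0F 0F) ≈ 0# ⊎ IsInteger μ
    IntegralSquares⇒≈0⊎integer ((t-integer , q-integer) , Δ-square) {μ} {w} pairing = conclude (≈0⊎#0 (V 0F))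
      where
      V : Fin 2 → Scalar
      V j = ∑ enum λ x → w x * e x 0F j
      μV≈VM : ∀ j → μ * V j ≈ V 0F * M 0F j + V 1F * M 1F j
      μV≈VM j = begin
        μ * V j ≈⟨ pairing (λ x → e x 0F j) ⟩
        ∑ enum (λ y → w y * ∑ enum (λ z → s z * e (y ∙ z) 0F j))
          ≈⟨ ∑-cong enum (λ y → *-congˡ {w y} (row y)) ⟩
        ∑ enum (λ y → w y * (e y 0F 0F * M 0F j + e y 0F 1F * M 1F j))
          ≈⟨ ∑-cong enum (λ y → solve 5 (λ w a b m n → w :* (a :* m :+ b :* n) := (w :* a) :* m :+ (w :* b) :* n)
               refl (w y) (e y 0F 0F) (e y 0F 1F) (M 0F j) (M 1F j)) ⟩
        ∑ enum (λ y → (w y * e y 0F 0F) * M 0F j + (w y * e y 0F 1F) * M 1F j)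
          ≈⟨ ∑-+ enum (λ y → (w y * e y 0F 0F) * M 0F j) (λ y → (w y * e y 0F 1F) * M 1F j) ⟩
        ∑ enum (λ y → (w y * e y 0F 0F) * M 0F j) + ∑ enum (λ y → (w y * e y 0F 1F) * M 1F j)
          ≈⟨ +-cong (∑-* enum (M 0F j) (λ y → w y * e y 0F 0F)) (∑-* enum (M 1F j) (λ y → w y * e y 0F 1F)) ⟨
        V 0F * M 0F j + V 1F * M 1F j ∎
        where
        row : ∀ y → ∑ enum (λ z → s z * e (y ∙ z) 0F j) ≈ e y 0F 0F * M 0F j + e y 0F 1F * M 1F j
        row y = begin
          ∑ enum (λ z → s z * e (y ∙ z) 0F j)
            ≈⟨ ∑-cong enum (λ z → trans (*-congˡ {s z} (entry-∙ params y z 0F j))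
                 (solve 5 (λ s a b m n → s :* (a :* m :+ b :* n) := a :* (s :* m) :+ b :* (s :* n))
                   refl (s z) (e y 0F 0F) (e y 0F 1F) (e z 0F j) (e z 1F j))) ⟩
          ∑ enum (λ z → e y 0F 0F * (s z * e z 0F j) + e y 0F 1F * (s z * e z 1F j))
            ≈⟨ ∑-+ enum (λ z → e y 0F 0F * (s z * e z 0F j)) (λ z → e y 0F 1F * (s z * e z 1F j)) ⟩
          ∑ enum (λ z → e y 0F 0F * (s z * e z 0F j)) + ∑ enum (λ z → e y 0F 1F * (s z * e z 1F j))
            ≈⟨ +-cong (*-∑ enum (e y 0F 0F) (λ z → s z * e z 0F j)) (*-∑ enum (e y 0F 1F) (λ z → s z * e z 1F j)) ⟨
          e y 0F 0F * M 0F j + e y 0F 1F * M 1F j ∎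
      V₀ V₁ : Scalar
      V₀ = V 0F
      V₁ = V 1F
      eq₀ : μ * V₀ - (V₀ * P + V₁ * Y) ≈ 0#
      eq₀ = x≈y⇒x-y≈0 (trans (μV≈VM 0F) (+-cong (*-congˡ (M≋ 0F 0F)) (*-congˡ (M≋ 1F 0F))))
      eq₁ : μ * V₁ - (V₀ * X + V₁ * Q) ≈ 0#
      eq₁ = x≈y⇒x-y≈0 (trans (μV≈VM 1F) (+-cong (*-congˡ (M≋ 0F 1F)) (*-congˡ (M≋ 1F 1F))))
      V₀-root : V₀ * ((μ - P) * (μ - Q) - X * Y) ≈ 0#
      V₀-root = begin
        -- The coefficients (μ - Q, Y) form the first column of the adjugate of μ - M; multiplying V
        -- (μ - M) = 0 by it removes V₁.
        V₀ * ((μ - P) * (μ - Q) - X * Y)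
          ≈⟨ solve 7 (λ v₀ v₁ μ p q x y → v₀ :* ((μ :- p) :* (μ :- q) :- x :* y)
               := (μ :- q) :* (μ :* v₀ :- (v₀ :* p :+ v₁ :* y)) :+ y :* (μ :* v₁ :- (v₀ :* x :+ v₁ :* q)))
               refl V₀ V₁ μ P Q X Y ⟩
        (μ - Q) * (μ * V₀ - (V₀ * P + V₁ * Y)) + Y * (μ * V₁ - (V₀ * X + V₁ * Q))
          ≈⟨ +-cong (*-congˡ eq₀) (*-congˡ eq₁) ⟩
        (μ - Q) * 0# + Y * 0#
          ≈⟨ solve 2 (λ a b → a :* con (+ 0) :+ b :* con (+ 0) := con (+ 0)) refl (μ - Q) Y ⟩
        0# ∎
      conclude : V₀ ≈ 0# ⊎ V₀ # 0# → V₀ ≈ 0# ⊎ IsInteger μ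
      conclude (inj₁ V₀≈0) = inj₁ V₀≈0
      conclude (inj₂ V₀#0) = inj₂ (IsInteger-quadratic t-integer q-integer Δ-square (begin
        (μ + μ - t) * (μ + μ - t)            ≈⟨ *-cong (+-congˡ (-‿cong t≈)) (+-congˡ (-‿cong t≈)) ⟩
        (μ + μ - (P + Q)) * (μ + μ - (P + Q)) ≈⟨ x-y≈0⇒x≈y (begin
          -- D = 2 tr M² - (tr M)² equals (tr M)² - 4 det M, the discriminant. The difference is
          -- therefore four times the characteristic polynomial at μ.
          (μ + μ - (P + Q)) * (μ + μ - (P + Q)) - D
            ≈⟨ solve 5 (λ μ p q x y → let g = (p :* p :+ q :* q) :+ (x :* y :+ y :* x)
                                          h = p :+ q
                                          r = (μ :- p) :* (μ :- q) :- x :* y in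
                 (μ :+ μ :- h) :* (μ :+ μ :- h) :- ((g :+ (g :+ con (+ 0))) :- h :* (h :* con (+ 1)))
                 := con (+ 4) :* r) refl μ P Q X Y ⟩
          _ * ((μ - P) * (μ - Q) - X * Y)   ≈⟨ *-congˡ (#0-cancelˡ V₀#0 V₀-root) ⟩
          _ * 0#                            ≈⟨ zeroʳ _ ⟩
          0#                                ∎) ⟩
        D ≈⟨ +-cong (+-cong q≈ (+-congʳ q≈)) (-‿cong (*-cong t≈ (*-congʳ t≈))) ⟨
        2 · q - t ^ 2 ∎))
        where
        D : Scalar
        D = 2 · ((P * P + Q * Q) + (X * Y + Y * X)) - (P + Q) ^ 2

-- Each case carries the value of `isEven` as well, since the character tables branch on that
-- Boolean.
data Parity (m : ℕ) : Set where
  even : ∀ q → m ≡ 2 ℕ.* q → isEven m ≡ true → Parity m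
  odd  : ∀ q → m ≡ suc (2 ℕ.* q) → isEven m ≡ false → Parity m

parity : ∀ m → Parity m
parity m = go (m ℕ.% 2) ≡.refl (ℕ.m%n<n m 2) (2 ∣? m) ≡.refl
  where
  m≡ : m ≡ m ℕ.% 2 ℕ.+ 2 ℕ.* (m ℕ./ 2)
  m≡ = ≡.trans (ℕ.m≡m%n+[m/n]*n m 2) (≡.cong (m ℕ.% 2 ℕ.+_) (ℕ.*-comm (m ℕ./ 2) 2))
  go : ∀ r → m ℕ.% 2 ≡ r → r ℕ.< 2 → ∀ d → d ≡ (2 ∣? m) → Parity m
  go _ _   _ (yes (divides q eq)) d≡ = even q (≡.trans eq (ℕ.*-comm q 2)) (≡.cong Dec.does (≡.sym d≡))
  go 0 r≡0 _ (no 2∤m)             d≡ = contradiction (m%n≡0⇒n∣m m 2 r≡0) 2∤m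
  go 1 r≡1 _ (no 2∤m)             d≡ = odd (m ℕ./ 2)
    (≡.trans m≡ (≡.cong (ℕ._+ 2 ℕ.* (m ℕ./ 2)) r≡1)) (≡.cong Dec.does (≡.sym d≡))
  go (suc (suc _)) _ (ℕ.s≤s (ℕ.s≤s ())) _ _

-- Equalities between traces with different parameters.

module TraceProperties {c ℓ₁ ℓ₂} (K : AlgClosedField₀ c ℓ₁ ℓ₂) (n : ℕ) .{{_ : NonZero n}} where
  open AlgClosedField₀ K renaming (Carrier to Scalar)
  open CommutativeRing commutativeRing using (commutativeSemiring)
  open FieldProperties K
  open MatrixRepresentations K n
  open QuadraticCharacters K n
  open SemiringExp semiring using (^-congˡ; ^-homo-*)
  open ExpProperties commutativeSemiring using (^-distrib-*)
  open FiniteGroup (T n) using (_∙_; ε; _⁻¹; inverseˡ)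
  open SetoidReasoning setoid
  open Solver

  trace-cong : ∀ {α α′ β β′ c d} → α ≈ β → α′ ≈ β′ → c ≈ d → ∀ x → trace α α′ c x ≈ trace β β′ d x
  trace-cong p q r (a^ m b^ 0F) = +-cong (^-congˡ (toℕ m) p) (^-congˡ (toℕ m) q)
  trace-cong p q r (a^ m b^ 1F) = refl
  trace-cong p q r (a^ m b^ 2F) = +-cong (*-cong (^-congˡ (toℕ m) p) r) (*-cong (^-congˡ (toℕ m) q) r)
  trace-cong p q r (a^ m b^ 3F) = refl

  -- Exchanging α and α⁻¹ exchanges the diagonal entries. This identifies the traces for k and 2n -
  -- k.
  trace-swap : ∀ α α′ c x → trace α α′ c x ≈ trace α′ α c x
  trace-swap α α′ c (a^ m b^ 0F) = +-comm _ _
  trace-swap α α′ c (a^ m b^ 1F) = refl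
  trace-swap α α′ c (a^ m b^ 2F) = +-comm _ _
  trace-swap α α′ c (a^ m b^ 3F) = refl

  inverse-unique : ∀ {x y z} → y * x ≈ 1# → z * x ≈ 1# → y ≈ z
  inverse-unique {x} {y} {z} yx≈1 zx≈1 = begin
    y            ≈⟨ *-identityʳ y ⟨
    y * 1#       ≈⟨ *-congˡ zx≈1 ⟨
    y * (z * x)  ≈⟨ solve 3 (λ x y z → y :* (z :* x) := (y :* x) :* z) refl x y z ⟩
    (y * x) * z  ≈⟨ *-congʳ yx≈1 ⟩
    1# * z       ≈⟨ *-identityˡ z ⟩
    z            ∎

  -- Where e(x) is diagonal, the entries of e(x⁻¹) are the inverses of its entries, so α and c are
  -- both inverted; commutativity of the sum then swaps α and α⁻¹ back.
  trace-dual : ∀ {α α⁻¹ c c⁻¹} → QuadraticParameters α α⁻¹ c → c * c⁻¹ ≈ 1# →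
    ∀ x → trace α α⁻¹ c (x ⁻¹) ≈ trace α α⁻¹ c⁻¹ x
  trace-dual {α} {α⁻¹} {c} {c⁻¹} params cc⁻¹≈1 = go
    where
    open QuadraticParameters params
    e : Normal n → Matrix
    e = entry α α⁻¹ c
    e-inverse : ∀ x → (e (x ⁻¹) ⊗ e x) ≋ diagonal 1# 1#
    e-inverse x i j = begin
      (e (x ⁻¹) ⊗ e x) i j   ≈⟨ entry-∙ params (x ⁻¹) x i j ⟨
      e (x ⁻¹ ∙ x) i j       ≡⟨ ≡.cong (λ y → e y i j) (inverseˡ x) ⟩
      e ε i j                ≈⟨ ρ≋entry α α⁻¹ c ε i j ⟨
      ρ α α⁻¹ c ε i j        ≈⟨ ρ-ε α α⁻¹ c params i j ⟩
      diagonal 1# 1# i j     ∎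
    x+00 : ∀ x → x + 0# * 0# ≈ x
    x+00 = solve 1 (λ x → x :+ con (+ 0) :* con (+ 0) := x) refl
    00+x : ∀ x → 0# * 0# + x ≈ x
    00+x = solve 1 (λ x → con (+ 0) :* con (+ 0) :+ x := x) refl
    αα⁻¹ : ∀ m → α⁻¹ ^ m * α ^ m ≈ 1#
    αα⁻¹ m = trans (*-comm _ _) (αᵐα⁻¹ᵐ≈1 m)
    scaled : ∀ {x y} → x * y ≈ 1# → (x * c⁻¹) * (y * c) ≈ 1#
    scaled {x} {y} xy≈1 = begin
      (x * c⁻¹) * (y * c)    ≈⟨ solve 4 (λ x y c d → (x :* d) :* (y :* c) := (x :* y) :* (c :* d)) refl x y c c⁻¹ ⟩
      (x * y) * (c * c⁻¹)    ≈⟨ *-cong xy≈1 cc⁻¹≈1 ⟩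
      1# * 1#                ≈⟨ *-identityˡ 1# ⟩
      1#                     ∎
    go : ∀ x → trace α α⁻¹ c (x ⁻¹) ≈ trace α α⁻¹ c⁻¹ x
    go x@(a^ r b^ 0F) = trans (+-cong
      (inverse-unique (trans (sym (x+00 _)) (e-inverse x 0F 0F)) (αα⁻¹ (toℕ r)))
      (inverse-unique (trans (sym (00+x _)) (e-inverse x 1F 1F)) (αᵐα⁻¹ᵐ≈1 (toℕ r)))) (+-comm _ _)
    go (a^ r b^ 1F) = refl
    go x@(a^ r b^ 2F) = trans (+-cong
      (inverse-unique (trans (sym (x+00 _)) (e-inverse x 0F 0F)) (scaled (αα⁻¹ (toℕ r))))
      (inverse-unique (trans (sym (00+x _)) (e-inverse x 1F 1F)) (scaled (αᵐα⁻¹ᵐ≈1 (toℕ r))))) (+-comm _ _)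
    go (a^ r b^ 3F) = refl

  character-cong : ∀ {β γ d f} → β ≈ γ → d ≈ f → ∀ x → character β d x ≈ character γ f x
  character-cong p q (a^ r b^ s) = *-cong (^-congˡ (toℕ r) p) (^-congˡ (toℕ s) q)

  power-complement : ∀ {x y} N j k → x * y ≈ 1# → x ^ N ≈ 1# → j ℕ.+ k ≡ N → x ^ j ≈ y ^ k
  power-complement {x} {y} _ j k xy≈1 xᴺ≈1 ≡.refl = begin
    x ^ j                        ≈⟨ *-identityʳ _ ⟨
    x ^ j * 1#                   ≈⟨ *-congˡ (trans (sym (^-distrib-* x y k)) (trans (^-congˡ k xy≈1) (Linear.power-1M k))) ⟨
    x ^ j * (x ^ k * y ^ k)      ≈⟨ *-assoc _ _ _ ⟨
    x ^ j * x ^ k * y ^ k        ≈⟨ *-congʳ (^-homo-* x j k) ⟨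
    x ^ (j ℕ.+ k) * y ^ k        ≈⟨ *-congʳ xᴺ≈1 ⟩
    1# * y ^ k                   ≈⟨ *-identityˡ _ ⟩
    y ^ k                        ∎

-- Powers of ζ, and what the character table has to provide.

module RootsOfUnity {c ℓ₁ ℓ₂} (K : AlgClosedField₀ c ℓ₁ ℓ₂) (n : ℕ) .{{_ : NonZero n}} (prim : PrimitiveRoot K (8 ℕ.* n)) where
  open AlgClosedField₀ K renaming (Carrier to Scalar)
  open CommutativeRing commutativeRing using (commutativeSemiring)
  open FieldProperties K
  open MatrixRepresentations K n
  open QuadraticCharacters K n
  open SemiringExp semiring using (^-congˡ; ^-congʳ; ^-homo-*; ^-assocʳ)
  open ExpProperties commutativeSemiring using (^-distrib-*)
  open FiniteGroup (T n) using (_⁻¹)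
  open PrimitiveRoot prim
  open Characters K n prim
  open SetoidReasoning setoid
  open Solver

  1^ : ∀ m → 1# ^ m ≈ 1#
  1^ = Linear.power-1M

  ^-comm : ∀ x j k → (x ^ j) ^ k ≈ (x ^ k) ^ j
  ^-comm x j k = trans (^-assocʳ x j k) (trans (^-congʳ x (ℕ.*-comm j k)) (sym (^-assocʳ x k j)))

  x^2≈xx : ∀ x → x ^ 2 ≈ x * x
  x^2≈xx x = *-congˡ (*-identityʳ x)

  ^-*-≈1 : ∀ {x y} m → x * y ≈ 1# → x ^ m * y ^ m ≈ 1#
  ^-*-≈1 {x} {y} m xy≈1 = trans (sym (^-distrib-* x y m)) (trans (^-congˡ m xy≈1) (1^ m))

  -1*-1≈1 : - 1# * - 1# ≈ 1#
  -1*-1≈1 = solve 0 ((:- con (+ 1)) :* (:- con (+ 1)) := con (+ 1)) refl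

  x²≈1⇒x≈±1 : ∀ {x} → x * x ≈ 1# → x ≈ 1# ⊎ x ≈ - 1#
  x²≈1⇒x≈±1 eq = x²≈y²⇒x≈±y (trans eq (sym (*-identityˡ 1#)))

  -- Its square is 1, and primitivity of ζ excludes the value 1.
  ζ^4n≈-1 : ζ ^ (4 ℕ.* n) ≈ - 1#
  ζ^4n≈-1 = conclude (x²≈1⇒x≈±1 squared)
    where
    squared : ζ ^ (4 ℕ.* n) * ζ ^ (4 ℕ.* n) ≈ 1#
    squared = trans (sym (^-homo-* ζ (4 ℕ.* n) (4 ℕ.* n)))
      (trans (^-congʳ ζ (≡.sym (ℕ.*-distribʳ-+ n 4 4))) ζ^N≈1)
    conclude : ζ ^ (4 ℕ.* n) ≈ 1# ⊎ ζ ^ (4 ℕ.* n) ≈ - 1# → ζ ^ (4 ℕ.* n) ≈ - 1#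
    conclude (inj₂ eq) = eq
    conclude (inj₁ eq) = contradiction eq (#⇒≉ (minimal
      (ℕ.>-nonZero⁻¹ (4 ℕ.* n) {{ℕ.m*n≢0 4 n}}) (ℕ.*-monoˡ-< n {4} {8} (ℕ.s≤s (ℕ.s≤s (ℕ.s≤s (ℕ.s≤s (ℕ.s≤s ℕ.z≤n))))))))

  ξ^n≈-1 : ξ ^ n ≈ - 1#
  ξ^n≈-1 = trans (^-assocʳ ζ 4 n) ζ^4n≈-1

  ω^4≈-1 : ω ^ 4 ≈ - 1#
  ω^4≈-1 = trans (^-comm ζ n 4) ξ^n≈-1

  i*i≈-1 : i * i ≈ - 1#
  i*i≈-1 = trans (sym (^-homo-* ω 2 2)) ω^4≈-1

  ξξ⁻¹≈1 : ξ * ξ⁻¹ ≈ 1#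
  ξξ⁻¹≈1 = ^-*-≈1 4 inverse

  εε⁻¹≈1 : ε * ε⁻¹ ≈ 1#
  εε⁻¹≈1 = ^-*-≈1 8 inverse

  ξ^2n≈1 : ξ ^ (2 ℕ.* n) ≈ 1#
  ξ^2n≈1 = begin
    ξ ^ (2 ℕ.* n)    ≈⟨ ^-assocʳ ξ 2 n ⟨
    (ξ ^ 2) ^ n      ≈⟨ ^-comm ξ 2 n ⟩
    (ξ ^ n) ^ 2      ≈⟨ x^2≈xx _ ⟩
    ξ ^ n * ξ ^ n    ≈⟨ *-cong ξ^n≈-1 ξ^n≈-1 ⟩
    - 1# * - 1#      ≈⟨ -1*-1≈1 ⟩
    1#               ∎

  ε≈ξ² : ε ≈ ξ ^ 2
  ε≈ξ² = sym (^-assocʳ ζ 4 2)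

  ε⁻¹≈ξ⁻¹² : ε⁻¹ ≈ ξ⁻¹ ^ 2
  ε⁻¹≈ξ⁻¹² = sym (^-assocʳ ζ⁻¹ 4 2)

  ε^n≈1 : ε ^ n ≈ 1#
  ε^n≈1 = trans (^-congˡ n ε≈ξ²) (trans (^-assocʳ ξ 2 n) ξ^2n≈1)

  inverse-power : ∀ {x y} m → x * y ≈ 1# → x ^ m ≈ 1# → y ^ m ≈ 1#
  inverse-power m xy≈1 xᵐ≈1 = trans (sym (*-identityˡ _)) (trans (*-congʳ (sym xᵐ≈1)) (^-*-≈1 m xy≈1))

  [-1]^even : ∀ q → [-1]^ (2 ℕ.* q) ≈ 1#
  [-1]^even q = trans (sym (^-assocʳ (- 1#) 2 q)) (trans (^-congˡ q (trans (x^2≈xx _) -1*-1≈1)) (1^ q))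

  [-1]^odd : ∀ q → [-1]^ (suc (2 ℕ.* q)) ≈ - 1#
  [-1]^odd q = trans (*-congˡ ([-1]^even q)) (*-identityʳ _)

  [-1]^² : ∀ m → [-1]^ m * [-1]^ m ≈ 1#
  [-1]^² m = ^-*-≈1 m -1*-1≈1

  -- The square root of (-1)ᵏ used by the table for even n: φ k belongs to c = κ k and ψ k to c = -
  -- κ k.
  κ : ℕ → Scalar
  κ k = if isEven k then 1# else i

  κ² : ∀ k → κ k * κ k ≈ [-1]^ k
  κ² k with parity k
  ... | even q ≡.refl eq rewrite eq = trans (*-identityˡ 1#) (sym ([-1]^even q))
  ... | odd q ≡.refl eq  rewrite eq = trans i*i≈-1 (sym ([-1]^odd q))

  [ξ^k]^n : ∀ k → (ξ ^ k) ^ n ≈ [-1]^ k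
  [ξ^k]^n k = trans (^-comm ξ k n) (^-congˡ k ξ^n≈-1)

  -- As ξⁿ = -1, the condition c² = αⁿ for α = ξᵏ reads c² = (-1)ᵏ.
  ξ-parameters : ∀ k {c} → c * c ≈ [-1]^ k → QuadraticParameters (ξ ^ k) (ξ⁻¹ ^ k) c
  ξ-parameters k c²≈ = record
    { αα⁻¹≈1 = ^-*-≈1 k ξξ⁻¹≈1
    ; α²ⁿ≈1  = trans (^-comm ξ k (2 ℕ.* n)) (trans (^-congˡ k ξ^2n≈1) (1^ k))
    ; c²≈αⁿ  = trans c²≈ (sym ([ξ^k]^n k))
    }


  -- The interface between the table and the spectrum: listed functions come from representations,
  -- and conversely the linear characters and the pairs (ξᵏ, c) with 0 < k < n are listed up to
  -- duals. The parity of n is confined to establishing it.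
  record Classification (χ : Fin 8 → Normal n → Scalar) (φ ψ : ℕ → Normal n → Scalar) : Set (c ⊔ ℓ₁) where
    field
      χ-linear    : ∀ j → ∃₂ λ β d → LinearParameters β d × (∀ x → χ j x ≈ character β d x)
      φ-quadratic : ∀ k → ∃ λ α → ∃ λ α⁻¹ → ∃ λ c → QuadraticParameters α α⁻¹ c × (∀ x → φ k x ≈ trace α α⁻¹ c x)
      ψ-quadratic : ∀ h → ∃ λ α → ∃ λ α⁻¹ → ∃ λ c → QuadraticParameters α α⁻¹ c × (∀ x → ψ h x ≈ trace α α⁻¹ c x)
      linear-χ    : ∀ {β d} → LinearParameters β d → ∃ λ j → ∀ x → χ j x ≈ character β d x
      -- The dual is needed for odd n only: there ψ (n - h) = ψ h, and the duals of these characters are not listed.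
      quadratic-φψ : ∀ k {c} → 1 ℕ.≤ k → k ℕ.< n → c * c ≈ [-1]^ k → ∃ λ h → (1 ℕ.≤ h × h ℕ.< n) ×
        ((∀ x → φ h x ≈ trace (ξ ^ k) (ξ⁻¹ ^ k) c x) ⊎
         (∀ x → ψ h x ≈ trace (ξ ^ k) (ξ⁻¹ ^ k) c x) ⊎
         (∀ x → ψ h (x ⁻¹) ≈ trace (ξ ^ k) (ξ⁻¹ ^ k) c x))

  -- Since -1 = ω⁴, the negative of a power of ω is again a power of ω.
  sqrt-ω : ∀ j {x} → x * x ≈ ω ^ (j ℕ.+ j) → x ≈ ω ^ j ⊎ x ≈ ω ^ (4 ℕ.+ j)
  sqrt-ω j {x} eq = conclude (x²≈y²⇒x≈±y (trans eq (^-homo-* ω j j)))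
    where
    conclude : x ≈ ω ^ j ⊎ x ≈ - (ω ^ j) → x ≈ ω ^ j ⊎ x ≈ ω ^ (4 ℕ.+ j)
    conclude (inj₁ eq) = inj₁ eq
    conclude (inj₂ eq) = inj₂ (begin
      x                  ≈⟨ eq ⟩
      - (ω ^ j)          ≈⟨ solve 1 (λ x → :- x := (:- con (+ 1)) :* x) refl (ω ^ j) ⟩
      - 1# * ω ^ j       ≈⟨ *-congʳ ω^4≈-1 ⟨
      ω ^ 4 * ω ^ j      ≈⟨ ^-homo-* ω 4 j ⟨
      ω ^ (4 ℕ.+ j)      ∎)

  -- Two square roots in succession: x² is ω²ʲ or ω⁴⁺²ʲ, and these yield the exponents j, j + 4 and
  -- j + 2, j + 6.
  fourth-root-ω : ∀ j {x} → x ^ 4 ≈ ω ^ ((j ℕ.+ j) ℕ.+ (j ℕ.+ j)) →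
    (x ≈ ω ^ j ⊎ x ≈ ω ^ (4 ℕ.+ j)) ⊎ (x ≈ ω ^ (2 ℕ.+ j) ⊎ x ≈ ω ^ (6 ℕ.+ j))
  fourth-root-ω j {x} eq = conclude (sqrt-ω (j ℕ.+ j) (trans
    (solve 1 (λ x → (x :* x) :* (x :* x) := x :* (x :* (x :* (x :* con (+ 1))))) refl x) eq))
    where
    4+2j : ∀ j → 4 ℕ.+ (j ℕ.+ j) ≡ (2 ℕ.+ j) ℕ.+ (2 ℕ.+ j)
    4+2j = ℕ-solve-∀
    conclude : x * x ≈ ω ^ (j ℕ.+ j) ⊎ x * x ≈ ω ^ (4 ℕ.+ (j ℕ.+ j)) →
      (x ≈ ω ^ j ⊎ x ≈ ω ^ (4 ℕ.+ j)) ⊎ (x ≈ ω ^ (2 ℕ.+ j) ⊎ x ≈ ω ^ (6 ℕ.+ j))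
    conclude (inj₁ eq) = inj₁ (sqrt-ω j eq)
    conclude (inj₂ eq) = inj₂ (sqrt-ω (2 ℕ.+ j) (trans eq (^-congʳ ω (4+2j j))))

-- The character table for even n.

module EvenClassification {c ℓ₁ ℓ₂} (K : AlgClosedField₀ c ℓ₁ ℓ₂) (n : ℕ) .{{_ : NonZero n}} (prim : PrimitiveRoot K (8 ℕ.* n)) where
  open AlgClosedField₀ K renaming (Carrier to Scalar)
  open FieldProperties K
  open MatrixRepresentations K n
  open QuadraticCharacters K n
  open TraceProperties K n
  open RootsOfUnity K n prim
  open SemiringExp semiring using (^-congˡ; ^-congʳ; ^-assocʳ)
  open Characters K n prim
  open SetoidReasoning setoid
  open Solver

  [ω^j]^4 : ∀ j → (ω ^ j) ^ 4 ≈ [-1]^ j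
  [ω^j]^4 j = trans (^-comm ω j 4) (^-congˡ j ω^4≈-1)

  χ-even : ∀ j → isEven (toℕ j) ≡ true → ∀ x → Even.χ j x ≈ character 1# (ω ^ toℕ j) x
  χ-even j eq (a^ r b^ s) rewrite eq = begin
    ω ^ (toℕ s ℕ.* toℕ j)                    ≡⟨ ≡.cong (ω ^_) (ℕ.*-comm (toℕ s) (toℕ j)) ⟩
    ω ^ (toℕ j ℕ.* toℕ s)                    ≈⟨ ^-assocʳ ω (toℕ j) (toℕ s) ⟨
    (ω ^ toℕ j) ^ toℕ s                      ≈⟨ *-identityˡ _ ⟨
    1# * (ω ^ toℕ j) ^ toℕ s                 ≈⟨ *-congʳ (1^ (toℕ r)) ⟨
    1# ^ toℕ r * (ω ^ toℕ j) ^ toℕ s         ∎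

  χ-odd : ∀ j → isEven (toℕ j) ≡ false → ∀ x → Even.χ j x ≈ character (- 1#) (ω ^ (toℕ j ℕ.∸ 1)) x
  χ-odd j eq (a^ r b^ s) rewrite eq = *-congˡ (begin
    ω ^ (toℕ s ℕ.* (toℕ j ℕ.∸ 1))            ≡⟨ ≡.cong (ω ^_) (ℕ.*-comm (toℕ s) (toℕ j ℕ.∸ 1)) ⟩
    ω ^ ((toℕ j ℕ.∸ 1) ℕ.* toℕ s)            ≈⟨ ^-assocʳ ω (toℕ j ℕ.∸ 1) (toℕ s) ⟨
    (ω ^ (toℕ j ℕ.∸ 1)) ^ toℕ s              ∎)

  ξ±* : ∀ k r c → ξ± (k ℕ.* r) * c ≈ (ξ ^ k) ^ r * c + (ξ⁻¹ ^ k) ^ r * c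
  ξ±* k r c = trans (*-congʳ (+-cong (sym (^-assocʳ ξ k r)) (sym (^-assocʳ ξ⁻¹ k r)))) (distribʳ c _ _)

  ξ±≈ : ∀ k r → ξ± (k ℕ.* r) ≈ (ξ ^ k) ^ r + (ξ⁻¹ ^ k) ^ r
  ξ±≈ k r = +-cong (sym (^-assocʳ ξ k r)) (sym (^-assocʳ ξ⁻¹ k r))

  φ-trace : ∀ k x → Even.φ k x ≈ trace (ξ ^ k) (ξ⁻¹ ^ k) (κ k) x
  φ-trace k (a^ r b^ 0F) = ξ±≈ k (toℕ r)
  φ-trace k (a^ r b^ 1F) = sym (+-identityˡ 0#)
  φ-trace k (a^ r b^ 2F) = trans (scale (isEven k)) (ξ±* k (toℕ r) (κ k))
    where
    scale : ∀ b → (if b then ξ± (k ℕ.* toℕ r) else i * ξ± (k ℕ.* toℕ r)) ≈ ξ± (k ℕ.* toℕ r) * (if b then 1# else i)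
    scale true  = sym (*-identityʳ _)
    scale false = *-comm _ _
  φ-trace k (a^ r b^ 3F) = sym (+-identityˡ 0#)

  ψ-trace : ∀ h x → Even.ψ h x ≈ trace (ξ ^ h) (ξ⁻¹ ^ h) (- κ h) x
  ψ-trace h (a^ r b^ 0F) = ξ±≈ h (toℕ r)
  ψ-trace h (a^ r b^ 1F) = sym (+-identityˡ 0#)
  ψ-trace h (a^ r b^ 2F) = trans (scale (isEven h)) (ξ±* h (toℕ r) (- κ h))
    where
    scale : ∀ b → (if b then - ξ± (h ℕ.* toℕ r) else - (i * ξ± (h ℕ.* toℕ r))) ≈ ξ± (h ℕ.* toℕ r) * (- (if b then 1# else i))
    scale true  = solve 1 (λ x → :- x := x :* (:- con (+ 1))) refl (ξ± (h ℕ.* toℕ r))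
    scale false = solve 2 (λ i x → :- (i :* x) := x :* (:- i)) refl i (ξ± (h ℕ.* toℕ r))
  ψ-trace h (a^ r b^ 3F) = sym (+-identityˡ 0#)

  -κ² : ∀ k → - κ k * - κ k ≈ [-1]^ k
  -κ² k = trans (solve 1 (λ x → (:- x) :* (:- x) := x :* x) refl (κ k)) (κ² k)

  module _ (q : ℕ) (n≡2q : n ≡ 2 ℕ.* q) where
    [-1]^n≈1 : [-1]^ n ≈ 1#
    [-1]^n≈1 = trans (^-congʳ (- 1#) n≡2q) ([-1]^even q)

    χ-linear : ∀ j → ∃₂ λ β d → LinearParameters β d × (∀ x → Even.χ j x ≈ character β d x)
    χ-linear j = go (parity (toℕ j))
      where
      go : Parity (toℕ j) → ∃₂ λ β d → LinearParameters β d × (∀ x → Even.χ j x ≈ character β d x)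
      go (even p j≡2p isEven-j) = 1# , ω ^ toℕ j , record
        { β²≈1  = *-identityˡ 1#
        ; d⁴≈βⁿ = trans ([ω^j]^4 (toℕ j)) (trans (^-congʳ (- 1#) j≡2p) (trans ([-1]^even p) (sym (1^ n))))
        } , χ-even j isEven-j
      go (odd p j≡1+2p isEven-j) = - 1# , ω ^ (toℕ j ℕ.∸ 1) , record
        { β²≈1  = -1*-1≈1
        ; d⁴≈βⁿ = trans ([ω^j]^4 (toℕ j ℕ.∸ 1)) (trans (^-congʳ (- 1#) (≡.cong (ℕ._∸ 1) j≡1+2p))
            (trans ([-1]^even p) (sym [-1]^n≈1)))
        } , χ-odd j isEven-j

    -- Here βⁿ = 1 for both signs of β, so d is an even power of ω. The four choices are indexed by
    -- the even j if β = 1 and by the odd j, shifted by one, if β = -1.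
    linear-χ : ∀ {β d} → LinearParameters β d → ∃ λ j → ∀ x → Even.χ j x ≈ character β d x
    linear-χ {β} {d} params = go (x²≈1⇒x≈±1 β²≈1)
      where
      open LinearParameters params
      roots : β ^ n ≈ 1# → (d ≈ ω ^ 0 ⊎ d ≈ ω ^ 4) ⊎ (d ≈ ω ^ 2 ⊎ d ≈ ω ^ 6)
      roots βⁿ≈1 = fourth-root-ω 0 (trans d⁴≈βⁿ βⁿ≈1)
      go : β ≈ 1# ⊎ β ≈ - 1# → ∃ λ j → ∀ x → Even.χ j x ≈ character β d x
      go (inj₁ β≈1) = choose (roots (trans (^-congˡ n β≈1) (1^ n)))
        where
        with-index : ∀ j → isEven (toℕ j) ≡ true → d ≈ ω ^ toℕ j → ∃ λ j → ∀ x → Even.χ j x ≈ character β d x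
        with-index j eq d≈ = j , λ x → trans (χ-even j eq x) (character-cong (sym β≈1) (sym d≈) x)
        choose : (d ≈ ω ^ 0 ⊎ d ≈ ω ^ 4) ⊎ (d ≈ ω ^ 2 ⊎ d ≈ ω ^ 6) → ∃ λ j → ∀ x → Even.χ j x ≈ character β d x
        choose (inj₁ (inj₁ d≈)) = with-index 0F ≡.refl d≈
        choose (inj₁ (inj₂ d≈)) = with-index 4F ≡.refl d≈
        choose (inj₂ (inj₁ d≈)) = with-index 2F ≡.refl d≈
        choose (inj₂ (inj₂ d≈)) = with-index 6F ≡.refl d≈
      go (inj₂ β≈-1) = choose (roots (trans (^-congˡ n β≈-1) [-1]^n≈1))
        where
        with-index : ∀ j → isEven (toℕ j) ≡ false → d ≈ ω ^ (toℕ j ℕ.∸ 1) → ∃ λ j → ∀ x → Even.χ j x ≈ character β d x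
        with-index j eq d≈ = j , λ x → trans (χ-odd j eq x) (character-cong (sym β≈-1) (sym d≈) x)
        choose : (d ≈ ω ^ 0 ⊎ d ≈ ω ^ 4) ⊎ (d ≈ ω ^ 2 ⊎ d ≈ ω ^ 6) → ∃ λ j → ∀ x → Even.χ j x ≈ character β d x
        choose (inj₁ (inj₁ d≈)) = with-index 1F ≡.refl d≈
        choose (inj₁ (inj₂ d≈)) = with-index 5F ≡.refl d≈
        choose (inj₂ (inj₁ d≈)) = with-index 3F ≡.refl d≈
        choose (inj₂ (inj₂ d≈)) = with-index 7F ≡.refl d≈

    classification : Classification Even.χ Even.φ Even.ψ
    classification = record
      { χ-linear     = χ-linear
      ; φ-quadratic  = λ k → _ , _ , _ , ξ-parameters k (κ² k) , φ-trace k
      ; ψ-quadratic  = λ h → _ , _ , _ , ξ-parameters h (-κ² h) , ψ-trace h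
      ; linear-χ     = linear-χ
      -- The index stays k; the sign in c = ± κ k decides between φ and ψ.
      ; quadratic-φψ = λ k 1≤k k<n c²≈ → k , (1≤k , k<n) , choose k (x²≈y²⇒x≈±y (trans c²≈ (sym (κ² k))))
      }
      where
      choose : ∀ k {c} → c ≈ κ k ⊎ c ≈ - κ k →
        (∀ x → Even.φ k x ≈ trace (ξ ^ k) (ξ⁻¹ ^ k) c x) ⊎
        (∀ x → Even.ψ k x ≈ trace (ξ ^ k) (ξ⁻¹ ^ k) c x) ⊎
        (∀ x → Even.ψ k (FiniteGroup._⁻¹ (T n) x) ≈ trace (ξ ^ k) (ξ⁻¹ ^ k) c x)
      choose k (inj₁ c≈) = inj₁ λ x → trans (φ-trace k x) (trace-cong refl refl (sym c≈) x)
      choose k (inj₂ c≈) = inj₂ (inj₁ λ x → trans (ψ-trace k x) (trace-cong refl refl (sym c≈) x))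

-- The character table for odd n.

module OddClassification {c ℓ₁ ℓ₂} (K : AlgClosedField₀ c ℓ₁ ℓ₂) (n : ℕ) .{{_ : NonZero n}} (prim : PrimitiveRoot K (8 ℕ.* n))
  (q : ℕ) (n≡1+2q : n ≡ suc (2 ℕ.* q)) where
  open AlgClosedField₀ K renaming (Carrier to Scalar)
  open CommutativeRing commutativeRing using (commutativeSemiring)
  open FieldProperties K
  open MatrixRepresentations K n
  open QuadraticCharacters K n
  open TraceProperties K n
  open RootsOfUnity K n prim
  open FiniteGroup (T n) using (_⁻¹)
  open SemiringExp semiring using (^-congˡ; ^-congʳ; ^-homo-*; ^-assocʳ)
  open ExpProperties commutativeSemiring using (^-distrib-*)
  open Characters K n prim
  open SetoidReasoning setoid
  open Solver

  [-1]^n≈-1 : [-1]^ n ≈ - 1#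
  [-1]^n≈-1 = trans (^-congʳ (- 1#) n≡1+2q) ([-1]^odd q)

  χ-character : ∀ j x → Odd.χ j x ≈ character ([-1]^ (toℕ j)) (ω ^ toℕ j) x
  χ-character j (a^ r b^ s) = *-cong (power-* (- 1#) (toℕ r)) (power-* ω (toℕ s))
    where
    power-* : ∀ x m → x ^ (m ℕ.* toℕ j) ≈ (x ^ toℕ j) ^ m
    power-* x m = trans (^-congʳ x (ℕ.*-comm m (toℕ j))) (sym (^-assocʳ x (toℕ j) m))

  χ-parameters : ∀ j → LinearParameters ([-1]^ j) (ω ^ j)
  χ-parameters j = record
    { β²≈1  = [-1]^² j
    ; d⁴≈βⁿ = begin
        (ω ^ j) ^ 4      ≈⟨ ^-comm ω j 4 ⟩
        (ω ^ 4) ^ j      ≈⟨ ^-congˡ j (trans ω^4≈-1 (sym [-1]^n≈-1)) ⟩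
        ([-1]^ n) ^ j    ≈⟨ ^-comm (- 1#) n j ⟩
        ([-1]^ j) ^ n    ∎
    }

  -- Here βⁿ = β, so d⁴ = β: even powers of ω belong to β = 1 and odd powers to β = -1, since ω⁴ =
  -- -1.
  linear-χ : ∀ {β d} → LinearParameters β d → ∃ λ j → ∀ x → Odd.χ j x ≈ character β d x
  linear-χ {β} {d} params = go (x²≈1⇒x≈±1 β²≈1)
    where
    open LinearParameters params
    with-index : ∀ j → β ≈ [-1]^ (toℕ j) → d ≈ ω ^ toℕ j → ∃ λ j → ∀ x → Odd.χ j x ≈ character β d x
    with-index j β≈ d≈ = j , λ x → trans (χ-character j x) (character-cong (sym β≈) (sym d≈) x)
    go : β ≈ 1# ⊎ β ≈ - 1# → ∃ λ j → ∀ x → Odd.χ j x ≈ character β d x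
    go (inj₁ β≈1) = choose (fourth-root-ω 0 (trans d⁴≈βⁿ (trans (^-congˡ n β≈1) (1^ n))))
      where
      choose : (d ≈ ω ^ 0 ⊎ d ≈ ω ^ 4) ⊎ (d ≈ ω ^ 2 ⊎ d ≈ ω ^ 6) → ∃ λ j → ∀ x → Odd.χ j x ≈ character β d x
      choose (inj₁ (inj₁ d≈)) = with-index 0F (trans β≈1 (sym ([-1]^even 0))) d≈
      choose (inj₁ (inj₂ d≈)) = with-index 4F (trans β≈1 (sym ([-1]^even 2))) d≈
      choose (inj₂ (inj₁ d≈)) = with-index 2F (trans β≈1 (sym ([-1]^even 1))) d≈
      choose (inj₂ (inj₂ d≈)) = with-index 6F (trans β≈1 (sym ([-1]^even 3))) d≈
    go (inj₂ β≈-1) = choose (fourth-root-ω 1 (trans d⁴≈βⁿ (trans (^-congˡ n β≈-1) (trans [-1]^n≈-1 (sym ω^4≈-1)))))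
      where
      choose : (d ≈ ω ^ 1 ⊎ d ≈ ω ^ 5) ⊎ (d ≈ ω ^ 3 ⊎ d ≈ ω ^ 7) → ∃ λ j → ∀ x → Odd.χ j x ≈ character β d x
      choose (inj₁ (inj₁ d≈)) = with-index 1F (trans β≈-1 (sym ([-1]^odd 0))) d≈
      choose (inj₁ (inj₂ d≈)) = with-index 5F (trans β≈-1 (sym ([-1]^odd 2))) d≈
      choose (inj₂ (inj₁ d≈)) = with-index 3F (trans β≈-1 (sym ([-1]^odd 1))) d≈
      choose (inj₂ (inj₂ d≈)) = with-index 7F (trans β≈-1 (sym ([-1]^odd 3))) d≈

  φ-trace : ∀ k x → Odd.φ k x ≈ trace (ε ^ k) (ε⁻¹ ^ k) ([-1]^ k) x
  φ-trace k (a^ r b^ 0F) = +-cong (sym (^-assocʳ ε k (toℕ r))) (sym (^-assocʳ ε⁻¹ k (toℕ r)))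
  φ-trace k (a^ r b^ 1F) = sym (+-identityˡ 0#)
  φ-trace k (a^ r b^ 2F) = trans (*-comm _ _) (trans
    (*-congʳ (+-cong (sym (^-assocʳ ε k (toℕ r))) (sym (^-assocʳ ε⁻¹ k (toℕ r))))) (distribʳ _ _ _))
  φ-trace k (a^ r b^ 3F) = sym (+-identityˡ 0#)

  φ-parameters : ∀ k → QuadraticParameters (ε ^ k) (ε⁻¹ ^ k) ([-1]^ k)
  φ-parameters k = record
    { αα⁻¹≈1 = ^-*-≈1 k εε⁻¹≈1
    ; α²ⁿ≈1  = trans (sym (^-assocʳ (ε ^ k) 2 n)) (trans (^-comm (ε ^ k) 2 n) (trans (^-congˡ 2 [ε^k]^n≈1) (1^ 2)))
    ; c²≈αⁿ  = trans ([-1]^² k) (sym [ε^k]^n≈1)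
    }
    where
    [ε^k]^n≈1 : (ε ^ k) ^ n ≈ 1#
    [ε^k]^n≈1 = trans (^-comm ε k n) (trans (^-congˡ k ε^n≈1) (1^ k))

  -- The factor (-1)^(rh + r) in ψ is the r-th power of this sign, so ψ h is a trace with α = η h
  -- ξʰ.
  η : ℕ → Scalar
  η h = [-1]^ (suc h)

  ψ-trace : ∀ h x → Odd.ψ h x ≈ trace (η h * ξ ^ h) (η h * ξ⁻¹ ^ h) i x
  ψ-trace h x = go x
    where
    term : ∀ y r → [-1]^ (r ℕ.* h ℕ.+ r) * y ^ (h ℕ.* r) ≈ (η h * y ^ h) ^ r
    term y r = begin
      [-1]^ (r ℕ.* h ℕ.+ r) * y ^ (h ℕ.* r)
        ≈⟨ *-cong (trans (^-congʳ (- 1#) (exponent r h)) (sym (^-assocʳ (- 1#) (suc h) r))) (sym (^-assocʳ y h r)) ⟩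
      η h ^ r * (y ^ h) ^ r                    ≈⟨ ^-distrib-* (η h) (y ^ h) r ⟨
      (η h * y ^ h) ^ r                        ∎
      where
      exponent : ∀ r h → r ℕ.* h ℕ.+ r ≡ suc h ℕ.* r
      exponent = ℕ-solve-∀
    terms : ∀ r → [-1]^ (r ℕ.* h ℕ.+ r) * ξ± (h ℕ.* r) ≈ (η h * ξ ^ h) ^ r + (η h * ξ⁻¹ ^ h) ^ r
    terms r = trans (distribˡ _ _ _) (+-cong (term ξ r) (term ξ⁻¹ r))
    go : ∀ x → Odd.ψ h x ≈ trace (η h * ξ ^ h) (η h * ξ⁻¹ ^ h) i x
    go (a^ r b^ 0F) = terms (toℕ r)
    go (a^ r b^ 1F) = sym (+-identityˡ 0#)
    go (a^ r b^ 2F) = trans (*-assoc _ _ _) (trans (*-comm _ _) (trans (*-congʳ (terms (toℕ r))) (distribʳ i _ _)))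
    go (a^ r b^ 3F) = sym (+-identityˡ 0#)

  -- For odd n, αⁿ = (-1)ʰ⁺¹ (-1)ʰ = -1 for every h, which is why the same c = i fits all of them.
  ψ-parameters : ∀ h → QuadraticParameters (η h * ξ ^ h) (η h * ξ⁻¹ ^ h) i
  ψ-parameters h = record
    { αα⁻¹≈1 = trans (solve 3 (λ η x y → (η :* x) :* (η :* y) := (η :* η) :* (x :* y)) refl (η h) (ξ ^ h) (ξ⁻¹ ^ h))
        (trans (*-cong ([-1]^² (suc h)) (^-*-≈1 h ξξ⁻¹≈1)) (*-identityˡ 1#))
    ; α²ⁿ≈1  = trans (sym (^-assocʳ (η h * ξ ^ h) 2 n)) (trans (^-comm (η h * ξ ^ h) 2 n)
        (trans (^-congˡ 2 αⁿ≈-1) (trans (x^2≈xx _) -1*-1≈1)))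
    ; c²≈αⁿ  = trans i*i≈-1 (sym αⁿ≈-1)
    }
    where
    αⁿ≈-1 : (η h * ξ ^ h) ^ n ≈ - 1#
    αⁿ≈-1 = begin
      (η h * ξ ^ h) ^ n                        ≈⟨ ^-distrib-* (η h) (ξ ^ h) n ⟩
      η h ^ n * (ξ ^ h) ^ n                    ≈⟨ *-cong (trans (^-comm (- 1#) (suc h) n) (^-congˡ (suc h) [-1]^n≈-1)) ([ξ^k]^n h) ⟩
      [-1]^ (suc h) * [-1]^ h                  ≈⟨ *-assoc _ _ _ ⟩
      - 1# * ([-1]^ h * [-1]^ h)               ≈⟨ *-congˡ ([-1]^² h) ⟩
      - 1# * 1#                                ≈⟨ *-identityʳ _ ⟩
      - 1#                                     ∎

  Listed : ℕ → Scalar → Set _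
  Listed k c = ∃ λ h → (1 ℕ.≤ h × h ℕ.< n) ×
    ((∀ x → Odd.φ h x ≈ trace (ξ ^ k) (ξ⁻¹ ^ k) c x) ⊎
     (∀ x → Odd.ψ h x ≈ trace (ξ ^ k) (ξ⁻¹ ^ k) c x) ⊎
     (∀ x → Odd.ψ h (x ⁻¹) ≈ trace (ξ ^ k) (ξ⁻¹ ^ k) c x))

  -- Here ξ²ᵐ = εᵐ and c = ± 1. The value c = (-1)ᵐ occurs in φ m. The opposite one occurs in φ (n -
  -- m), because εⁿ⁻ᵐ = ε⁻ᵐ while n odd gives (-1)ⁿ⁻ᵐ = -(-1)ᵐ.
  even-listed : ∀ m {c} → 1 ℕ.≤ 2 ℕ.* m → 2 ℕ.* m ℕ.< n → c * c ≈ [-1]^ (2 ℕ.* m) → Listed (2 ℕ.* m) c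
  even-listed m {c} 1≤2m 2m<n c²≈ = go (x²≈y²⇒x≈±y {y = [-1]^ m} (trans c²≈ (trans ([-1]^even m) (sym ([-1]^² m)))))
    where
    1≤m : 1 ℕ.≤ m
    1≤m = ℕ.*-cancelˡ-< 2 0 m 1≤2m
    m<n : m ℕ.< n
    m<n = ℕ.≤-<-trans (ℕ.m≤n*m m 2) 2m<n
    ε^m≈ : ε ^ m ≈ ξ ^ (2 ℕ.* m)
    ε^m≈ = trans (^-congˡ m ε≈ξ²) (^-assocʳ ξ 2 m)
    ε⁻¹^m≈ : ε⁻¹ ^ m ≈ ξ⁻¹ ^ (2 ℕ.* m)
    ε⁻¹^m≈ = trans (^-congˡ m ε⁻¹≈ξ⁻¹²) (^-assocʳ ξ⁻¹ 2 m)
    n-m+m≡n : (n ℕ.∸ m) ℕ.+ m ≡ n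
    n-m+m≡n = ℕ.m∸n+n≡m (ℕ.<⇒≤ m<n)
    [-1]^[n-m]≈ : [-1]^ (n ℕ.∸ m) ≈ - ([-1]^ m)
    [-1]^[n-m]≈ = begin
      [-1]^ (n ℕ.∸ m)                          ≈⟨ *-identityʳ _ ⟨
      [-1]^ (n ℕ.∸ m) * 1#                     ≈⟨ *-congˡ ([-1]^² m) ⟨
      [-1]^ (n ℕ.∸ m) * ([-1]^ m * [-1]^ m)    ≈⟨ *-assoc _ _ _ ⟨
      [-1]^ (n ℕ.∸ m) * [-1]^ m * [-1]^ m      ≈⟨ *-congʳ (^-homo-* (- 1#) (n ℕ.∸ m) m) ⟨
      [-1]^ (n ℕ.∸ m ℕ.+ m) * [-1]^ m          ≈⟨ *-congʳ (trans (^-congʳ (- 1#) n-m+m≡n) [-1]^n≈-1) ⟩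
      - 1# * [-1]^ m                           ≈⟨ solve 1 (λ x → (:- con (+ 1)) :* x := :- x) refl ([-1]^ m) ⟩
      - ([-1]^ m)                              ∎
    go : c ≈ [-1]^ m ⊎ c ≈ - ([-1]^ m) → Listed (2 ℕ.* m) c
    go (inj₁ c≈) = m , (1≤m , m<n) , inj₁ λ x → trans (φ-trace m x) (trace-cong ε^m≈ ε⁻¹^m≈ (sym c≈) x)
    go (inj₂ c≈) = n ℕ.∸ m , (ℕ.m<n⇒0<n∸m m<n , ℕ.∸-monoʳ-< 1≤m (ℕ.<⇒≤ m<n)) , inj₁ λ x →
      trans (φ-trace (n ℕ.∸ m) x) (trans (trace-swap _ _ _ x) (trace-cong
        (trans (power-complement n (n ℕ.∸ m) m (trans (*-comm _ _) εε⁻¹≈1) (inverse-power n εε⁻¹≈1 ε^n≈1) n-m+m≡n) ε^m≈)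
        (trans (power-complement n (n ℕ.∸ m) m εε⁻¹≈1 ε^n≈1 n-m+m≡n) ε⁻¹^m≈)
        (trans [-1]^[n-m]≈ (sym c≈)) x))

  -- For odd k the sign η k is 1, so ψ k has parameters (ξᵏ, i). The remaining root c = -i is the
  -- inverse of i and belongs to the dual of ψ k.
  odd-listed : ∀ m {c} → suc (2 ℕ.* m) ℕ.< n → c * c ≈ [-1]^ (suc (2 ℕ.* m)) → Listed (suc (2 ℕ.* m)) c
  odd-listed m {c} k<n c²≈ = go (x²≈y²⇒x≈±y (trans c²≈ (trans ([-1]^odd m) (sym i*i≈-1))))
    where
    k : ℕ
    k = suc (2 ℕ.* m)
    η≈1 : η k ≈ 1#
    η≈1 = trans (*-congˡ ([-1]^odd m)) -1*-1≈1
    η*≈ : ∀ x → η k * x ≈ x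
    η*≈ x = trans (*-congʳ η≈1) (*-identityˡ x)
    i*-i≈1 : i * - i ≈ 1#
    i*-i≈1 = trans (solve 1 (λ x → x :* (:- x) := :- (x :* x)) refl i)
      (trans (-‿cong i*i≈-1) (solve 0 (:- (:- con (+ 1)) := con (+ 1)) refl))
    go : c ≈ i ⊎ c ≈ - i → Listed k c
    go (inj₁ c≈) = k , (ℕ.s≤s ℕ.z≤n , k<n) , inj₂ (inj₁ λ x →
      trans (ψ-trace k x) (trace-cong (η*≈ _) (η*≈ _) (sym c≈) x))
    go (inj₂ c≈) = k , (ℕ.s≤s ℕ.z≤n , k<n) , inj₂ (inj₂ λ x →
      trans (ψ-trace k (x ⁻¹)) (trans (trace-dual (ψ-parameters k) i*-i≈1 x) (trace-cong (η*≈ _) (η*≈ _) (sym c≈) x)))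

  classification : Classification Odd.χ Odd.φ Odd.ψ
  classification = record
    { χ-linear     = λ j → _ , _ , χ-parameters (toℕ j) , χ-character j
    ; φ-quadratic  = λ k → _ , _ , _ , φ-parameters k , φ-trace k
    ; ψ-quadratic  = λ h → _ , _ , _ , ψ-parameters h , ψ-trace h
    ; linear-χ     = linear-χ
    ; quadratic-φψ = λ k → listed k (parity k)
    }
    where
    listed : ∀ k → Parity k → ∀ {c} → 1 ℕ.≤ k → k ℕ.< n → c * c ≈ [-1]^ k → Listed k c
    listed k (even m ≡.refl _) = even-listed m
    listed k (odd m ≡.refl _)  = λ _ → odd-listed m

-- A finite search: the first index that yields B settles the matter, otherwise A holds throughout.
all-or : ∀ {a b} m {A : Fin m → Set a} {B : Set b} → (∀ k → A k ⊎ B) → (∀ k → A k) ⊎ B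
all-or zero    f = inj₁ λ ()
all-or (suc m) {A} {B} f = combine (f zero) (all-or m (f ∘ suc))
  where
  combine : A zero ⊎ B → (∀ k → A (suc k)) ⊎ B → (∀ k → A k) ⊎ B
  combine (inj₂ b) _        = inj₂ b
  combine (inj₁ _) (inj₂ b) = inj₂ b
  combine (inj₁ a) (inj₁ g) = inj₁ λ { zero → a ; (suc k) → g k }

-- Fourier inversion at the identity.

module Inversion {c ℓ₁ ℓ₂} (K : AlgClosedField₀ c ℓ₁ ℓ₂) (n : ℕ) .{{_ : NonZero n}} (prim : PrimitiveRoot K (8 ℕ.* n)) where
  open AlgClosedField₀ K renaming (Carrier to Scalar)
  open Scalars K
  open CommutativeRing commutativeRing using (commutativeSemiring)
  open FieldProperties K
  open FiniteSums K
  open MatrixRepresentations K n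
  open RootsOfUnity K n prim
  open SemiringExp semiring using (^-congˡ; ^-assocʳ)
  open ExpProperties commutativeSemiring using (^-distrib-*)
  open MultProperties semiring using (×-assoc-*; ×-congʳ)
  open Presentation n using (ε; residue; residue-toℕ)
  open FiniteGroup (T n) using (enum)
  open PrimitiveRoot prim
  open Characters K n prim using (ξ; ξ⁻¹; i; [-1]^)
  open SetoidReasoning setoid
  open Solver

  geometric : ∀ y m → y * sum {m} (λ k → y ^ toℕ k) + 1# ≈ sum {m} (λ k → y ^ toℕ k) + y ^ m
  geometric y zero    = solve 1 (λ y → y :* con (+ 0) :+ con (+ 1) := con (+ 0) :+ con (+ 1)) refl y
  geometric y (suc m) = begin
    y * (1# + sum {m} (λ k → y * y ^ toℕ k)) + 1#   ≈⟨ +-congʳ (*-congˡ (+-congˡ (Σₛ.*-distribˡ-sum y (λ (k : Fin m) → y ^ toℕ k)))) ⟨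
    y * (1# + y * G) + 1#                       ≈⟨ solve 2 (λ y g → y :* (con (+ 1) :+ y :* g) :+ con (+ 1)
                                                    := y :* (y :* g :+ con (+ 1)) :+ con (+ 1)) refl y G ⟩
    y * (y * G + 1#) + 1#                       ≈⟨ +-congʳ (*-congˡ (geometric y m)) ⟩
    y * (G + y ^ m) + 1#                        ≈⟨ solve 3 (λ y g p → y :* (g :+ p) :+ con (+ 1)
                                                    := (con (+ 1) :+ y :* g) :+ y :* p) refl y G (y ^ m) ⟩
    1# + y * G + y * y ^ m                      ≈⟨ +-congʳ (+-congˡ (Σₛ.*-distribˡ-sum y (λ (k : Fin m) → y ^ toℕ k))) ⟩
    1# + sum {m} (λ k → y * y ^ toℕ k) + y * y ^ m  ∎
    where
    G : Scalar
    G = sum {m} λ k → y ^ toℕ k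

  geometric-≈0 : ∀ {y m} → y ^ m ≈ 1# → ¬ y ≈ 1# → sum {m} (λ k → y ^ toℕ k) ≈ 0#
  geometric-≈0 {y} {m} yᵐ≈1 y≉1 = conclude (≈0⊎#0 (y - 1#))
    where
    G : Scalar
    G = sum {m} λ k → y ^ toℕ k
    conclude : y - 1# ≈ 0# ⊎ (y - 1#) # 0# → G ≈ 0#
    conclude (inj₁ y-1≈0) = contradiction (x-y≈0⇒x≈y y-1≈0) y≉1
    conclude (inj₂ y-1#0) = #0-cancelˡ y-1#0 (begin
      (y - 1#) * G                  ≈⟨ solve 2 (λ y g → (y :- con (+ 1)) :* g
                                         := (y :* g :+ con (+ 1)) :- (g :+ con (+ 1))) refl y G ⟩
      (y * G + 1#) - (G + 1#)       ≈⟨ x≈y⇒x-y≈0 (trans (geometric y m) (+-congˡ yᵐ≈1)) ⟩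
      0#                            ∎)

  -- ξʳ = ζ⁴ʳ with 0 < 4r < 8n, so primitivity applies.
  ξ^r≉1 : ∀ {r} → 0 ℕ.< r → r ℕ.< 2 ℕ.* n → ¬ ξ ^ r ≈ 1#
  ξ^r≉1 {r} 0<r r<2n ξ^r≈1 = #⇒≉ (minimal
    (ℕ.*-monoʳ-< 4 0<r) (ℕ.<-≤-trans (ℕ.*-monoʳ-< 4 r<2n) (ℕ.≤-reflexive (≡.sym (ℕ.*-assoc 4 2 n)))))
    (trans (sym (^-assocʳ ζ 4 r)) ξ^r≈1)

  coefficient₀₀ : ℕ → Scalar → Normal n → Scalar
  coefficient₀₀ k c x = entry (ξ ^ k) (ξ⁻¹ ^ k) c x 0F 0F

  i^k-squared : ∀ k → i ^ k * i ^ k ≈ [-1]^ k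
  i^k-squared k = trans (sym (^-distrib-* i i k)) (^-congˡ k i*i≈-1)

  -i^k-squared : ∀ k → - (i ^ k) * - (i ^ k) ≈ [-1]^ k
  -i^k-squared k = trans (solve 1 (λ x → (:- x) :* (:- x) := x :* x) refl (i ^ k)) (i^k-squared k)

  -- `i ^ k` and its negative are both square roots of (-1)ᵏ, uniformly in the parity of k, so the
  -- two representations with α = ξᵏ are added.
  pair : ℕ → Normal n → Scalar
  pair k x = coefficient₀₀ k (i ^ k) x + coefficient₀₀ k (- (i ^ k)) x

  -- A nonzero multiple of the point mass at ε: on aʳ the sum over k is geometric, on aʳb² the two
  -- signs of c cancel, and odd powers of b have no diagonal entry.
  delta : Normal n → Scalar
  delta x = sum {2 ℕ.* n} λ k → pair (toℕ k) x

  delta-≈0 : ∀ x → x ≢ ε → delta x ≈ 0#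
  delta-≈0 (a^ r b^ 0F) x≢ε = begin
    sum {2 ℕ.* n} (λ k → (ξ ^ toℕ k) ^ toℕ r + (ξ ^ toℕ k) ^ toℕ r)
      ≈⟨ Σₚ.sum-cong-≋ {2 ℕ.* n} (λ k → +-cong (^-comm ξ (toℕ k) (toℕ r)) (^-comm ξ (toℕ k) (toℕ r))) ⟩
    sum {2 ℕ.* n} (λ k → (ξ ^ toℕ r) ^ toℕ k + (ξ ^ toℕ r) ^ toℕ k)
      ≈⟨ Σₚ.∑-distrib-+ {2 ℕ.* n} (λ k → (ξ ^ toℕ r) ^ toℕ k) (λ k → (ξ ^ toℕ r) ^ toℕ k) ⟩
    sum {2 ℕ.* n} (λ k → (ξ ^ toℕ r) ^ toℕ k) + sum {2 ℕ.* n} (λ k → (ξ ^ toℕ r) ^ toℕ k)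
      ≈⟨ +-cong G≈0 G≈0 ⟩
    0# + 0#  ≈⟨ +-identityˡ 0# ⟩
    0#       ∎
    where
    r≢0 : toℕ r ≢ 0
    r≢0 r≡0 = x≢ε (≡.cong (a^_b^ 0F) (≡.trans (≡.sym (residue-toℕ r)) (≡.cong (residue ∘ +_) r≡0)))
    G≈0 : sum {2 ℕ.* n} (λ k → (ξ ^ toℕ r) ^ toℕ k) ≈ 0#
    G≈0 = geometric-≈0 {ξ ^ toℕ r} {2 ℕ.* n} (trans (^-comm ξ (toℕ r) (2 ℕ.* n)) (trans (^-congˡ (toℕ r) ξ^2n≈1) (1^ (toℕ r))))
      (ξ^r≉1 (ℕ.n≢0⇒n>0 r≢0) (toℕ<n r))
  delta-≈0 (a^ r b^ 1F) _ = ∑-0 (↔-id (Fin (2 ℕ.* n))) λ k → +-identityˡ 0#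
  delta-≈0 (a^ r b^ 2F) _ = ∑-0 (↔-id (Fin (2 ℕ.* n))) λ k →
    solve 2 (λ x y → x :* y :+ x :* (:- y) := con (+ 0)) refl ((ξ ^ toℕ k) ^ toℕ r) (i ^ toℕ k)
  delta-≈0 (a^ r b^ 3F) _ = ∑-0 (↔-id (Fin (2 ℕ.* n))) λ k → +-identityˡ 0#

  coefficient₀₀-ε : ∀ k {c} → c * c ≈ [-1]^ k → coefficient₀₀ k c ε ≈ 1#
  coefficient₀₀-ε k {c} c²≈ = trans (sym (ρ≋entry (ξ ^ k) (ξ⁻¹ ^ k) c ε 0F 0F))
    (ρ-ε (ξ ^ k) (ξ⁻¹ ^ k) c (ξ-parameters k c²≈) 0F 0F)

  delta-ε : delta ε # 0#
  delta-ε = #-congʳ (sym (begin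
    delta ε                          ≈⟨ Σₚ.sum-cong-≋ {2 ℕ.* n} (λ k → +-cong
                                          (coefficient₀₀-ε (toℕ k) (i^k-squared (toℕ k)))
                                          (coefficient₀₀-ε (toℕ k) (-i^k-squared (toℕ k)))) ⟩
    sum {2 ℕ.* n} (λ _ → 1# + 1#)    ≈⟨ Σₚ.sum-replicate (2 ℕ.* n) ⟩
    (2 ℕ.* n) · (1# + 1#)            ≈⟨ ×-congʳ (2 ℕ.* n) (*-identityˡ _) ⟨
    (2 ℕ.* n) · (1# * (1# + 1#))     ≈⟨ ×-assoc-* (2 ℕ.* n) 1# (1# + 1#) ⟨
    (2 ℕ.* n) · 1# * (1# + 1#)       ∎)) (x#0y#0→xy#0 (·1#0 (2 ℕ.* n) (ℕ.≢-nonZero⁻¹ _ {{ℕ.m*n≢0 2 n}})) 2#0)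
    where
    ·1#0 : ∀ m → m ≢ 0 → m · 1# # 0#
    ·1#0 zero    0≢0 = contradiction ≡.refl 0≢0
    ·1#0 (suc m) _   = char-zero m

  -- Summed over k and both signs, the coefficients give 4n · w ε.
  coefficients≈0⇒≈0 : ∀ (w : Normal n → Scalar) →
    (∀ (k : Fin (2 ℕ.* n)) → ∑ enum (λ x → w x * coefficient₀₀ (toℕ k) (i ^ toℕ k) x) ≈ 0#
                           × ∑ enum (λ x → w x * coefficient₀₀ (toℕ k) (- (i ^ toℕ k)) x) ≈ 0#) → w ε ≈ 0#
  coefficients≈0⇒≈0 w coefficients≈0 = #0-cancelˡ delta-ε (begin
    delta ε * w ε                                           ≈⟨ *-comm _ _ ⟩
    w ε * delta ε
      ≈⟨ ∑-single enum (λ x → w x * delta x) ε (λ x x≢ε → trans (*-congˡ (delta-≈0 x x≢ε)) (zeroʳ (w x))) ⟨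
    ∑ enum (λ x → w x * delta x)                            ≈⟨ ∑-cong enum (λ x → *-∑ ks (w x) (λ k → pair (toℕ k) x)) ⟩
    ∑ enum (λ x → ∑ ks (λ k → w x * pair (toℕ k) x))        ≈⟨ ∑-comm enum ks (λ x k → w x * pair (toℕ k) x) ⟩
    ∑ ks (λ k → ∑ enum (λ x → w x * pair (toℕ k) x))        ≈⟨ ∑-0 ks pair≈0 ⟩
    0#                                                      ∎)
    where
    ks = ↔-id (Fin (2 ℕ.* n))
    pair≈0 : ∀ k → ∑ enum (λ x → w x * pair (toℕ k) x) ≈ 0#
    pair≈0 k = begin
      ∑ enum (λ x → w x * pair (toℕ k) x)
        ≈⟨ ∑-cong enum (λ x → distribˡ (w x) (f x) (g x)) ⟩
      ∑ enum (λ x → w x * f x + w x * g x)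
        ≈⟨ ∑-+ enum (λ x → w x * f x) (λ x → w x * g x) ⟩
      ∑ enum (λ x → w x * f x) + ∑ enum (λ x → w x * g x)
        ≈⟨ +-cong (proj₁ (coefficients≈0 k)) (proj₂ (coefficients≈0 k)) ⟩
      0# + 0#  ≈⟨ +-identityˡ 0# ⟩
      0#       ∎
      where
      f g : Normal n → Scalar
      f = coefficient₀₀ (toℕ k) (i ^ toℕ k)
      g = coefficient₀₀ (toℕ k) (- (i ^ toℕ k))

-- The equivalence, for any table satisfying `Classification`.

module CayleyIntegrality {c ℓ₁ ℓ₂ p} (K : AlgClosedField₀ c ℓ₁ ℓ₂) (n : ℕ) .{{_ : NonZero n}} (prim : PrimitiveRoot K (8 ℕ.* n))
  {S₁ S₂ : Pred (Normal n) p} (S₁? : Decidable S₁) (S₂? : Decidable S₂)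
  (S₁⊆ : S₁ ⊆ ⟨a⟩b^ 0F ∪ ⟨a⟩b^ 2F) (S₂⊆ : S₂ ⊆ ⟨a⟩b^ 1F ∪ ⟨a⟩b^ 3F)
  (ε∉S : FiniteGroup.ε (T n) ∉ S₁ ∪ S₂) (S≐S⁻¹ : (S₁ ∪ S₂) ≐ FiniteGroup._⁻¹ˢ (T n) (S₁ ∪ S₂)) where
  open AlgClosedField₀ K renaming (Carrier to Scalar)
  open Scalars K
  open FieldProperties K
  open FiniteSums K
  open MatrixRepresentations K n
  open QuadraticCharacters K n
  open TraceProperties K n
  open RootsOfUnity K n prim
  open Inversion K n prim
  open SemiringExp semiring using (^-congˡ)
  open FiniteGroup (T n) using (enum; _∙_; ε; _⁻¹)
  open CharacterSums K (T n)
  open Discriminant K (T n)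
  open CayleySpectrum K (T n) (S₁? ∪? S₂?) ε∉S S≐S⁻¹
  open SplitConnectionSet K n S₁? S₂? S₁⊆ S₂⊆ ε∉S S≐S⁻¹
  open Spectrum K (Cay (T n) (S₁? ∪? S₂?) ε∉S S≐S⁻¹)
  open Characters K n prim using (ξ; ξ⁻¹; i; [-1]^)
  open SetoidReasoning setoid
  open Solver

  Conditions : (Fin 8 → Normal n → Scalar) → (ℕ → Normal n → Scalar) → (ℕ → Normal n → Scalar) → Set ℓ₁
  Conditions χ φ ψ =
      (∀ (j : Fin 8) → IsInteger (χ j ⟪ S₁? ∪? S₂? ⟫))
    × (∀ k → 1 ℕ.≤ k → k ℕ.< n → IsInteger (φ k ⟪ S₁? ⟫) × IsInteger (squares S₁? S₂? (φ k)))
    × (∀ k → 1 ℕ.≤ k → k ℕ.< n → IsPerfectSquare (Δ S₁? S₂? (φ k)))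
    × (∀ h → 1 ℕ.≤ h → h ℕ.< n → IsInteger (ψ h ⟪ S₁? ⟫) × IsInteger (squares S₁? S₂? (ψ h)))
    × (∀ h → 1 ℕ.≤ h → h ℕ.< n → IsPerfectSquare (Δ S₁? S₂? (ψ h)))

  module _ {χ : Fin 8 → Normal n → Scalar} {φ ψ : ℕ → Normal n → Scalar} (classification : Classification χ φ ψ) where
    open Classification classification

    quadratic⇒IntegralSquares : Integral → ∀ {f : Normal n → Scalar} →
      (∃ λ α → ∃ λ α⁻¹ → ∃ λ c → QuadraticParameters α α⁻¹ c × (∀ x → f x ≈ trace α α⁻¹ c x)) → IntegralSquares f
    quadratic⇒IntegralSquares integral (α , α⁻¹ , c , params , f≈) =
      IntegralSquares-cong {trace α α⁻¹ c} (λ x → sym (f≈ x)) (integral⇒IntegralSquares params integral)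

    linear⇒IsInteger : Integral → ∀ {f : Normal n → Scalar} →
      (∃₂ λ β d → LinearParameters β d × (∀ x → f x ≈ character β d x)) → IsInteger (f ⟪ S₁? ∪? S₂? ⟫)
    linear⇒IsInteger integral (β , d , params , f≈) =
      IsInteger-cong (⟪⟫-cong {character β d} (λ x → sym (f≈ x)) (S₁? ∪? S₂?))
        (integral _ (LinearCharacter.isEigenvalue (character-∙ params) (#-congʳ (sym (character-ε params)) 1#0)))

    integral⇒conditions : Integral → Conditions χ φ ψ
    integral⇒conditions integral =
        (λ j → linear⇒IsInteger integral (χ-linear j))
      , (λ k _ _ → proj₁ (φ-squares k)) , (λ k _ _ → proj₂ (φ-squares k))
      , (λ h _ _ → proj₁ (ψ-squares h)) , (λ h _ _ → proj₂ (ψ-squares h))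
      where
      φ-squares : ∀ k → IntegralSquares (φ k)
      φ-squares k = quadratic⇒IntegralSquares integral (φ-quadratic k)
      ψ-squares : ∀ h → IntegralSquares (ψ h)
      ψ-squares h = quadratic⇒IntegralSquares integral (ψ-quadratic h)

    module _ (conditions : Conditions χ φ ψ) where
      private
        χ-integers : ∀ j → IsInteger (χ j ⟪ S₁? ∪? S₂? ⟫)
        χ-integers = proj₁ conditions

        φ-squares : ∀ k → 1 ℕ.≤ k → k ℕ.< n → IntegralSquares (φ k)
        φ-squares k 1≤k k<n = proj₁ (proj₂ conditions) k 1≤k k<n , proj₁ (proj₂ (proj₂ conditions)) k 1≤k k<n

        ψ-squares : ∀ h → 1 ℕ.≤ h → h ℕ.< n → IntegralSquares (ψ h)
        ψ-squares h 1≤h h<n =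
          proj₁ (proj₂ (proj₂ (proj₂ conditions))) h 1≤h h<n , proj₂ (proj₂ (proj₂ (proj₂ conditions))) h 1≤h h<n

      trace-squares : ∀ k {c} → 1 ℕ.≤ k → k ℕ.< n → c * c ≈ [-1]^ k → IntegralSquares (trace (ξ ^ k) (ξ⁻¹ ^ k) c)
      trace-squares k {c} 1≤k k<n c²≈ = go (quadratic-φψ k 1≤k k<n c²≈)
        where
        go : (∃ λ h → (1 ℕ.≤ h × h ℕ.< n) ×
          ((∀ x → φ h x ≈ trace (ξ ^ k) (ξ⁻¹ ^ k) c x) ⊎
           (∀ x → ψ h x ≈ trace (ξ ^ k) (ξ⁻¹ ^ k) c x) ⊎
           (∀ x → ψ h (x ⁻¹) ≈ trace (ξ ^ k) (ξ⁻¹ ^ k) c x))) → IntegralSquares (trace (ξ ^ k) (ξ⁻¹ ^ k) c)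
        go (h , (1≤h , h<n) , inj₁ φ≈)         = IntegralSquares-cong {φ h} φ≈ (φ-squares h 1≤h h<n)
        go (h , (1≤h , h<n) , inj₂ (inj₁ ψ≈))  = IntegralSquares-cong {ψ h} ψ≈ (ψ-squares h 1≤h h<n)
        go (h , (1≤h , h<n) , inj₂ (inj₂ ψ*≈)) =
          IntegralSquares-cong {ψ h ∘ _⁻¹} ψ*≈ (IntegralSquares-dual (ψ h) (ψ-squares h 1≤h h<n))

      -- Since ξᵏ is the inverse of ξ²ⁿ⁻ᵏ, the trace for k is the one for 2n - k with α and α⁻¹
      -- exchanged, and 2n - k lies below n. The same c fits: c² = α⁻ⁿ is the condition for 2n - k.
      trace-squares′ : ∀ k {c} → n ℕ.< k → k ℕ.< 2 ℕ.* n → c * c ≈ [-1]^ k → IntegralSquares (trace (ξ ^ k) (ξ⁻¹ ^ k) c)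
      trace-squares′ k {c} n<k k<2n c²≈ = IntegralSquares-cong {trace (ξ ^ k′) (ξ⁻¹ ^ k′) c}
        (λ x → trans (trace-swap (ξ ^ k′) (ξ⁻¹ ^ k′) c x) (trace-cong (sym ξ^k≈) (sym ξ⁻¹^k≈) refl x))
        (trace-squares k′ (ℕ.m<n⇒0<n∸m k<2n) k′<n
          (trans (QuadraticParameters.c²≈α⁻¹ⁿ (ξ-parameters k c²≈)) (trans (^-congˡ n ξ⁻¹^k≈) ([ξ^k]^n k′))))
        where
        k′ : ℕ
        k′ = 2 ℕ.* n ℕ.∸ k
        k′<n : k′ ℕ.< n
        k′<n = ≡.subst (k′ ℕ.<_) (≡.trans (≡.cong (ℕ._∸ n) (≡.cong (n ℕ.+_) (ℕ.+-identityʳ n))) (ℕ.m+n∸n≡m n n))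
          (ℕ.∸-monoʳ-< n<k (ℕ.<⇒≤ k<2n))
        k+k′≡2n : k ℕ.+ k′ ≡ 2 ℕ.* n
        k+k′≡2n = ℕ.m+[n∸m]≡n (ℕ.<⇒≤ k<2n)
        ξ^k≈ : ξ ^ k ≈ ξ⁻¹ ^ k′
        ξ^k≈ = power-complement (2 ℕ.* n) k k′ ξξ⁻¹≈1 ξ^2n≈1 k+k′≡2n
        ξ⁻¹^k≈ : ξ⁻¹ ^ k ≈ ξ ^ k′
        ξ⁻¹^k≈ = power-complement (2 ℕ.* n) k k′ (trans (*-comm _ _) ξξ⁻¹≈1)
          (inverse-power (2 ℕ.* n) ξξ⁻¹≈1 ξ^2n≈1) k+k′≡2n

      module _ {μ : Scalar} {w : Normal n → Scalar} (pairing : ∀ (f : Normal n → Scalar) →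
        μ * ∑ enum (λ x → w x * f x) ≈ ∑ enum (λ y → w y * ∑ enum (λ z → s z * f (y ∙ z)))) where

        -- Carrying the goal along as an alternative means that only a nonvanishing coefficient has
        -- to produce integrality.
        Dichotomy : ℕ → Scalar → Set ℓ₁
        Dichotomy k c = ∑ enum (λ x → w x * coefficient₀₀ k c x) ≈ 0# ⊎ IsInteger μ

        linear-dichotomy : ∀ {β d} → LinearParameters β d → ∑ enum (λ x → w x * character β d x) ≈ 0# ⊎ IsInteger μ
        linear-dichotomy {β} {d} params =
          go (LinearCharacter.⟨w,χ⟩≈0⊎μ≈χ⟪S⟫ (character-∙ params) {μ} {w} pairing) (linear-χ params)
          where
          go : ∑ enum (λ x → w x * character β d x) ≈ 0# ⊎ μ ≈ character β d ⟪ S₁? ∪? S₂? ⟫ →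
            (∃ λ j → ∀ x → χ j x ≈ character β d x) → ∑ enum (λ x → w x * character β d x) ≈ 0# ⊎ IsInteger μ
          go (inj₁ ≈0) _         = inj₁ ≈0
          go (inj₂ μ≈) (j , χ≈) =
            inj₂ (IsInteger-cong (trans (⟪⟫-cong {χ j} χ≈ (S₁? ∪? S₂?)) (sym μ≈)) (χ-integers j))

        -- For ξᵏ = ± 1 the two-dimensional representation splits into the linear characters with b ↦ ± √c.
        split-dichotomy : ∀ k {c} → c * c ≈ [-1]^ k → ξ ^ k * ξ ^ k ≈ 1# → Dichotomy k c
        split-dichotomy k {c} c²≈ ξ²ᵏ≈1 = go (quadratic-root 0# (- c))
          where
          go : (∃ λ d → d * d - 0# * d + - c ≈ 0#) → Dichotomy k c
          go (d , root) = combine (linear-dichotomy (parameters d²)) (linear-dichotomy (parameters -d²))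
            where
            d² : d * d ≈ c
            d² = x-y≈0⇒x≈y (trans (solve 2 (λ d c → d :* d :- c := d :* d :- con (+ 0) :* d :+ (:- c)) refl d c) root)
            -d² : - d * - d ≈ c
            -d² = trans (solve 1 (λ d → (:- d) :* (:- d) := d :* d) refl d) d²
            parameters : ∀ {f} → f * f ≈ c → LinearParameters (ξ ^ k) f
            parameters {f} f² = record
              { β²≈1  = ξ²ᵏ≈1
              ; d⁴≈βⁿ = begin
                  f ^ 4                ≈⟨ solve 1 (λ f → f :* (f :* (f :* (f :* con (+ 1)))) := (f :* f) :* (f :* f)) refl f ⟩
                  (f * f) * (f * f)    ≈⟨ *-cong f² f² ⟩
                  c * c                ≈⟨ c²≈ ⟩
                  [-1]^ k              ≈⟨ [ξ^k]^n k ⟨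
                  (ξ ^ k) ^ n          ∎
              }
            -- On odd powers of b the contributions of d and -d cancel, on even powers only d² = c
            -- enters; so the mean of the two linear characters is the upper left entry.
            average : ∀ x → character (ξ ^ k) d x + character (ξ ^ k) (- d) x ≈ coefficient₀₀ k c x + coefficient₀₀ k c x
            average (a^ r b^ 0F) = +-cong (*-identityʳ _) (*-identityʳ _)
            average (a^ r b^ 1F) = solve 2 (λ x d → x :* (d :* con (+ 1)) :+ x :* ((:- d) :* con (+ 1))
              := con (+ 0) :+ con (+ 0)) refl ((ξ ^ k) ^ toℕ r) d
            average (a^ r b^ 2F) = trans (solve 2 (λ x d → x :* (d :* (d :* con (+ 1))) :+ x :* ((:- d) :* ((:- d) :* con (+ 1)))
              := x :* (d :* d) :+ x :* (d :* d)) refl ((ξ ^ k) ^ toℕ r) d) (+-cong (*-congˡ d²) (*-congˡ d²))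
            average (a^ r b^ 3F) = solve 2 (λ x d → x :* (d :* (d :* (d :* con (+ 1))))
              :+ x :* ((:- d) :* ((:- d) :* ((:- d) :* con (+ 1)))) := con (+ 0) :+ con (+ 0)) refl ((ξ ^ k) ^ toℕ r) d
            V : Scalar
            V = ∑ enum (λ x → w x * coefficient₀₀ k c x)
            V+V≈ : V + V ≈ ∑ enum (λ x → w x * character (ξ ^ k) d x) + ∑ enum (λ x → w x * character (ξ ^ k) (- d) x)
            V+V≈ = begin
              V + V
                ≈⟨ ∑-+ enum (λ x → w x * coefficient₀₀ k c x) (λ x → w x * coefficient₀₀ k c x) ⟨
              ∑ enum (λ x → w x * coefficient₀₀ k c x + w x * coefficient₀₀ k c x)
                ≈⟨ ∑-cong enum (λ x → trans (sym (distribˡ (w x) _ _)) (trans (*-congˡ {w x} (sym (average x))) (distribˡ (w x) _ _))) ⟩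
              ∑ enum (λ x → w x * character (ξ ^ k) d x + w x * character (ξ ^ k) (- d) x)
                ≈⟨ ∑-+ enum (λ x → w x * character (ξ ^ k) d x) (λ x → w x * character (ξ ^ k) (- d) x) ⟩
              ∑ enum (λ x → w x * character (ξ ^ k) d x) + ∑ enum (λ x → w x * character (ξ ^ k) (- d) x) ∎
            combine : ∑ enum (λ x → w x * character (ξ ^ k) d x) ≈ 0# ⊎ IsInteger μ →
              ∑ enum (λ x → w x * character (ξ ^ k) (- d) x) ≈ 0# ⊎ IsInteger μ → Dichotomy k c
            combine (inj₂ integer) _              = inj₂ integer
            combine (inj₁ _)       (inj₂ integer) = inj₂ integer
            combine (inj₁ +≈0)     (inj₁ -≈0)     =
              inj₁ (x+x≈0⇒x≈0 (trans V+V≈ (trans (+-cong +≈0 -≈0) (+-identityˡ 0#))))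

        quadratic-dichotomy : ∀ k {c} → c * c ≈ [-1]^ k → IntegralSquares (trace (ξ ^ k) (ξ⁻¹ ^ k) c) → Dichotomy k c
        quadratic-dichotomy k c²≈ squares = IntegralSquares⇒≈0⊎integer (ξ-parameters k c²≈) squares {μ} {w} pairing

        -- The indices 0 and n, where ξᵏ = ± 1, lie outside the range of φ and ψ and are left to the
        -- linear characters; those above n fold back to 2n - k.
        dichotomy : ∀ k {c} → k ℕ.< 2 ℕ.* n → c * c ≈ [-1]^ k → Dichotomy k c
        dichotomy zero    _ c²≈ = split-dichotomy 0 c²≈ (*-identityˡ 1#)
        dichotomy k@(suc _) {c} k<2n c²≈ = go (ℕ.<-cmp k n)
          where
          go : Tri (k ℕ.< n) (k ≡ n) (n ℕ.< k) → Dichotomy k c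
          go (tri< k<n _ _) = quadratic-dichotomy k c²≈ (trace-squares k (ℕ.s≤s ℕ.z≤n) k<n c²≈)
          go (tri≈ _ k≡n _) = split-dichotomy k c²≈ (≡.subst (λ m → ξ ^ m * ξ ^ m ≈ 1#) (≡.sym k≡n)
            (trans (*-cong ξ^n≈-1 ξ^n≈-1) -1*-1≈1))
          go (tri> _ _ n<k) = quadratic-dichotomy k c²≈ (trace-squares′ k n<k k<2n c²≈)

      conditions⇒integral : Integral
      conditions⇒integral μ eigenvalue = go (eigenvalue-pairing eigenvalue)
        where
        go : (∃ λ (w : Normal n → Scalar) → w ε # 0# × (∀ (f : Normal n → Scalar) →
          μ * ∑ enum (λ x → w x * f x) ≈ ∑ enum (λ y → w y * ∑ enum (λ z → s z * f (y ∙ z))))) → IsInteger μ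
        go (w , wε#0 , pairing) = conclude (all-or (2 ℕ.* n) λ k → both
            (dichotomy {μ} {w} pairing (toℕ k) (toℕ<n k) (i^k-squared (toℕ k)))
            (dichotomy {μ} {w} pairing (toℕ k) (toℕ<n k) (-i^k-squared (toℕ k))))
          where
          both : ∀ {a b} {A : Set a} {A′ : Set a} {B : Set b} → A ⊎ B → A′ ⊎ B → (A × A′) ⊎ B
          both (inj₁ x) (inj₁ y) = inj₁ (x , y)
          both (inj₁ _) (inj₂ y) = inj₂ y
          both (inj₂ x) _        = inj₂ x
          conclude : (∀ (k : Fin (2 ℕ.* n)) → ∑ enum (λ x → w x * coefficient₀₀ (toℕ k) (i ^ toℕ k) x) ≈ 0#
              × ∑ enum (λ x → w x * coefficient₀₀ (toℕ k) (- (i ^ toℕ k)) x) ≈ 0#) ⊎ IsInteger μ → IsInteger μ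
          conclude (inj₂ integer)        = integer
          -- If every coefficient vanished, inversion would give w ε = 0, against the choice of w.
          conclude (inj₁ coefficients≈0) = contradiction (coefficients≈0⇒≈0 w coefficients≈0) (#⇒≉ wε#0)

    integral⇔conditions : Integral ⇔ Conditions χ φ ψ
    integral⇔conditions = mk⇔ integral⇒conditions conditions⇒integral

classification : ∀ {c ℓ₁ ℓ₂} (K : AlgClosedField₀ c ℓ₁ ℓ₂) (n : ℕ) .{{_ : NonZero n}} (prim : PrimitiveRoot K (8 ℕ.* n)) →
  let open Characters K n prim in RootsOfUnity.Classification K n prim χ φ ψ
classification K n prim = go (parity n)
  where
  open Characters K n prim
  -- The Boolean is abstracted so that one parity equation selects the branch of χ, φ and ψ
  -- simultaneously.
  Classified : Bool → Set _
  Classified b = RootsOfUnity.Classification K n prim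
    (if b then Even.χ else Odd.χ) (if b then Even.φ else Odd.φ) (if b then Even.ψ else Odd.ψ)
  go : Parity n → Classified (isEven n)
  go (even q n≡2q isEven-n)  = ≡.subst Classified (≡.sym isEven-n) (EvenClassification.classification K n prim q n≡2q)
  go (odd q n≡1+2q isEven-n) = ≡.subst Classified (≡.sym isEven-n) (OddClassification.classification K n prim q n≡1+2q)

open import Data.Nat.Base using (_*_; _≤_; _<_)

theorem3p1 :
  ∀ {c ℓ₁ ℓ₂ p} (K : AlgClosedField₀ c ℓ₁ ℓ₂) (n : ℕ) .{{_ : NonZero n}} (ζ : PrimitiveRoot K (8 * n)) →
  let open Scalars K
      open Spectrum K
      open FiniteGroup (T n) using (_⁻¹ˢ)
      open CharacterSums K (T n)
      open Characters K n ζ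
      open Discriminant K (T n)
  in
  (S₁ S₂ : Pred (Normal n) p) (S₁? : Decidable S₁) (S₂? : Decidable S₂) →
  S₁ ⊆ ⟨a⟩b^ 0F ∪ ⟨a⟩b^ 2F →
  S₂ ⊆ ⟨a⟩b^ 1F ∪ ⟨a⟩b^ 3F →
  Satisfiable (S₁ ∪ S₂) →
  (ε∉S : FiniteGroup.ε (T n) ∉ S₁ ∪ S₂) →
  (S≐S⁻¹ : (S₁ ∪ S₂) ≐ (S₁ ∪ S₂) ⁻¹ˢ) →
  Integral (Cay (T n) (S₁? ∪? S₂?) ε∉S S≐S⁻¹)
  ⇔ ( (∀ (j : Fin 8) → IsInteger (χ j ⟪ S₁? ∪? S₂? ⟫))
    × (∀ k → 1 ≤ k → k < n → IsInteger (φ k ⟪ S₁? ⟫) × IsInteger (squares S₁? S₂? (φ k)))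
    × (∀ k → 1 ≤ k → k < n → IsPerfectSquare (Δ S₁? S₂? (φ k)))
    × (∀ h → 1 ≤ h → h < n → IsInteger (ψ h ⟪ S₁? ⟫) × IsInteger (squares S₁? S₂? (ψ h)))
    × (∀ h → 1 ≤ h → h < n → IsPerfectSquare (Δ S₁? S₂? (ψ h))) )
theorem3p1 K n ζ S₁ S₂ S₁? S₂? S₁⊆ S₂⊆ _ ε∉S S≐S⁻¹ =
  CayleyIntegrality.integral⇔conditions K n ζ S₁? S₂? S₁⊆ S₂⊆ ε∉S S≐S⁻¹ (classification K n ζ)
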